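{- Let $CP_3(n)$ be defined by $\sum_{n\ge 0} CP_3(n)q^n = \dfrac{f_3^6f_6^6}{f_1^2f_2^2}$. Then for all integers $n\ge 0$, \[ CP_3(24n+15)\equiv 0\pmod{16},\qquad CP_3(24n+21)\equiv 0\pmod{16}. \]
   Context: For $|q|<1$ and integer $m\ge 1$, $f_m := (q^m;q^m)_\infty=\prod_{n\ge1}(1-q^{mn})$. $CP_3(n)$ is the number of $3$-core cubic bipartitions of $n$, defined by the generating function $\sum_{n\ge0}CP_3(n)q^n = \frac{f_3^6f_6^6}{f_1^2f_2^2}$. -}

module Defs where

open import Data.Nat using (ℕ; zero; suc; _≤ᵇ_)
open import Data.Integer using (ℤ; _+_; _*_; -_; 0ℤ; 1ℤ; _-_)
open import Data.Bool using (if_then_else_)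
open import Data.List using (List; []; _∷_; foldr; map; upTo; zipWith)
open import Data.Nat.Base using (_∸_)
import Data.Nat as ℕ

sumℤ : List ℤ → ℤ
sumℤ = foldr _+_ 0ℤ

Series : Set
Series = ℕ → ℤ

_·_ : Series → Series → Series
(a · b) n = sumℤ (map (λ k → a k * b (n ∸ k)) (upTo (suc n)))

one : Series
one zero    = 1ℤ
one (suc _) = 0ℤ

_^_ : Series → ℕ → Series
a ^ zero  = one
a ^ suc k = a · (a ^ k)

oneMinusQ^ : ℕ → Series
oneMinusQ^ d n = (if n ℕ.≡ᵇ 0 then 1ℤ else 0ℤ) - (if n ℕ.≡ᵇ d then 1ℤ else 0ℤ)

finProd : ℕ → ℕ → Series
finProd m zero    = one
finProd m (suc N) = oneMinusQ^ (m ℕ.* suc N) · finProd m N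

-- f_m = ∏_{n≥1} (1 - q^{m n}), for m ≥ 1.  Coefficient of q^n is determined
-- by the factors with m j ≤ n, so for m ≥ 1 it equals the coefficient of q^n
-- in the finite product over j = 1..n.
f : ℕ → Series
f m n = finProd m n n

-- Multiplicative inverse of a series with constant term 1:
-- b 0 = 1,  b n = - Σ_{k=1}^{n} a k * b (n - k).
-- Computed by building the list [b n, b (n-1), ..., b 0].
private
  invList : Series → ℕ → List ℤ
  invList a zero    = 1ℤ ∷ []
  invList a (suc n) = let bs = invList a n
                          s  = sumℤ (zipWith _*_ (map (λ k → a (suc k)) (upTo (suc n))) bs)
                      in (- s) ∷ bs

  head0 : List ℤ → ℤ
  head0 []      = 0ℤ
  head0 (x ∷ _) = x

inv : Series → Series
inv a n = head0 (invList a n)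

-- Generating function of 3-core cubic bipartitions: f_3^6 f_6^6 / (f_1^2 f_2^2)
CP3series : Series
CP3series = ((f 3 ^ 6) · (f 6 ^ 6)) · inv ((f 1 ^ 2) · (f 2 ^ 2))

CP3 : ℕ → ℤ
CP3 n = CP3series n

{-# OPTIONS --safe #-}
module Submission where

-- Write F for the generating function, φ(-q) = f₁²/f₂ = 1 + 2 S(q) and ψ(q) = f₂²/f₁.  Then
-- F φ(-q) φ(-q³) f₂³ = φ(-q³)⁴ f₆⁹, where φ(-q³)⁴ ≡ 1 + 8 (S(q³) + S(q³)²) mod 16 and
-- φ(-q) φ(-q³) = U - 2 v with U even and v = q ψ(q²) ψ(q⁶).  Multiplying by U + 2 v and taking odd
-- parts gives, modulo 16, the odd part of F as a sum of two terms.  The first is congruent to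
-- 2 q f₁₂⁶ φ(-q⁶)², because (U² - 4 v²) φ(-q²)² ≡ φ(-q⁶)² mod 8; its exponents are 1 mod 6.
-- The second is 8 times the odd part of S(q³) times f₆⁹/f₂³, and modulo 2 the latter is
-- q⁻² (S(q²) + S(q⁴) + S(q⁶) + S(q¹²)), since it is a root of the same quadratic equation.  Since S
-- is a series in the squares, neither term meets the exponents 15 and 21 mod 24.
--
-- The identities of Gauss for φ and ψ follow from telescoping the partial sums of q-binomial series
-- (Shanks); the formula for v comes from a substitution in the quadratic form x² + 3 y².

open import Defs
open import Data.Nat using (ℕ; zero; suc; _+_; _*_; _∸_; _≤_; _<_; z≤n; s≤s)
open import Data.Integer using (ℤ; +_; -[1+_]; 0ℤ; 1ℤ; -_; ∣_∣)
open import Data.Integer.Divisibility using (_∣_)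
open import Data.Product using (_×_; _,_; proj₁; proj₂; ∃)
open import Data.Sum using (_⊎_; inj₁; inj₂)
open import Data.Bool using (Bool; true; false; if_then_else_; _xor_; _∧_; not)
open import Data.Empty using (⊥; ⊥-elim)
open import Data.List using (List; map; upTo; applyUpTo)
open import Data.Maybe using (Maybe; just; nothing)
open import Data.Nat.DivMod using (_%_; _/_; m≡m%n+[m/n]*n; m%n<n; m*n%n≡0; %-distribˡ-+; [m+kn]%n≡m%n)
open import Function using (_∘_)
open import Level using (0ℓ)
open import Relation.Nullary using (yes; no)
open import Relation.Nullary.Decidable using (Dec; from-yes; ¬?; _→-dec_; _×-dec_)
open import Relation.Binary.PropositionalEquality using (_≡_; _≢_; refl; sym; trans; cong; cong₂; subst; module ≡-Reasoning)
open import Algebra.Bundles using (CommutativeRing; Semiring)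
open import Algebra.Solver.Ring.AlmostCommutativeRing using (fromCommutativeRing; _-Raw-AlmostCommutative⟶_)
open import Tactic.Cong using (cong!)
import Algebra.Definitions.RawSemiring as Exponentiation
import Algebra.Solver.Ring as RingSolver
import Data.Nat as ℕ
import Data.Nat.Properties as ℕₚ
import Data.Nat.Tactic.RingSolver as ℕ-Solver
import Data.Integer as ℤ
import Data.Integer.Divisibility.Signed as Signed
import Data.Integer.Properties as ℤₚ
import Data.Integer.Tactic.RingSolver as ℤ-Solver
import Data.List.Properties as Listₚ
import Relation.Binary.Reasoning.Setoid as SetoidReasoning

-- The factor φ(-q³) is brought in because the odd part of φ(-q) φ(-q³) is a single product with an
-- explicit factor 2; as f₂ and f₆ are series in q², they pass through the odd part unchanged. That
-- 2, and the 8 from the fourth power, divide the work: the first term need only be known modulo 8,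
-- the second only modulo 2. Modulo 2 squaring is the substitution q ↦ q², so identities between
-- theta series turn into algebraic equations. The quadratic equation comes from S(q) + S(q³): its
-- square is S(q²) + S(q⁶), and its odd part is q f₂³ f₆³ by the Gauss products and q f₂¹² + q³ f₆¹²
-- by the odd squares. The classes 15 and 21 modulo 24 are what remains of the class 3 modulo 6: for
-- 3 and 9 modulo 24 the second term can meet exponents 2 s² ≡ 2 and 8.

_+ˢ_ : Series → Series → Series
(a +ˢ b) n = a n ℤ.+ b n

const : ℤ → Series
const c zero    = c
const c (suc _) = 0ℤ

tail : Series → Series
tail a n = a (suc n)

scale : ℤ → Series → Series
scale c a n = c ℤ.* a n

-- Ring laws of the Cauchy product

∑< : ℕ → (ℕ → ℤ) → ℤ
∑< n t = sumℤ (applyUpTo t n)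

∑<-cong : ∀ n {t u : ℕ → ℤ} → (∀ i → i < n → t i ≡ u i) → ∑< n t ≡ ∑< n u
∑<-cong zero    h = refl
∑<-cong (suc n) h = cong₂ ℤ._+_ (h 0 (s≤s z≤n)) (∑<-cong n λ i i<n → h (suc i) (s≤s i<n))

·-sum : ∀ a b n → (a · b) n ≡ ∑< (suc n) (λ k → a k ℤ.* b (n ∸ k))
·-sum a b n = cong sumℤ (Listₚ.map-upTo (λ k → a k ℤ.* b (n ∸ k)) (suc n))

·-zero : ∀ a b → (a · b) 0 ≡ a 0 ℤ.* b 0
·-zero a b = ℤₚ.+-identityʳ _

-- Peeling the constant term off the left factor turns the convolution into a recursion on `tail`,
-- so the ring laws below are inductions on the exponent, without reindexing double sums.
·-suc : ∀ a b n → (a · b) (suc n) ≡ a 0 ℤ.* b (suc n) ℤ.+ (tail a · b) n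
·-suc a b n = trans (·-sum a b (suc n)) (cong (λ s → a 0 ℤ.* b (suc n) ℤ.+ s) (sym (·-sum (tail a) b n)))

·-cong-≤ : ∀ a a′ b b′ n → (∀ k → k ≤ n → a k ≡ a′ k) → (∀ k → k ≤ n → b k ≡ b′ k) → (a · b) n ≡ (a′ · b′) n
·-cong-≤ a a′ b b′ n p q = begin
  (a · b) n ≡⟨ ·-sum a b n ⟩
  ∑< (suc n) (λ k → a k ℤ.* b (n ∸ k))
    ≡⟨ ∑<-cong (suc n) (λ { k (s≤s k≤n) → cong₂ ℤ._*_ (p k k≤n) (q (n ∸ k) (ℕₚ.m∸n≤m n k)) }) ⟩
  ∑< (suc n) (λ k → a′ k ℤ.* b′ (n ∸ k)) ≡⟨ ·-sum a′ b′ n ⟨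
  (a′ · b′) n ∎
  where open ≡-Reasoning

·-distribʳ : ∀ a b c n → ((a +ˢ b) · c) n ≡ ((a · c) +ˢ (b · c)) n
·-distribʳ a b c zero    = trans (·-zero (a +ˢ b) c) (trans (ℤₚ.*-distribʳ-+ (c 0) (a 0) (b 0)) (sym (cong₂ ℤ._+_ (·-zero a c) (·-zero b c))))
·-distribʳ a b c (suc n) = begin
  ((a +ˢ b) · c) (suc n) ≡⟨ ·-suc (a +ˢ b) c n ⟩
  (a 0 ℤ.+ b 0) ℤ.* c (suc n) ℤ.+ ((tail a +ˢ tail b) · c) n ≡⟨ cong (λ s → (a 0 ℤ.+ b 0) ℤ.* c (suc n) ℤ.+ s) (·-distribʳ (tail a) (tail b) c n) ⟩
  (a 0 ℤ.+ b 0) ℤ.* c (suc n) ℤ.+ ((tail a · c) n ℤ.+ (tail b · c) n) ≡⟨ shuffle (a 0) (b 0) (c (suc n)) _ _ ⟩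
  (a 0 ℤ.* c (suc n) ℤ.+ (tail a · c) n) ℤ.+ (b 0 ℤ.* c (suc n) ℤ.+ (tail b · c) n) ≡⟨ cong₂ ℤ._+_ (·-suc a c n) (·-suc b c n) ⟨
  (a · c) (suc n) ℤ.+ (b · c) (suc n) ∎
  where
  open ≡-Reasoning
  shuffle : ∀ x y z u v → (x ℤ.+ y) ℤ.* z ℤ.+ (u ℤ.+ v) ≡ (x ℤ.* z ℤ.+ u) ℤ.+ (y ℤ.* z ℤ.+ v)
  shuffle = ℤ-Solver.solve-∀

scale-· : ∀ c a b n → (scale c a · b) n ≡ (scale c (a · b)) n
scale-· c a b zero    = trans (·-zero (scale c a) b) (trans (ℤₚ.*-assoc c (a 0) (b 0)) (cong (c ℤ.*_) (sym (·-zero a b))))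
scale-· c a b (suc n) = begin
  (scale c a · b) (suc n) ≡⟨ ·-suc (scale c a) b n ⟩
  c ℤ.* a 0 ℤ.* b (suc n) ℤ.+ (scale c (tail a) · b) n ≡⟨ cong (λ s → c ℤ.* a 0 ℤ.* b (suc n) ℤ.+ s) (scale-· c (tail a) b n) ⟩
  c ℤ.* a 0 ℤ.* b (suc n) ℤ.+ c ℤ.* (tail a · b) n ≡⟨ shuffle c (a 0) (b (suc n)) _ ⟩
  c ℤ.* (a 0 ℤ.* b (suc n) ℤ.+ (tail a · b) n) ≡⟨ cong (c ℤ.*_) (·-suc a b n) ⟨
  c ℤ.* (a · b) (suc n) ∎
  where
  open ≡-Reasoning
  shuffle : ∀ x y z u → x ℤ.* y ℤ.* z ℤ.+ x ℤ.* u ≡ x ℤ.* (y ℤ.* z ℤ.+ u)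
  shuffle = ℤ-Solver.solve-∀

·-assoc : ∀ a b c n → ((a · b) · c) n ≡ (a · (b · c)) n
·-assoc a b c zero    = begin
  ((a · b) · c) 0      ≡⟨ ·-zero (a · b) c ⟩
  (a · b) 0 ℤ.* c 0    ≡⟨ cong (ℤ._* c 0) (·-zero a b) ⟩
  a 0 ℤ.* b 0 ℤ.* c 0  ≡⟨ ℤₚ.*-assoc (a 0) (b 0) (c 0) ⟩
  a 0 ℤ.* (b 0 ℤ.* c 0) ≡⟨ cong (a 0 ℤ.*_) (·-zero b c) ⟨
  a 0 ℤ.* (b · c) 0    ≡⟨ ·-zero a (b · c) ⟨
  (a · (b · c)) 0      ∎
  where open ≡-Reasoning
·-assoc a b c (suc n) = begin
  ((a · b) · c) (suc n)
    ≡⟨ ·-suc (a · b) c n ⟩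
  (a · b) 0 ℤ.* c (suc n) ℤ.+ (tail (a · b) · c) n
    ≡⟨ cong₂ (λ x y → x ℤ.* c (suc n) ℤ.+ y) (·-zero a b) (·-cong-≤ (tail (a · b)) (scale (a 0) (tail b) +ˢ (tail a · b)) c c n (λ k _ → ·-suc a b k) (λ k _ → refl)) ⟩
  a 0 ℤ.* b 0 ℤ.* c (suc n) ℤ.+ ((scale (a 0) (tail b) +ˢ (tail a · b)) · c) n
    ≡⟨ cong (λ x → a 0 ℤ.* b 0 ℤ.* c (suc n) ℤ.+ x) (·-distribʳ (scale (a 0) (tail b)) (tail a · b) c n) ⟩
  a 0 ℤ.* b 0 ℤ.* c (suc n) ℤ.+ ((scale (a 0) (tail b) · c) n ℤ.+ ((tail a · b) · c) n)
    ≡⟨ cong₂ (λ x y → a 0 ℤ.* b 0 ℤ.* c (suc n) ℤ.+ (x ℤ.+ y)) (scale-· (a 0) (tail b) c n) (·-assoc (tail a) b c n) ⟩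
  a 0 ℤ.* b 0 ℤ.* c (suc n) ℤ.+ (a 0 ℤ.* (tail b · c) n ℤ.+ (tail a · (b · c)) n)
    ≡⟨ shuffle (a 0) (b 0) (c (suc n)) _ _ ⟩
  a 0 ℤ.* (b 0 ℤ.* c (suc n) ℤ.+ (tail b · c) n) ℤ.+ (tail a · (b · c)) n
    ≡⟨ cong (λ x → a 0 ℤ.* x ℤ.+ (tail a · (b · c)) n) (·-suc b c n) ⟨
  a 0 ℤ.* (b · c) (suc n) ℤ.+ (tail a · (b · c)) n
    ≡⟨ ·-suc a (b · c) n ⟨
  (a · (b · c)) (suc n) ∎
  where
  open ≡-Reasoning
  shuffle : ∀ x y z u v → x ℤ.* y ℤ.* z ℤ.+ (x ℤ.* u ℤ.+ v) ≡ x ℤ.* (y ℤ.* z ℤ.+ u) ℤ.+ v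
  shuffle = ℤ-Solver.solve-∀

-- Peeling at the other end. Commutativity needs both ends, and so does the pairing of symmetric
-- terms in a square.
·-sucʳ : ∀ a b n → (a · b) (suc n) ≡ a (suc n) ℤ.* b 0 ℤ.+ (a · tail b) n
·-sucʳ a b zero    = begin
  (a · b) 1 ≡⟨ ·-suc a b 0 ⟩
  a 0 ℤ.* b 1 ℤ.+ (tail a · b) 0 ≡⟨ cong (λ x → a 0 ℤ.* b 1 ℤ.+ x) (·-zero (tail a) b) ⟩
  a 0 ℤ.* b 1 ℤ.+ a 1 ℤ.* b 0 ≡⟨ ℤₚ.+-comm (a 0 ℤ.* b 1) _ ⟩
  a 1 ℤ.* b 0 ℤ.+ a 0 ℤ.* b 1 ≡⟨ cong (λ x → a 1 ℤ.* b 0 ℤ.+ x) (·-zero a (tail b)) ⟨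
  a 1 ℤ.* b 0 ℤ.+ (a · tail b) 0 ∎
  where open ≡-Reasoning
·-sucʳ a b (suc n) = begin
  (a · b) (2 + n) ≡⟨ ·-suc a b (suc n) ⟩
  a 0 ℤ.* b (2 + n) ℤ.+ (tail a · b) (suc n) ≡⟨ cong (λ x → a 0 ℤ.* b (2 + n) ℤ.+ x) (·-sucʳ (tail a) b n) ⟩
  a 0 ℤ.* b (2 + n) ℤ.+ (a (2 + n) ℤ.* b 0 ℤ.+ (tail a · tail b) n) ≡⟨ shuffle (a 0 ℤ.* b (2 + n)) (a (2 + n) ℤ.* b 0) _ ⟩
  a (2 + n) ℤ.* b 0 ℤ.+ (a 0 ℤ.* b (2 + n) ℤ.+ (tail a · tail b) n) ≡⟨ cong (λ x → a (2 + n) ℤ.* b 0 ℤ.+ x) (·-suc a (tail b) n) ⟨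
  a (2 + n) ℤ.* b 0 ℤ.+ (a · tail b) (suc n) ∎
  where
  open ≡-Reasoning
  shuffle : ∀ x y z → x ℤ.+ (y ℤ.+ z) ≡ y ℤ.+ (x ℤ.+ z)
  shuffle = ℤ-Solver.solve-∀

·-comm : ∀ a b n → (a · b) n ≡ (b · a) n
·-comm a b zero    = trans (·-zero a b) (trans (ℤₚ.*-comm (a 0) (b 0)) (sym (·-zero b a)))
·-comm a b (suc n) = begin
  (a · b) (suc n) ≡⟨ ·-suc a b n ⟩
  a 0 ℤ.* b (suc n) ℤ.+ (tail a · b) n ≡⟨ cong₂ ℤ._+_ (ℤₚ.*-comm (a 0) (b (suc n))) (·-comm (tail a) b n) ⟩
  b (suc n) ℤ.* a 0 ℤ.+ (b · tail a) n ≡⟨ ·-sucʳ b a n ⟨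
  (b · a) (suc n) ∎
  where open ≡-Reasoning

0-· : ∀ a b → (∀ n → a n ≡ 0ℤ) → ∀ n → (a · b) n ≡ 0ℤ
0-· a b h zero    = trans (·-zero a b) (cong (ℤ._* b 0) (h 0))
0-· a b h (suc n) = trans (·-suc a b n) (cong₂ ℤ._+_ (cong (ℤ._* b (suc n)) (h 0)) (0-· (tail a) b (h ∘ suc) n))

const-· : ∀ c a n → (const c · a) n ≡ c ℤ.* a n
const-· c a zero    = ·-zero (const c) a
const-· c a (suc n) = trans (·-suc (const c) a n) (trans (cong (λ x → c ℤ.* a (suc n) ℤ.+ x) (0-· (tail (const c)) a (λ _ → refl) n)) (ℤₚ.+-identityʳ _))

const-zero : ∀ n → const 0ℤ n ≡ 0ℤ
const-zero zero    = refl
const-zero (suc n) = refl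

-- Without η, and with the operations defined by copatterns, an expression in the ring of power
-- series is never unfolded into its coefficients during unification.
record PS : Set where
  no-eta-equality
  constructor series
  field
    coeff : Series

open PS

-- The commutative ring of power series

infix  4 _≈_
infixl 6 _⊕_
infixl 7 _⊗_
infix  8 ⊖_

record _≈_ (x y : PS) : Set where
  constructor coeffwise
  field
    at : ∀ n → coeff x n ≡ coeff y n

open _≈_

_⊕_ _⊗_ : PS → PS → PS
coeff (x ⊕ y) n = coeff x n ℤ.+ coeff y n
coeff (x ⊗ y)   = coeff x · coeff y

⊖_ : PS → PS
coeff (⊖ x) n = - coeff x n

κ : ℤ → PS
coeff (κ c) = const c

≈-refl : ∀ {x} → x ≈ x
≈-refl = coeffwise λ n → refl

≈-sym : ∀ {x y} → x ≈ y → y ≈ x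
≈-sym p = coeffwise λ n → sym (at p n)

≈-trans : ∀ {x y z} → x ≈ y → y ≈ z → x ≈ z
≈-trans p q = coeffwise λ n → trans (at p n) (at q n)

⊕-cong : ∀ {x x′ y y′} → x ≈ x′ → y ≈ y′ → x ⊕ y ≈ x′ ⊕ y′
⊕-cong p q = coeffwise λ n → cong₂ ℤ._+_ (at p n) (at q n)

⊗-cong : ∀ {x x′ y y′} → x ≈ x′ → y ≈ y′ → x ⊗ y ≈ x′ ⊗ y′
⊗-cong {x} {x′} {y} {y′} p q = coeffwise λ n → ·-cong-≤ (coeff x) (coeff x′) (coeff y) (coeff y′) n (λ k _ → at p k) (λ k _ → at q k)

⊗-comm : ∀ x y → x ⊗ y ≈ y ⊗ x
⊗-comm x y = coeffwise (·-comm (coeff x) (coeff y))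

⊗-distribʳ : ∀ z x y → (x ⊕ y) ⊗ z ≈ x ⊗ z ⊕ y ⊗ z
⊗-distribʳ z x y = coeffwise (·-distribʳ (coeff x) (coeff y) (coeff z))

⊗-identityˡ : ∀ x → κ 1ℤ ⊗ x ≈ x
⊗-identityˡ x = coeffwise λ n → trans (const-· 1ℤ (coeff x) n) (ℤₚ.*-identityˡ _)

seriesRing : CommutativeRing 0ℓ 0ℓ
seriesRing = record
  { Carrier = PS ; _≈_ = _≈_ ; _+_ = _⊕_ ; _*_ = _⊗_ ; -_ = ⊖_ ; 0# = κ 0ℤ ; 1# = κ 1ℤ
  ; isCommutativeRing = record
    { isRing = record
      { +-isAbelianGroup = record
        { isGroup = record
          { isMonoid = record
            { isSemigroup = record
              { isMagma = record
                { isEquivalence = record { refl = ≈-refl ; sym = ≈-sym ; trans = ≈-trans }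
                ; ∙-cong = ⊕-cong }
              ; assoc = λ x y z → coeffwise λ n → ℤₚ.+-assoc (coeff x n) (coeff y n) (coeff z n) }
            ; identity = (λ x → coeffwise λ n → trans (cong (ℤ._+ coeff x n) (const-zero n)) (ℤₚ.+-identityˡ _))
                       , (λ x → coeffwise λ n → trans (cong (λ c → coeff x n ℤ.+ c) (const-zero n)) (ℤₚ.+-identityʳ _)) }
          ; inverse = (λ x → coeffwise λ n → trans (ℤₚ.+-inverseˡ (coeff x n)) (sym (const-zero n)))
                    , (λ x → coeffwise λ n → trans (ℤₚ.+-inverseʳ (coeff x n)) (sym (const-zero n)))
          ; ⁻¹-cong = λ p → coeffwise λ n → cong -_ (at p n) }
        ; comm = λ x y → coeffwise λ n → ℤₚ.+-comm (coeff x n) (coeff y n) }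
      ; *-cong = ⊗-cong
      ; *-assoc = λ x y z → coeffwise (·-assoc (coeff x) (coeff y) (coeff z))
      ; *-identity = ⊗-identityˡ , (λ x → ≈-trans (⊗-comm x (κ 1ℤ)) (⊗-identityˡ x))
      ; distrib = (λ z x y → ≈-trans (⊗-comm z (x ⊕ y)) (≈-trans (⊗-distribʳ z x y) (⊕-cong (⊗-comm x z) (⊗-comm y z))))
                , ⊗-distribʳ }
    ; *-comm = ⊗-comm } }

κ-* : ∀ c d → κ (c ℤ.* d) ≈ κ c ⊗ κ d
κ-* c d = coeffwise λ
  { zero    → sym (const-· c (const d) 0)
  ; (suc n) → trans (sym (ℤₚ.*-zeroʳ c)) (sym (const-· c (const d) (suc n))) }

-- Integer coefficients have decidable equality, so the ring solver can compute with constants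
-- inside a ring whose own equality is not decidable.
κ-morphism : CommutativeRing.rawRing ℤₚ.+-*-commutativeRing -Raw-AlmostCommutative⟶ fromCommutativeRing seriesRing
κ-morphism = record
  { ⟦_⟧ = κ
  ; +-homo = λ c d → coeffwise λ { zero → refl ; (suc n) → refl }
  ; *-homo = κ-*
  ; -‿homo = λ c → coeffwise λ { zero → refl ; (suc n) → refl }
  ; 0-homo = ≈-refl
  ; 1-homo = ≈-refl }

κ≟ : ∀ c d → Maybe (κ c ≈ κ d)
κ≟ c d with c ℤ.≟ d
... | yes refl = just ≈-refl
... | no _     = nothing

module PS-Solver = RingSolver (CommutativeRing.rawRing ℤₚ.+-*-commutativeRing) (fromCommutativeRing seriesRing) κ-morphism κ≟
open PS-Solver using (_:=_; _:+_; _:*_; _:^_; _:-_; :-_; con)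
open Exponentiation (Semiring.rawSemiring (CommutativeRing.semiring seriesRing)) using () renaming (_^_ to infixr 8 _^ᴾ_)
module ≈-Reasoning = SetoidReasoning (CommutativeRing.setoid seriesRing)

-- Finite sums

∑ : ℕ → (ℕ → ℤ) → ℤ
∑ zero    t = 0ℤ
∑ (suc n) t = ∑ n t ℤ.+ t n

∑-cong : ∀ n {t u : ℕ → ℤ} → (∀ i → i < n → t i ≡ u i) → ∑ n t ≡ ∑ n u
∑-cong zero    h = refl
∑-cong (suc n) h = cong₂ ℤ._+_ (∑-cong n λ i i<n → h i (ℕₚ.m<n⇒m<1+n i<n)) (h n ℕₚ.≤-refl)

∑-const-0 : ∀ n → ∑ n (λ _ → 0ℤ) ≡ 0ℤ
∑-const-0 zero    = refl
∑-const-0 (suc n) = trans (ℤₚ.+-identityʳ _) (∑-const-0 n)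

∑-zero : ∀ n {t : ℕ → ℤ} → (∀ i → i < n → t i ≡ 0ℤ) → ∑ n t ≡ 0ℤ
∑-zero n h = trans (∑-cong n h) (∑-const-0 n)

∑-+ : ∀ n (t u : ℕ → ℤ) → ∑ n (λ i → t i ℤ.+ u i) ≡ ∑ n t ℤ.+ ∑ n u
∑-+ zero    t u = refl
∑-+ (suc n) t u = trans (cong (ℤ._+ (t n ℤ.+ u n)) (∑-+ n t u)) (shuffle (∑ n t) (∑ n u) (t n) (u n))
  where
  shuffle : ∀ a b c d → a ℤ.+ b ℤ.+ (c ℤ.+ d) ≡ a ℤ.+ c ℤ.+ (b ℤ.+ d)
  shuffle = ℤ-Solver.solve-∀

∑-neg : ∀ n (t : ℕ → ℤ) → ∑ n (λ i → - t i) ≡ - ∑ n t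
∑-neg zero    t = refl
∑-neg (suc n) t = trans (cong (ℤ._+ - t n) (∑-neg n t)) (sym (ℤₚ.neg-distrib-+ (∑ n t) (t n)))

∑-first : ∀ n (t : ℕ → ℤ) → ∑ (suc n) t ≡ t 0 ℤ.+ ∑ n (t ∘ suc)
∑-first zero    t = ℤₚ.+-comm 0ℤ (t 0)
∑-first (suc n) t = trans (cong (ℤ._+ t (suc n)) (∑-first n t)) (ℤₚ.+-assoc (t 0) _ _)

∑-swap : ∀ m n (t : ℕ → ℕ → ℤ) → ∑ m (λ i → ∑ n (t i)) ≡ ∑ n (λ j → ∑ m (λ i → t i j))
∑-swap zero    n t = sym (∑-const-0 n)
∑-swap (suc m) n t = trans (cong (ℤ._+ ∑ n (t m)) (∑-swap m n t)) (sym (∑-+ n _ _))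

∑-double : ∀ n (t : ℕ → ℤ) → ∑ (n + n) t ≡ ∑ n (λ i → t (i + i) ℤ.+ t (suc (i + i)))
∑-double zero    t = refl
∑-double (suc n) t = begin
  ∑ (n + suc n) t ℤ.+ t (n + suc n) ≡⟨ cong (λ m → ∑ m t ℤ.+ t m) (ℕₚ.+-suc n n) ⟩
  ∑ (n + n) t ℤ.+ t (n + n) ℤ.+ t (suc (n + n)) ≡⟨ ℤₚ.+-assoc (∑ (n + n) t) _ _ ⟩
  ∑ (n + n) t ℤ.+ (t (n + n) ℤ.+ t (suc (n + n))) ≡⟨ cong (ℤ._+ (t (n + n) ℤ.+ t (suc (n + n)))) (∑-double n t) ⟩
  ∑ n (λ i → t (i + i) ℤ.+ t (suc (i + i))) ℤ.+ (t (n + n) ℤ.+ t (suc (n + n))) ∎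
  where open ≡-Reasoning

∑-stable : ∀ {m n} (t : ℕ → ℤ) → m ≤ n → (∀ i → m ≤ i → t i ≡ 0ℤ) → ∑ n t ≡ ∑ m t
∑-stable {m} t m≤n h = go (ℕₚ.≤⇒≤′ m≤n)
  where
  go : ∀ {n} → m ℕ.≤′ n → ∑ n t ≡ ∑ m t
  go (ℕ.≤′-reflexive refl) = refl
  go {suc n} (ℕ.≤′-step m≤′n) = trans (cong₂ ℤ._+_ (go m≤′n) (h n (ℕₚ.≤′⇒≤ m≤′n))) (ℤₚ.+-identityʳ _)

⨁ : ℕ → (ℕ → PS) → PS
⨁ zero    t = κ 0ℤ
⨁ (suc n) t = ⨁ n t ⊕ t n

coeff-⨁ : ∀ n t N → coeff (⨁ n t) N ≡ ∑ n (λ i → coeff (t i) N)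
coeff-⨁ zero    t N = const-zero N
coeff-⨁ (suc n) t N = cong (ℤ._+ coeff (t n) N) (coeff-⨁ n t N)

⨁-cong : ∀ n {t u : ℕ → PS} → (∀ i → t i ≈ u i) → ⨁ n t ≈ ⨁ n u
⨁-cong zero    h = ≈-refl
⨁-cong (suc n) h = ⊕-cong (⨁-cong n h) (h n)

⨁-distribˡ : ∀ n x t → x ⊗ ⨁ n t ≈ ⨁ n (λ i → x ⊗ t i)
⨁-distribˡ zero    x t = PS-Solver.solve 1 (λ x → x :* con 0ℤ := con 0ℤ) ≈-refl x
⨁-distribˡ (suc n) x t = ≈-trans (proj₁ (CommutativeRing.distrib seriesRing) x (⨁ n t) (t n)) (⊕-cong (⨁-distribˡ n x t) ≈-refl)

⨁-distribʳ : ∀ n x t → ⨁ n t ⊗ x ≈ ⨁ n (λ i → t i ⊗ x)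
⨁-distribʳ n x t = ≈-trans (⊗-comm (⨁ n t) x) (≈-trans (⨁-distribˡ n x t) (⨁-cong n λ i → ⊗-comm x (t i)))

-- Monomials and infinite sums

mono : ℕ → PS
coeff (mono e) n = if n ℕ.≡ᵇ e then 1ℤ else 0ℤ

coeff-mono-≢ : ∀ e n → n ≢ e → coeff (mono e) n ≡ 0ℤ
coeff-mono-≢ zero    zero    n≢e = ⊥-elim (n≢e refl)
coeff-mono-≢ zero    (suc n) n≢e = refl
coeff-mono-≢ (suc e) zero    n≢e = refl
coeff-mono-≢ (suc e) (suc n) n≢e = coeff-mono-≢ e n (n≢e ∘ cong suc)

coeff-mono-< : ∀ e n → n < e → coeff (mono e) n ≡ 0ℤ
coeff-mono-< e n n<e = coeff-mono-≢ e n (ℕₚ.<⇒≢ n<e)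

mono-0 : mono 0 ≈ κ 1ℤ
mono-0 = coeffwise λ { zero → refl ; (suc n) → refl }

mono-0-⊗ : ∀ x → mono 0 ⊗ x ≈ x
mono-0-⊗ x = ≈-trans (⊗-cong mono-0 ≈-refl) (⊗-identityˡ x)

mono-suc-⊗-0 : ∀ e x → coeff (mono (suc e) ⊗ x) 0 ≡ 0ℤ
mono-suc-⊗-0 e x = ·-zero (coeff (mono (suc e))) (coeff x)

mono-suc-⊗-suc : ∀ e x n → coeff (mono (suc e) ⊗ x) (suc n) ≡ coeff (mono e ⊗ x) n
mono-suc-⊗-suc e x n = trans (·-suc (coeff (mono (suc e))) (coeff x) n) (ℤₚ.+-identityˡ _)

coeff-mono-⊗ : ∀ e x n → coeff (mono e ⊗ x) (e + n) ≡ coeff x n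
coeff-mono-⊗ zero    x n = at (mono-0-⊗ x) n
coeff-mono-⊗ (suc e) x n = trans (mono-suc-⊗-suc e x (e + n)) (coeff-mono-⊗ e x n)

coeff-mono-⊗-< : ∀ e x n → n < e → coeff (mono e ⊗ x) n ≡ 0ℤ
coeff-mono-⊗-< (suc e) x zero    _         = mono-suc-⊗-0 e x
coeff-mono-⊗-< (suc e) x (suc n) (s≤s n<e) = trans (mono-suc-⊗-suc e x n) (coeff-mono-⊗-< e x n n<e)

mono-+ : ∀ d e → mono (d + e) ≈ mono d ⊗ mono e
mono-+ zero    e = ≈-sym (mono-0-⊗ (mono e))
mono-+ (suc d) e = coeffwise λ
  { zero    → sym (mono-suc-⊗-0 d (mono e))
  ; (suc n) → trans (at (mono-+ d e) n) (sym (mono-suc-⊗-suc d (mono e) n)) }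

-- Agreement up to a given exponent

infix 4 _≈_to_
record _≈_to_ (x y : PS) (N : ℕ) : Set where
  constructor upto
  field
    at-≤ : ∀ n → n ≤ N → coeff x n ≡ coeff y n

open _≈_to_

≈to-⊗ : ∀ {N x x′ y y′} → x ≈ x′ to N → y ≈ y′ to N → x ⊗ y ≈ x′ ⊗ y′ to N
≈to-⊗ {x = x} {x′} {y} {y′} p q = upto λ n n≤N →
  ·-cong-≤ (coeff x) (coeff x′) (coeff y) (coeff y′) n (λ k k≤n → at-≤ p k (ℕₚ.≤-trans k≤n n≤N)) (λ k k≤n → at-≤ q k (ℕₚ.≤-trans k≤n n≤N))

≈-to : ∀ {x y N} → x ≈ y → x ≈ y to N
≈-to p = upto λ n _ → at p n

to-trans : ∀ {x y z N} → x ≈ y to N → y ≈ z to N → x ≈ z to N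
to-trans p q = upto λ n n≤N → trans (at-≤ p n n≤N) (at-≤ q n n≤N)

to-sym : ∀ {x y N} → x ≈ y to N → y ≈ x to N
to-sym p = upto λ n n≤N → sym (at-≤ p n n≤N)

to-weaken : ∀ {x y M N} → M ≤ N → x ≈ y to N → x ≈ y to M
to-weaken M≤N p = upto λ n n≤M → at-≤ p n (ℕₚ.≤-trans n≤M M≤N)

to-all : ∀ {x y} → (∀ N → x ≈ y to N) → x ≈ y
to-all p = coeffwise λ n → at-≤ (p n) n ℕₚ.≤-refl

-- An infinite sum of series t i of order at least i.
lim : (ℕ → PS) → PS
coeff (lim t) N = ∑ (suc N) (λ i → coeff (t i) N)

Order : (ℕ → PS) → Set
Order t = ∀ i N → N < i → coeff (t i) N ≡ 0ℤ

lim-∑ : ∀ {t} → Order t → ∀ {M N} → N < M → coeff (lim t) N ≡ ∑ M (λ i → coeff (t i) N)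
lim-∑ {t} o {M} {N} N<M = sym (∑-stable (λ i → coeff (t i) N) N<M λ i N<i → o i N N<i)

lim-⨁ : ∀ {t} → Order t → ∀ {M N} → N < M → lim t ≈ ⨁ M t to N
lim-⨁ {t} o {M} N<M = upto λ n n≤N → trans (lim-∑ {t} o (ℕₚ.≤-<-trans n≤N N<M)) (sym (coeff-⨁ M t n))

-- The support argument behind every vanishing claim about products: parity and the residues modulo
-- 6 and 24 all enter through it.
·-vanish : ∀ a b n → (∀ j k → j + k ≡ n → a j ≡ 0ℤ ⊎ b k ≡ 0ℤ) → (a · b) n ≡ 0ℤ
·-vanish a b zero    h with h 0 0 refl
... | inj₁ p = trans (·-zero a b) (cong (ℤ._* b 0) p)
... | inj₂ p = trans (·-zero a b) (trans (cong (a 0 ℤ.*_) p) (ℤₚ.*-zeroʳ (a 0)))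
·-vanish a b (suc n) h = trans (·-suc a b n) (cong₂ ℤ._+_ (first (h 0 (suc n) refl)) (·-vanish (tail a) b n λ j k e → h (suc j) k (cong suc e)))
  where
  first : a 0 ≡ 0ℤ ⊎ b (suc n) ≡ 0ℤ → a 0 ℤ.* b (suc n) ≡ 0ℤ
  first (inj₁ p) = cong (ℤ._* b (suc n)) p
  first (inj₂ p) = trans (cong (a 0 ℤ.*_) p) (ℤₚ.*-zeroʳ (a 0))

-- The list underlying inv is private to Defs, but the proof term produced by cong! for
-- the degenerate equation below is cong (λ xs → sumℤ (zipWith _*_ xs L)) h with L the list
-- of values of inv, so the pairing with L can be recovered from it by unification.
module Pairing where

  solveFor : {p z s t : ℤ} → z ≡ - (p ℤ.+ s) → - s ≡ - t → s ≡ t → s ≡ t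
  solveFor _ _ e = e

  coefficients : Series → ℕ → List ℤ
  coefficients a n = map (λ k → a (suc k)) (applyUpTo suc (suc n))

  degenerate : ∀ a n (h : coefficients a n ≡ coefficients a n) → _
  degenerate a n h = solveFor {p = a 1 ℤ.* inv a (suc n)} (refl {x = inv a (suc (suc n))}) refl (cong! h)

  data Box : {s t : ℤ} → s ≡ t → Set where

  mapped : {A : Set} {x y : A} {g : A → ℤ} {T : x ≡ y → Set} → (∀ h → T h ≡ Box (cong g h)) → A → ℤ
  mapped {g = g} _ = g

  pairing : Series → ℕ → List ℤ → ℤ
  pairing a n = mapped {T = λ h → Box (degenerate a n h)} (λ h → refl)

  inv-suc : ∀ a n → inv a (suc n) ≡ - pairing a n (map (λ k → a (suc k)) (upTo (suc n)))
  inv-suc a n = refl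

  pairing-sum : ∀ a n (g : ℕ → ℤ) → pairing a n (applyUpTo g (suc n)) ≡ (g · inv a) n
  pairing-sum a zero    g = refl
  pairing-sum a (suc n) g = trans (cong (λ s → g 0 ℤ.* inv a (suc n) ℤ.+ s) (pairing-sum a n (g ∘ suc))) (sym (·-suc g (inv a) n))

open Pairing using (pairing; inv-suc; pairing-sum)

-- Reciprocals and cancellation

recip : PS → PS
coeff (recip x) = inv (coeff x)

⊗-recip : ∀ x → coeff x 0 ≡ 1ℤ → x ⊗ recip x ≈ κ 1ℤ
⊗-recip x x₀ = coeffwise λ { zero → trans (·-zero a (inv a)) (cong (ℤ._* 1ℤ) x₀) ; (suc n) → step n }
  where
  a = coeff x
  open ≡-Reasoning
  step : ∀ n → (a · inv a) (suc n) ≡ 0ℤ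
  step n = begin
    (a · inv a) (suc n) ≡⟨ ·-suc a (inv a) n ⟩
    a 0 ℤ.* inv a (suc n) ℤ.+ (tail a · inv a) n ≡⟨ cong (λ c → c ℤ.* inv a (suc n) ℤ.+ (tail a · inv a) n) x₀ ⟩
    1ℤ ℤ.* inv a (suc n) ℤ.+ (tail a · inv a) n ≡⟨ cong (λ c → c ℤ.+ (tail a · inv a) n) (ℤₚ.*-identityˡ (inv a (suc n))) ⟩
    inv a (suc n) ℤ.+ (tail a · inv a) n ≡⟨ cong (λ c → c ℤ.+ (tail a · inv a) n) (trans (inv-suc a n) (cong (λ l → - pairing a n l) (Listₚ.map-upTo (λ k → a (suc k)) (suc n)))) ⟩
    - pairing a n (applyUpTo (tail a) (suc n)) ℤ.+ (tail a · inv a) n ≡⟨ cong (λ c → - c ℤ.+ (tail a · inv a) n) (pairing-sum a n (tail a)) ⟩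
    - (tail a · inv a) n ℤ.+ (tail a · inv a) n ≡⟨ ℤₚ.+-inverseˡ ((tail a · inv a) n) ⟩
    0ℤ ∎

unit-cancel : ∀ u {x y} → coeff u 0 ≡ 1ℤ → u ⊗ x ≈ u ⊗ y → x ≈ y
unit-cancel u {x} {y} u₀ p = begin
  x                    ≈⟨ undo x ⟨
  recip u ⊗ (u ⊗ x)    ≈⟨ ⊗-cong ≈-refl p ⟩
  recip u ⊗ (u ⊗ y)    ≈⟨ undo y ⟩
  y                    ∎
  where
  open ≈-Reasoning
  undo : ∀ z → recip u ⊗ (u ⊗ z) ≈ z
  undo z = ≈-trans (PS-Solver.solve 3 (λ r u z → r :* (u :* z) := (u :* r) :* z) ≈-refl (recip u) u z)
                   (≈-trans (⊗-cong (⊗-recip u u₀) ≈-refl) (⊗-identityˡ z))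

-- Nested uses reduce x ≈ y to a polynomial identity that exhibits it as a linear combination of
-- known equations l ≈ r with cofactors c.
combine : ∀ {x y l r} c → l ≈ r → x ⊕ c ⊗ (r ⊕ ⊖ l) ≈ y → x ≈ y
combine {x} {y} {l} {r} c l≈r p = ≈-trans step p
  where
  step : x ≈ x ⊕ c ⊗ (r ⊕ ⊖ l)
  step = ≈-trans (PS-Solver.solve 3 (λ x c r → x := x :+ c :* (r :- r)) ≈-refl x c r)
                 (⊕-cong ≈-refl (⊗-cong ≈-refl (⊕-cong ≈-refl (coeffwise λ n → cong -_ (sym (at l≈r n))))))

1-_ : PS → PS
1- x = κ 1ℤ ⊕ ⊖ x

infix 9 1-_

coeff-κ-⊗ : ∀ c x n → coeff (κ c ⊗ x) n ≡ c ℤ.* coeff x n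
coeff-κ-⊗ c x = const-· c (coeff x)

coeff-1-mono-0 : ∀ {e} → 1 ≤ e → coeff (1- mono e) 0 ≡ 1ℤ
coeff-1-mono-0 (s≤s _) = refl

-- Signs, triangular numbers and theta series

sgn : ℕ → ℤ
sgn zero    = 1ℤ
sgn (suc n) = - sgn n

tri : ℕ → ℕ
tri zero    = 0
tri (suc n) = tri n + suc n

tri-double : ∀ n → tri (n + n) ≡ suc (n + n) * n
tri-double zero    = refl
tri-double (suc n) = begin
  tri (n + suc n) + suc (n + suc n)         ≡⟨ cong (λ k → tri k + suc k) (ℕₚ.+-suc n n) ⟩
  tri (n + n) + suc (n + n) + suc (suc (n + n)) ≡⟨ cong (λ k → k + suc (n + n) + suc (suc (n + n))) (tri-double n) ⟩
  suc (n + n) * n + suc (n + n) + suc (suc (n + n)) ≡⟨ identity n ⟩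
  suc (suc n + suc n) * suc n ∎
  where
  open ≡-Reasoning
  identity : ∀ n → suc (n + n) * n + suc (n + n) + suc (suc (n + n)) ≡ suc (suc n + suc n) * suc n
  identity = ℕ-Solver.solve-∀

tri-suc-double : ∀ n → tri (suc (n + n)) ≡ suc (n + n) * suc n
tri-suc-double n = trans (cong (_+ suc (n + n)) (tri-double n)) (identity n)
  where
  identity : ∀ n → suc (n + n) * n + suc (n + n) ≡ suc (n + n) * suc n
  identity = ℕ-Solver.solve-∀

n≤tri : ∀ n → n ≤ tri n
n≤tri zero    = z≤n
n≤tri (suc n) = ℕₚ.m≤n+m (suc n) (tri n)

n≤d*n : ∀ {d} n → 1 ≤ d → n ≤ d * n
n≤d*n {suc d} n _ = ℕₚ.m≤m+n n (d * n)

-- `S` sums over positive integers only, hence the shift to `suc i`; the squares of x and -x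
-- coincide, so the theta series over all integers is 1 plus twice `S`.
S-term Ψ-term : ℕ → ℕ → PS
S-term d i = κ (sgn (suc i)) ⊗ mono (d * (suc i * suc i))
Ψ-term d i = mono (d * tri i)

-- Φ d = φ(-q^d) and Ψ d = ψ(q^d) in the notation of Ramanujan.
S Φ Ψ : ℕ → PS
S d = lim (S-term d)
Φ d = κ 1ℤ ⊕ κ (+ 2) ⊗ S d
Ψ d = lim (Ψ-term d)

S-order : ∀ {d} → 1 ≤ d → Order (S-term d)
S-order {d} 1≤d i N N<i = trans (coeff-κ-⊗ (sgn (suc i)) (mono (d * (suc i * suc i))) N)
  (trans (cong (sgn (suc i) ℤ.*_) (coeff-mono-< (d * (suc i * suc i)) N bound)) (ℤₚ.*-zeroʳ (sgn (suc i))))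
  where
  bound : N < d * (suc i * suc i)
  bound = ℕₚ.<-≤-trans (ℕₚ.<-trans N<i (ℕₚ.n<1+n i)) (ℕₚ.≤-trans (ℕₚ.m≤m+n (suc i) (i * suc i)) (n≤d*n (suc i * suc i) 1≤d))

Ψ-order : ∀ {d} → 1 ≤ d → Order (Ψ-term d)
Ψ-order {d} 1≤d i N N<i = coeff-mono-< (d * tri i) N (ℕₚ.<-≤-trans N<i (ℕₚ.≤-trans (n≤tri i) (n≤d*n (tri i) 1≤d)))

-- The identities of Gauss

𝐟 : ℕ → PS
𝐟 m = series (f m)

fin : ℕ → ℕ → PS
fin m n = series (finProd m n)

fin-zero : ∀ m → fin m 0 ≈ κ 1ℤ
fin-zero m = coeffwise λ { zero → refl ; (suc n) → refl }

fin-suc : ∀ m n → fin m (suc n) ≈ 1- mono (m * suc n) ⊗ fin m n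
fin-suc m n = coeffwise λ k →
  ·-cong-≤ (oneMinusQ^ (m * suc n)) (coeff (1- mono (m * suc n))) (finProd m n) (finProd m n) k
    (λ { zero _ → refl ; (suc j) _ → refl }) (λ _ _ → refl)

coeff-1-mono-⊗ : ∀ e x n → n < e → coeff (1- mono e ⊗ x) n ≡ coeff x n
coeff-1-mono-⊗ e x n n<e = begin
  coeff (1- mono e ⊗ x) n ≡⟨ at (PS-Solver.solve 2 (λ m x → (con 1ℤ :- m) :* x := x :- m :* x) ≈-refl (mono e) x) n ⟩
  coeff x n ℤ.- coeff (mono e ⊗ x) n ≡⟨ cong (λ c → coeff x n ℤ.- c) (coeff-mono-⊗-< e x n n<e) ⟩
  coeff x n ℤ.- 0ℤ ≡⟨ ℤₚ.+-identityʳ (coeff x n) ⟩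
  coeff x n ∎
  where open ≡-Reasoning

-- Factors beyond the first `N` only alter exponents above `N`, so the diagonal definition of `f`
-- agrees with every longer product.
fin-stable : ∀ {m} → 1 ≤ m → ∀ {N n} → N ≤ n → fin m n ≈ 𝐟 m to N
fin-stable {m} 1≤m {N} {n} N≤n = upto λ k k≤N → go k (ℕₚ.≤⇒≤′ (ℕₚ.≤-trans k≤N N≤n))
  where
  go : ∀ k {n} → k ℕ.≤′ n → finProd m n k ≡ finProd m k k
  go k (ℕ.≤′-reflexive refl) = refl
  go k {suc n} (ℕ.≤′-step k≤′n) = trans (trans (at (fin-suc m n) k)
    (coeff-1-mono-⊗ (m * suc n) (fin m n) k (ℕₚ.<-≤-trans (s≤s (ℕₚ.≤′⇒≤ k≤′n)) (n≤d*n (suc n) 1≤m)))) (go k k≤′n)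

-- The partial sums of the q-binomial series Σ V s · zˢ satisfy its functional equation
-- (1 - a z) F(qz) = (1 - z) F(z) up to a boundary term; here P s = qˢ and Z s = zˢ.
q-binomial : ∀ (a z : PS) (P V Z : ℕ → PS) → P 0 ≈ κ 1ℤ →
  (∀ s → V (suc s) ⊗ 1- P (suc s) ≈ V s ⊗ 1- (a ⊗ P s)) → (∀ s → Z (suc s) ≈ z ⊗ Z s) → ∀ m →
  1- (a ⊗ z) ⊗ ⨁ m (λ s → V s ⊗ (P s ⊗ Z s)) ≈ 1- z ⊗ ⨁ m (λ s → V s ⊗ Z s) ⊕ V m ⊗ 1- P m ⊗ Z m
q-binomial a z P V Z P₀ hV hZ zero    =
  combine (V 0 ⊗ Z 0) P₀ (PS-Solver.solve 5 (λ a z p v w →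
    (con 1ℤ :- a :* z) :* con 0ℤ :+ v :* w :* (con 1ℤ :- p) := (con 1ℤ :- z) :* con 0ℤ :+ v :* (con 1ℤ :- p) :* w) ≈-refl a z (P 0) (V 0) (Z 0))
q-binomial a z P V Z P₀ hV hZ (suc m) =
  combine (κ 1ℤ) (q-binomial a z P V Z P₀ hV hZ m)
  (combine (z ⊗ Z m) (≈-sym (hV m))
  (combine (V (suc m) ⊗ 1- P (suc m)) (≈-sym (hZ m))
  (PS-Solver.solve 10 (λ a z p v w p′ v′ w′ F G →
      (con 1ℤ :- a :* z) :* (F :+ v :* (p :* w))
      :+ con 1ℤ :* (((con 1ℤ :- z) :* G :+ v :* (con 1ℤ :- p) :* w) :- (con 1ℤ :- a :* z) :* F)
      :+ z :* w :* (v′ :* (con 1ℤ :- p′) :- v :* (con 1ℤ :- a :* p))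
      :+ v′ :* (con 1ℤ :- p′) :* (w′ :- z :* w)
      := (con 1ℤ :- z) :* (G :+ v :* w) :+ v′ :* (con 1ℤ :- p′) :* w′)
    ≈-refl a z (P m) (V m) (Z m) (P (suc m)) (V (suc m)) (Z (suc m)) (⨁ m (λ s → V s ⊗ (P s ⊗ Z s))) (⨁ m (λ s → V s ⊗ Z s)))))

coeff-⊗-⊗-mono-< : ∀ x y e n → n < e → coeff (x ⊗ (y ⊗ mono e)) n ≡ 0ℤ
coeff-⊗-⊗-mono-< x y e n n<e = trans
  (at (PS-Solver.solve 3 (λ x y m → x :* (y :* m) := m :* (x :* y)) ≈-refl x y (mono e)) n)
  (coeff-mono-⊗-< e (x ⊗ y) n n<e)

⨁-first-to : ∀ {x N} n (t : ℕ → PS) → t 0 ≈ x to N → (∀ i k → k ≤ N → coeff (t (suc i)) k ≡ 0ℤ) → ⨁ (suc n) t ≈ x to N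
⨁-first-to {x} n t t₀ h = upto λ k k≤N → begin
  coeff (⨁ (suc n) t) k ≡⟨ coeff-⨁ (suc n) t k ⟩
  ∑ (suc n) (λ i → coeff (t i) k) ≡⟨ ∑-first n (λ i → coeff (t i) k) ⟩
  coeff (t 0) k ℤ.+ ∑ n (λ i → coeff (t (suc i)) k) ≡⟨ cong₂ ℤ._+_ (at-≤ t₀ k k≤N) (∑-zero n λ i _ → h i k k≤N) ⟩
  coeff x k ℤ.+ 0ℤ ≡⟨ ℤₚ.+-identityʳ (coeff x k) ⟩
  coeff x k ∎
  where open ≡-Reasoning

module Gauss (d : ℕ) (1≤d : 1 ≤ d) where

  X : ℕ → PS
  X k = mono (d * k)

  X-+ : ∀ j k → X (j + k) ≈ X j ⊗ X k
  X-+ j k = subst (λ e → mono e ≈ X j ⊗ X k) (sym (ℕₚ.*-distribˡ-+ d j k)) (mono-+ (d * j) (d * k))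

  X-≡ : ∀ {j k} → j ≡ k → X j ≈ X k
  X-≡ refl = ≈-refl

  X-0 : X 0 ≈ κ 1ℤ
  X-0 = subst (λ e → mono e ≈ κ 1ℤ) (sym (ℕₚ.*-zeroʳ d)) mono-0

  1-X-unit : ∀ k → coeff (1- X (suc k)) 0 ≡ 1ℤ
  1-X-unit k = coeff-1-mono-0 (ℕₚ.≤-trans (s≤s z≤n) (n≤d*n (suc k) 1≤d))

  1≤2d : 1 ≤ 2 * d
  1≤2d = ℕₚ.≤-trans 1≤d (ℕₚ.m≤m+n d (d + 0))

  fin-2d-suc : ∀ n → fin (2 * d) (suc n) ≈ 1- X (suc n + suc n) ⊗ fin (2 * d) n
  fin-2d-suc n = subst (λ e → fin (2 * d) (suc n) ≈ 1- mono e ⊗ fin (2 * d) n) (identity d n) (fin-suc (2 * d) n)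
    where
    identity : ∀ d n → 2 * d * suc n ≡ d * (suc n + suc n)
    identity = ℕ-Solver.solve-∀

  -- V s is the coefficient (a;q)ₛ/(q;q)ₛ of the q-binomial series, with P s = qˢ.
  module _ (a : PS) (P : ℕ → PS) (unit : ∀ s → coeff (1- P (suc s)) 0 ≡ 1ℤ) where

    q-coeff : ℕ → PS
    q-coeff zero    = κ 1ℤ
    q-coeff (suc s) = q-coeff s ⊗ 1- (a ⊗ P s) ⊗ recip (1- P (suc s))

    q-coeff-suc : ∀ s → q-coeff (suc s) ⊗ 1- P (suc s) ≈ q-coeff s ⊗ 1- (a ⊗ P s)
    q-coeff-suc s = combine (q-coeff s ⊗ 1- (a ⊗ P s)) (⊗-recip (1- P (suc s)) (unit s))
      (PS-Solver.solve 3 (λ v u r → v :* r :* u :+ v :* (con 1ℤ :- u :* r) := v) ≈-refl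
        (q-coeff s ⊗ 1- (a ⊗ P s)) (1- P (suc s)) (recip (1- P (suc s))))

  module Theta where

    -- The case a = -1: writing q for q^d, `V s` is (-1;q)ₛ/(q;q)ₛ, and `Z n` below takes z = -qⁿ.
    V : ℕ → PS
    V = q-coeff (κ (- 1ℤ)) X 1-X-unit

    Z : ℕ → ℕ → PS
    Z n s = κ (sgn s) ⊗ X (n * s)

    F : ℕ → ℕ → PS
    F n m = ⨁ m (λ s → V s ⊗ Z n s)

    numerator denominator T : ℕ → PS
    numerator = fin d
    denominator zero    = κ 1ℤ
    denominator (suc n) = (κ 1ℤ ⊕ X (suc n)) ⊗ denominator n
    T n = κ 1ℤ ⊕ κ (+ 2) ⊗ ⨁ n (S-term d)

    numerator-denominator : ∀ n → numerator n ⊗ denominator n ≈ fin (2 * d) n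
    numerator-denominator zero    = ≈-trans (⊗-cong (fin-zero d) ≈-refl) (≈-trans (⊗-identityˡ (κ 1ℤ)) (≈-sym (fin-zero (2 * d))))
    numerator-denominator (suc n) =
      combine ((κ 1ℤ ⊕ X (suc n)) ⊗ denominator n) (fin-suc d n)
      (combine (1- X (suc n) ⊗ (κ 1ℤ ⊕ X (suc n))) (numerator-denominator n)
      (combine (⊖ fin (2 * d) n) (≈-sym (X-+ (suc n) (suc n)))
      (combine (κ 1ℤ) (≈-sym (fin-2d-suc n))
      (PS-Solver.solve 7 (λ x xx p p′ m g g′ →
          p′ :* ((con 1ℤ :+ x) :* m) :+ (con 1ℤ :+ x) :* m :* ((con 1ℤ :- x) :* p :- p′)
          :+ (con 1ℤ :- x) :* (con 1ℤ :+ x) :* (g :- p :* m) :+ (:- g) :* (xx :- x :* x) :+ con 1ℤ :* (g′ :- (con 1ℤ :- xx) :* g) := g′)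
        ≈-refl (X (suc n)) (X (suc n + suc n)) (numerator n) (numerator (suc n)) (denominator n) (fin (2 * d) n) (fin (2 * d) (suc n))))))

    -- Because (-1;q)ₙ₊₁ = 2 (-q;q)ₙ. This 2 becomes the factor 2 in `Φ`.
    V-numerator : ∀ n → numerator (suc n) ⊗ V (suc n) ≈ κ (+ 2) ⊗ denominator n
    V-numerator zero    =
      combine (V 1) (fin-suc d 0)
      (combine (1- X 1 ⊗ V 1) (fin-zero d)
      (combine (κ 1ℤ) (q-coeff-suc (κ (- 1ℤ)) X 1-X-unit 0)
      (combine (κ 1ℤ) X-0
      (PS-Solver.solve 5 (λ x₀ x₁ p₀ p₁ v →
          p₁ :* v :+ v :* ((con 1ℤ :- x₁) :* p₀ :- p₁) :+ (con 1ℤ :- x₁) :* v :* (con 1ℤ :- p₀)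
          :+ con 1ℤ :* (con 1ℤ :* (con 1ℤ :- con (- 1ℤ) :* x₀) :- v :* (con 1ℤ :- x₁)) :+ con 1ℤ :* (con 1ℤ :- x₀)
          := con (+ 2) :* con 1ℤ)
        ≈-refl (X 0) (X 1) (numerator 0) (numerator 1) (V 1)))))
    V-numerator (suc n) =
      combine (V (suc (suc n))) (fin-suc d (suc n))
      (combine (numerator (suc n)) (q-coeff-suc (κ (- 1ℤ)) X 1-X-unit (suc n))
      (combine (κ 1ℤ ⊕ X (suc n)) (V-numerator n)
      (PS-Solver.solve 7 (λ x x′ p p′ v v′ m →
          p′ :* v′ :+ v′ :* ((con 1ℤ :- x′) :* p :- p′)
          :+ p :* (v :* (con 1ℤ :- con (- 1ℤ) :* x) :- v′ :* (con 1ℤ :- x′))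
          :+ (con 1ℤ :+ x) :* (con (+ 2) :* m :- p :* v)
          := con (+ 2) :* ((con 1ℤ :+ x) :* m))
        ≈-refl (X (suc n)) (X (suc (suc n))) (numerator (suc n)) (numerator (suc (suc n))) (V (suc n)) (V (suc (suc n))) (denominator n))))

    Z-zero : ∀ n → Z n 0 ≈ κ 1ℤ
    Z-zero n = ≈-trans (⊗-identityˡ (X (n * 0))) (≈-trans (X-≡ (ℕₚ.*-zeroʳ n)) X-0)

    κ-neg : ∀ c → κ (- c) ≈ ⊖ κ c
    κ-neg c = coeffwise λ { zero → refl ; (suc n) → refl }

    Z-suc : ∀ n s → Z n (suc s) ≈ ⊖ X n ⊗ Z n s
    Z-suc n s =
      combine (X (n * suc s)) (κ-neg (sgn s))
      (combine (⊖ κ (sgn s)) (≈-trans (X-≡ (ℕₚ.*-suc n s)) (X-+ n (n * s)))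
      (PS-Solver.solve 5 (λ c c′ x y y′ →
          c′ :* y′ :+ y′ :* ((:- c) :- c′) :+ (:- c) :* (x :* y :- y′) := (:- x) :* (c :* y))
        ≈-refl (κ (sgn s)) (κ (- sgn s)) (X n) (X (n * s)) (X (n * suc s))))

    X-⊗-Z : ∀ n s → X s ⊗ Z n s ≈ Z (suc n) s
    X-⊗-Z n s =
      combine (κ (sgn s)) (≈-sym (X-+ s (n * s)))
      (PS-Solver.solve 4 (λ c x y y′ → x :* (c :* y) :+ c :* (y′ :- x :* y) := c :* y′)
        ≈-refl (κ (sgn s)) (X s) (X (n * s)) (X (s + n * s)))

    F-shift : ∀ n m → ⨁ m (λ s → V s ⊗ (X s ⊗ Z n s)) ≈ F (suc n) m
    F-shift n m = ⨁-cong m λ s → ⊗-cong ≈-refl (X-⊗-Z n s)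

    -- An exact finite form of the theta identity. For k = n + 1 the functional equation lowers
    -- `F (suc k)` to `F k`; the new summand and the boundary term together leave `V k ⊗ Z k k`
    -- times 1 - qᵏ, where `Z k k` is (-1)ᵏ q^(k²), the next term of the theta series.
    partial-theta : ∀ n → denominator n ⊗ T n ≈ numerator n ⊗ F (suc n) (suc n)
    partial-theta zero    =
      combine (κ 0ℤ ⊕ κ 1ℤ ⊗ Z 1 0) (≈-sym (fin-zero d))
      (combine (κ 1ℤ) (≈-sym (Z-zero 1))
      (PS-Solver.solve 2 (λ p z →
          con 1ℤ :* (con 1ℤ :+ con (+ 2) :* con 0ℤ) :+ (con 0ℤ :+ con 1ℤ :* z) :* (p :- con 1ℤ) :+ con 1ℤ :* (z :- con 1ℤ)
          := p :* (con 0ℤ :+ con 1ℤ :* z))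
        ≈-refl (numerator 0) (Z 1 0)))
    partial-theta (suc n) =
      combine (κ 1ℤ ⊕ X k) (partial-theta n)
      (combine ((κ 1ℤ ⊕ X k) ⊗ Z k k) (≈-sym (V-numerator n))
      (combine ((κ 1ℤ ⊕ X k) ⊗ Z k k ⊗ V k ⊕ ⊖ F (suc k) (suc k)) (fin-suc d n)
      (combine (numerator n) (≈-sym step)
      (combine (numerator n ⊗ V (suc k) ⊗ 1- X (suc k)) (≈-sym (Z-suc k k))
      (combine (numerator n ⊗ X k ⊗ Z k k) (q-coeff-suc (κ (- 1ℤ)) X 1-X-unit k)
      (PS-Solver.solve 12 (λ x x′ p p′ m t z z′ v v′ F₀ F₁ →
          (con 1ℤ :+ x) :* m :* (con 1ℤ :+ con (+ 2) :* (t :+ z))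
          :+ (con 1ℤ :+ x) :* (p :* F₀ :- m :* (con 1ℤ :+ con (+ 2) :* t))
          :+ (con 1ℤ :+ x) :* z :* (p′ :* v :- con (+ 2) :* m)
          :+ ((con 1ℤ :+ x) :* z :* v :+ (:- F₁)) :* ((con 1ℤ :- x) :* p :- p′)
          :+ p :* ((con 1ℤ :- con (- 1ℤ) :* (:- x)) :* F₁ :- ((con 1ℤ :- (:- x)) :* (F₀ :+ v :* z) :+ v′ :* (con 1ℤ :- x′) :* z′))
          :+ p :* v′ :* (con 1ℤ :- x′) :* (z′ :- (:- x) :* z)
          :+ p :* x :* z :* (v :* (con 1ℤ :- con (- 1ℤ) :* x) :- v′ :* (con 1ℤ :- x′))
          := p′ :* F₁)
        ≈-refl (X k) (X (suc k)) (numerator n) (numerator k) (denominator n) (⨁ n (S-term d)) (Z k k) (Z k (suc k)) (V k) (V (suc k)) (F k k) (F (suc k) (suc k))))))))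
      where
      k = suc n
      -- The functional equation at a = -1, z = -qᵏ, where az = qᵏ.
      step : 1- (κ (- 1ℤ) ⊗ ⊖ X k) ⊗ F (suc k) (suc k) ≈ 1- (⊖ X k) ⊗ F k (suc k) ⊕ V (suc k) ⊗ 1- X (suc k) ⊗ Z k (suc k)
      step = ≈-trans (⊗-cong ≈-refl (≈-sym (F-shift k (suc k))))
        (q-binomial (κ (- 1ℤ)) (⊖ X k) X V (Z k) X-0 (q-coeff-suc (κ (- 1ℤ)) X 1-X-unit) (Z-suc k) (suc k))

    -- Only s = 0 survives, since the summand s carries the (n+1)s-th power of q^d.
    F-to : ∀ n → F (suc n) (suc n) ≈ κ 1ℤ to n
    F-to n = ⨁-first-to n (λ s → V s ⊗ Z (suc n) s) (≈-to (≈-trans (⊗-identityˡ (Z (suc n) 0)) (Z-zero (suc n))))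
      λ i k k≤n → coeff-⊗-⊗-mono-< (V (suc i)) (κ (sgn (suc i))) (d * (suc n * suc i)) k
        (ℕₚ.<-≤-trans (s≤s k≤n) (ℕₚ.≤-trans (ℕₚ.m≤m*n (suc n) (suc i)) (n≤d*n (suc n * suc i) 1≤d)))

    T-to : ∀ n → T (suc n) ≈ Φ d to n
    T-to n = upto λ k k≤n → cong (λ c → coeff (κ 1ℤ) k ℤ.+ c) (trans (coeff-κ-⊗ (+ 2) (⨁ (suc n) (S-term d)) k)
      (trans (cong (+ 2 ℤ.*_) (sym (at-≤ (lim-⨁ (S-order 1≤d) (s≤s k≤n)) k ℕₚ.≤-refl))) (sym (coeff-κ-⊗ (+ 2) (S d) k))))

    -- The finite identity multiplied by (q;q)ₙ, using (q;q)ₙ (-q;q)ₙ = (q²;q²)ₙ; in the limit `F`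
    -- becomes 1.
    theta : 𝐟 d ⊗ 𝐟 d ≈ 𝐟 (2 * d) ⊗ Φ d
    theta = to-all λ N → let n = suc N ; N≤n = ℕₚ.n≤1+n N in
      to-trans (≈to-⊗ (to-sym (fin-stable 1≤d N≤n)) (to-sym (fin-stable 1≤d N≤n)))
      (to-trans (to-sym (≈-to (PS-Solver.solve 1 (λ p → p :* p :* con 1ℤ := p :* p) ≈-refl (numerator n))))
      (to-trans (≈to-⊗ {x = numerator n ⊗ numerator n} (≈-to ≈-refl) (to-sym (to-weaken N≤n (F-to n))))
      (to-trans (≈-to (finite n))
      (≈to-⊗ (fin-stable 1≤2d N≤n) (T-to N)))))
      where
      finite : ∀ n → numerator n ⊗ numerator n ⊗ F (suc n) (suc n) ≈ fin (2 * d) n ⊗ T n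
      finite n =
        combine (numerator n) (≈-sym (partial-theta n))
        (combine (T n) (numerator-denominator n)
        (PS-Solver.solve 5 (λ p m g t F → p :* p :* F :+ p :* (m :* t :- p :* F) :+ t :* (g :- p :* m) := g :* t)
          ≈-refl (numerator n) (denominator n) (fin (2 * d) n) (T n) (F (suc n) (suc n))))

  module Triangular where

    -- Now the base is q² and a = q: `V s` is (q;q²)ₛ/(q²;q²)ₛ, and `Z n` takes z = q^(2n+1).
    P : ℕ → PS
    P s = X (s + s)

    P-unit : ∀ s → coeff (1- P (suc s)) 0 ≡ 1ℤ
    P-unit s = 1-X-unit (s + suc s)

    V : ℕ → PS
    V = q-coeff (X 1) P P-unit

    Z : ℕ → ℕ → PS
    Z n s = X (suc (n + n) * s)

    F : ℕ → ℕ → PS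
    F n m = ⨁ m (λ s → V s ⊗ Z n s)

    even odd B : ℕ → PS
    even = fin (2 * d)
    odd zero    = κ 1ℤ
    odd (suc n) = 1- X (suc (n + n)) ⊗ odd n
    B zero    = κ 0ℤ
    B (suc n) = B n ⊕ X (tri (n + n)) ⊕ X (tri (suc (n + n)))

    P-⊗-X1 : ∀ n → X 1 ⊗ P n ≈ X (suc (n + n))
    P-⊗-X1 n = ≈-sym (X-+ 1 (n + n))

    even-odd : ∀ n → even n ⊗ odd n ≈ fin d (n + n)
    even-odd zero    = ≈-trans (⊗-cong (fin-zero (2 * d)) ≈-refl) (≈-trans (⊗-identityˡ (κ 1ℤ)) (≈-sym (fin-zero d)))
    even-odd (suc n) = ≈-trans step (subst (λ k → 1- X (suc k) ⊗ fin d k ≈ fin d (suc k)) (sym (ℕₚ.+-suc n n)) (≈-sym (fin-suc d (suc (n + n)))))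
      where
      step : even (suc n) ⊗ odd (suc n) ≈ 1- X (suc (n + suc n)) ⊗ fin d (n + suc n)
      step = subst (λ k → even (suc n) ⊗ odd (suc n) ≈ 1- X (suc k) ⊗ fin d k) (sym (ℕₚ.+-suc n n))
        (combine (odd (suc n)) (subst (λ k → even (suc n) ≈ 1- X (suc k) ⊗ even n) (ℕₚ.+-suc n n) (fin-2d-suc n))
        (combine (1- X (suc (n + n)) ⊗ 1- X (suc (suc (n + n)))) (even-odd n)
        (combine (1- X (suc (suc (n + n)))) (≈-sym (fin-suc d (n + n)))
        (PS-Solver.solve 7 (λ x y e e′ o g g′ →
            e′ :* ((con 1ℤ :- x) :* o) :+ (con 1ℤ :- x) :* o :* ((con 1ℤ :- y) :* e :- e′)
            :+ (con 1ℤ :- x) :* (con 1ℤ :- y) :* (g :- e :* o) :+ (con 1ℤ :- y) :* (g′ :- (con 1ℤ :- x) :* g) := (con 1ℤ :- y) :* g′)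
          ≈-refl (X (suc (n + n))) (X (suc (suc (n + n)))) (even n) (even (suc n)) (odd n) (fin d (n + n)) (fin d (suc (n + n)))))))

    V-even : ∀ n → even n ⊗ V n ≈ odd n
    V-even zero    = ≈-trans (⊗-cong (fin-zero (2 * d)) ≈-refl) (⊗-identityˡ (κ 1ℤ))
    V-even (suc n) =
      combine (V (suc n)) (fin-2d-suc n)
      (combine (even n) (q-coeff-suc (X 1) P P-unit n)
      (combine (1- (X 1 ⊗ P n)) (V-even n)
      (combine (⊖ odd n) (P-⊗-X1 n)
      (PS-Solver.solve 9 (λ x₁ p p′ y e e′ v v′ o →
          e′ :* v′ :+ v′ :* ((con 1ℤ :- p′) :* e :- e′) :+ e :* (v :* (con 1ℤ :- x₁ :* p) :- v′ :* (con 1ℤ :- p′))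
          :+ (con 1ℤ :- x₁ :* p) :* (o :- e :* v) :+ (:- o) :* (y :- x₁ :* p) := (con 1ℤ :- y) :* o)
        ≈-refl (X 1) (P n) (P (suc n)) (X (suc (n + n))) (even n) (even (suc n)) (V n) (V (suc n)) (odd n)))))

    Z-zero : ∀ n → Z n 0 ≈ κ 1ℤ
    Z-zero n = ≈-trans (X-≡ (ℕₚ.*-zeroʳ (suc (n + n)))) X-0

    Z-suc : ∀ n s → Z n (suc s) ≈ X (suc (n + n)) ⊗ Z n s
    Z-suc n s = ≈-trans (X-≡ (ℕₚ.*-suc (suc (n + n)) s)) (X-+ (suc (n + n)) (suc (n + n) * s))

    P-⊗-Z : ∀ n s → P s ⊗ Z n s ≈ Z (suc n) s
    P-⊗-Z n s = ≈-trans (≈-sym (X-+ (s + s) (suc (n + n) * s))) (X-≡ (identity n s))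
      where
      identity : ∀ n s → s + s + suc (n + n) * s ≡ suc (suc n + suc n) * s
      identity = ℕ-Solver.solve-∀

    -- Each step yields two triangular exponents. For z = q^(2n+1) the new summand brings zⁿ with
    -- n(2n+1) = tri(2n), and the boundary term brings zⁿ⁺¹ with (n+1)(2n+1) = tri(2n+1); hence `B`
    -- grows by two terms at a time.
    partial-triangular : ∀ n → odd n ⊗ B n ≈ even n ⊗ F n n
    partial-triangular zero    = PS-Solver.solve 2 (λ o e → o :* con 0ℤ := e :* con 0ℤ) ≈-refl (odd 0) (even 0)
    partial-triangular (suc n) =
      combine (1- z) (partial-triangular n)
      (combine (1- z ⊗ (t₀ ⊕ t₁)) (≈-sym (V-even n))
      (combine (1- z ⊗ even n ⊗ V n) (X-≡ (tri-double n))
      (combine (1- z ⊗ even n ⊗ V n) (X-≡ (tri-suc-double n))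
      (combine (even n) (≈-sym step)
      (combine (⊖ (even n ⊗ Z n (suc n))) (q-coeff-suc (X 1) P P-unit n)
      (combine (even n ⊗ Z n (suc n) ⊗ V n) (P-⊗-X1 n)
      (combine (⊖ (even n ⊗ F₁)) (≈-trans (≈-sym (X-+ 1 (suc (n + n)))) (X-≡ (cong suc (sym (ℕₚ.+-suc n n)))))
      (combine F₁ (≈-sym (fin-2d-suc n))
      (PS-Solver.solve 16 (λ x₁ x p p′ e e′ o b t t′ v v′ w w′ F₀ F₁ →
          (con 1ℤ :- x) :* o :* (b :+ t :+ t′)
          :+ (con 1ℤ :- x) :* (e :* F₀ :- o :* b)
          :+ (con 1ℤ :- x) :* (t :+ t′) :* (e :* v :- o)
          :+ (con 1ℤ :- x) :* e :* v :* (w :- t)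
          :+ (con 1ℤ :- x) :* e :* v :* (w′ :- t′)
          :+ e :* ((con 1ℤ :- x₁ :* x) :* F₁ :- ((con 1ℤ :- x) :* (F₀ :+ v :* w) :+ v′ :* (con 1ℤ :- p′) :* w′))
          :+ (:- (e :* w′)) :* (v :* (con 1ℤ :- x₁ :* p) :- v′ :* (con 1ℤ :- p′))
          :+ e :* w′ :* v :* (x :- x₁ :* p)
          :+ (:- (e :* F₁)) :* (p′ :- x₁ :* x)
          :+ F₁ :* (e′ :- (con 1ℤ :- p′) :* e)
          := e′ :* F₁)
        ≈-refl (X 1) z (P n) (P (suc n)) (even n) (even (suc n)) (odd n) (B n) t₀ t₁ (V n) (V (suc n)) (Z n n) (Z n (suc n)) (F n n) F₁)))))))))
      where
      z = X (suc (n + n))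
      t₀ = X (tri (n + n))
      t₁ = X (tri (suc (n + n)))
      F₁ = F (suc n) (suc n)
      step : 1- (X 1 ⊗ z) ⊗ F₁ ≈ 1- z ⊗ F n (suc n) ⊕ V (suc n) ⊗ 1- P (suc n) ⊗ Z n (suc n)
      step = ≈-trans (⊗-cong ≈-refl (≈-sym (⨁-cong (suc n) λ s → ⊗-cong ≈-refl (P-⊗-Z n s))))
        (q-binomial (X 1) z P V (Z n) X-0 (q-coeff-suc (X 1) P P-unit) (Z-suc n) (suc n))

    F-to : ∀ n → F (suc n) (suc n) ≈ κ 1ℤ to n
    F-to n = ⨁-first-to n (λ s → V s ⊗ Z (suc n) s) (≈-to (≈-trans (⊗-identityˡ (Z (suc n) 0)) (Z-zero (suc n))))
      λ i k k≤n → trans (at (⊗-comm (V (suc i)) (Z (suc n) (suc i))) k) (coeff-mono-⊗-< (d * (suc (suc n + suc n) * suc i)) (V (suc i)) k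
        (ℕₚ.<-≤-trans (s≤s k≤n) (ℕₚ.≤-trans (ℕₚ.m≤n+m (suc n) (suc (suc n))) (ℕₚ.≤-trans (ℕₚ.m≤m*n (suc (suc n + suc n)) (suc i)) (n≤d*n (suc (suc n + suc n) * suc i) 1≤d)))))

    B-to : ∀ n → B (suc n) ≈ Ψ d to n
    B-to n = upto λ k k≤n → trans (coeff-B k (suc n)) (sym (lim-∑ {Ψ-term d} (Ψ-order 1≤d) (s≤s (ℕₚ.≤-trans k≤n (ℕₚ.m≤m+n n (suc n))))))
      where
      coeff-B : ∀ k n → coeff (B n) k ≡ ∑ (n + n) (λ i → coeff (Ψ-term d i) k)
      coeff-B k zero    = const-zero k
      coeff-B k (suc n) = trans (cong (λ c → c ℤ.+ coeff (Ψ-term d (n + n)) k ℤ.+ coeff (Ψ-term d (suc (n + n))) k) (coeff-B k n))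
        (cong (λ j → ∑ j (λ i → coeff (Ψ-term d i) k) ℤ.+ coeff (Ψ-term d j) k) (sym (ℕₚ.+-suc n n)))

    triangular : 𝐟 (2 * d) ⊗ 𝐟 (2 * d) ≈ 𝐟 d ⊗ Ψ d
    triangular = to-all λ N → let n = suc N ; N≤n = ℕₚ.n≤1+n N in
      to-trans (≈to-⊗ (to-sym (fin-stable 1≤2d N≤n)) (to-sym (fin-stable 1≤2d N≤n)))
      (to-trans (to-sym (≈-to (PS-Solver.solve 1 (λ p → p :* p :* con 1ℤ := p :* p) ≈-refl (even n))))
      (to-trans (≈to-⊗ {x = even n ⊗ even n} (≈-to ≈-refl) (to-sym (F-to N)))
      (to-trans (≈-to (finite n))
      (≈to-⊗ (fin-stable 1≤d (ℕₚ.≤-trans N≤n (ℕₚ.m≤m+n n n))) (B-to N)))))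
      where
      finite : ∀ n → even n ⊗ even n ⊗ F n n ≈ fin d (n + n) ⊗ B n
      finite n =
        combine (even n) (≈-sym (partial-triangular n))
        (combine (B n) (even-odd n)
        (PS-Solver.solve 5 (λ e o g b F → e :* e :* F :+ e :* (o :* b :- e :* F) :+ b :* (g :- e :* o) := g :* b)
          ≈-refl (even n) (odd n) (fin d (n + n)) (B n) (F n n)))

-- The odd part of Φ 1 ⊗ Φ 3

∑± : ℕ → (ℤ → ℤ) → ℤ
∑± K g = ∑ K (λ i → g (+ i)) ℤ.+ ∑ K (λ i → g -[1+ i ])

-- The two ends of the range vary independently because a translation moves one end outwards and the
-- other inwards.
record HasSum (g : ℤ → ℤ) (s : ℤ) : Set where
  constructor hasSum
  field
    bound  : ℕ
    sum-to : ∀ A B → bound ≤ A → bound ≤ B → ∑ B (λ i → g (+ i)) ℤ.+ ∑ A (λ i → g -[1+ i ]) ≡ s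

HasSum-unique : ∀ {g s t} → HasSum g s → HasSum g t → s ≡ t
HasSum-unique (hasSum M p) (hasSum L q) = trans (sym (p (M + L) (M + L) (ℕₚ.m≤m+n M L) (ℕₚ.m≤m+n M L))) (q (M + L) (M + L) (ℕₚ.m≤n+m L M) (ℕₚ.m≤n+m L M))

HasSum-cong : ∀ {g h s} → (∀ x → g x ≡ h x) → HasSum g s → HasSum h s
HasSum-cong e (hasSum M p) = hasSum M λ A B M≤A M≤B →
  trans (sym (cong₂ ℤ._+_ (∑-cong B λ i _ → e (+ i)) (∑-cong A λ i _ → e -[1+ i ]))) (p A B M≤A M≤B)

HasSum-support : ∀ {g K} → (∀ x → K ≤ ∣ x ∣ → g x ≡ 0ℤ) → HasSum g (∑± K g)
HasSum-support {g} {K} z = hasSum K λ A B K≤A K≤B → cong₂ ℤ._+_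
  (∑-stable (λ i → g (+ i)) K≤B λ i K≤i → z (+ i) K≤i)
  (∑-stable (λ i → g -[1+ i ]) K≤A λ i K≤i → z -[1+ i ] (ℕₚ.m≤n⇒m≤1+n K≤i))

HasSum-suc : ∀ {g s} → HasSum g s → HasSum (λ x → g (1ℤ ℤ.+ x)) s
HasSum-suc {g} {s} (hasSum M p) = hasSum (suc M) λ { (suc A) B (s≤s M≤A) M<B → begin
  ∑ B (λ i → g (+ suc i)) ℤ.+ ∑ (suc A) (λ i → g (1ℤ ℤ.+ -[1+ i ])) ≡⟨ cong (λ c → ∑ B (λ i → g (+ suc i)) ℤ.+ c) (∑-first A (λ i → g (1ℤ ℤ.+ -[1+ i ]))) ⟩
  ∑ B (λ i → g (+ suc i)) ℤ.+ (g 0ℤ ℤ.+ ∑ A (λ i → g -[1+ i ])) ≡⟨ shuffle (∑ B (λ i → g (+ suc i))) (g 0ℤ) _ ⟩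
  (g 0ℤ ℤ.+ ∑ B (λ i → g (+ suc i))) ℤ.+ ∑ A (λ i → g -[1+ i ]) ≡⟨ cong (ℤ._+ ∑ A (λ i → g -[1+ i ])) (∑-first B (λ i → g (+ i))) ⟨
  ∑ (suc B) (λ i → g (+ i)) ℤ.+ ∑ A (λ i → g -[1+ i ]) ≡⟨ p A (suc B) M≤A (ℕₚ.≤-trans (ℕₚ.n≤1+n M) (ℕₚ.m≤n⇒m≤1+n M<B)) ⟩
  s ∎ }
  where
  open ≡-Reasoning
  shuffle : ∀ a b c → a ℤ.+ (b ℤ.+ c) ≡ (b ℤ.+ a) ℤ.+ c
  shuffle = ℤ-Solver.solve-∀

HasSum-pred : ∀ {g s} → HasSum g s → HasSum (λ x → g (-[1+ 0 ] ℤ.+ x)) s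
HasSum-pred {g} {s} (hasSum M p) = hasSum (suc M) λ { A (suc B) M<A (s≤s M≤B) → begin
  ∑ (suc B) (λ i → g (-[1+ 0 ] ℤ.+ + i)) ℤ.+ ∑ A (λ i → g -[1+ suc i ]) ≡⟨ cong (ℤ._+ ∑ A (λ i → g -[1+ suc i ])) (∑-first B (λ i → g (-[1+ 0 ] ℤ.+ + i))) ⟩
  g -[1+ 0 ] ℤ.+ ∑ B (λ i → g (+ i)) ℤ.+ ∑ A (λ i → g -[1+ suc i ]) ≡⟨ shuffle (g -[1+ 0 ]) (∑ B (λ i → g (+ i))) _ ⟩
  ∑ B (λ i → g (+ i)) ℤ.+ (g -[1+ 0 ] ℤ.+ ∑ A (λ i → g -[1+ suc i ])) ≡⟨ cong (λ c → ∑ B (λ i → g (+ i)) ℤ.+ c) (∑-first A (λ i → g -[1+ i ])) ⟨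
  ∑ B (λ i → g (+ i)) ℤ.+ ∑ (suc A) (λ i → g -[1+ i ]) ≡⟨ p (suc A) B (ℕₚ.≤-trans (ℕₚ.n≤1+n M) (ℕₚ.m≤n⇒m≤1+n M<A)) M≤B ⟩
  s ∎ }
  where
  open ≡-Reasoning
  shuffle : ∀ a b c → a ℤ.+ b ℤ.+ c ≡ b ℤ.+ (a ℤ.+ c)
  shuffle = ℤ-Solver.solve-∀

HasSum-shift : ∀ {g s} c → HasSum g s → HasSum (λ x → g (c ℤ.+ x)) s
HasSum-shift {g} (+ zero)      p = HasSum-cong (λ x → cong g (sym (ℤₚ.+-identityˡ x))) p
HasSum-shift {g} (+ suc c)     p = HasSum-cong (λ x → cong g (sym (ℤₚ.+-assoc 1ℤ (+ c) x))) (HasSum-shift (+ c) (HasSum-suc p))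
HasSum-shift {g} -[1+ zero ]   p = HasSum-pred p
HasSum-shift {g} -[1+ suc c ]  p = HasSum-cong (λ x → cong g (sym (ℤₚ.+-assoc -[1+ 0 ] -[1+ c ] x))) (HasSum-shift -[1+ c ] (HasSum-pred p))

HasSum-double : ∀ {g s} → HasSum g s → HasSum (λ x → g (x ℤ.+ x) ℤ.+ g (1ℤ ℤ.+ (x ℤ.+ x))) s
HasSum-double {g} {s} (hasSum M p) = hasSum M λ A B M≤A M≤B → begin
  ∑ B (λ i → g (+ (i + i)) ℤ.+ g (+ suc (i + i))) ℤ.+ ∑ A (λ i → g -[1+ suc (i + i) ] ℤ.+ g -[1+ i + i ])
    ≡⟨ cong₂ ℤ._+_ (sym (∑-double B (λ i → g (+ i))))
        (trans (∑-cong A (λ i _ → ℤₚ.+-comm (g -[1+ suc (i + i) ]) _)) (sym (∑-double A (λ i → g -[1+ i ])))) ⟩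
  ∑ (B + B) (λ i → g (+ i)) ℤ.+ ∑ (A + A) (λ i → g -[1+ i ])
    ≡⟨ p (A + A) (B + B) (ℕₚ.≤-trans M≤A (ℕₚ.m≤m+n A A)) (ℕₚ.≤-trans M≤B (ℕₚ.m≤m+n B B)) ⟩
  s ∎
  where open ≡-Reasoning

∑±-cong : ∀ K {g h : ℤ → ℤ} → (∀ x → g x ≡ h x) → ∑± K g ≡ ∑± K h
∑±-cong K e = cong₂ ℤ._+_ (∑-cong K λ i _ → e (+ i)) (∑-cong K λ i _ → e -[1+ i ])

∑±-neg : ∀ K g → ∑± K (λ x → - g x) ≡ - ∑± K g
∑±-neg K g = trans (cong₂ ℤ._+_ (∑-neg K _) (∑-neg K _)) (sym (ℤₚ.neg-distrib-+ (∑ K (λ i → g (+ i))) _))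

∑±-swap : ∀ K (g : ℤ → ℤ → ℤ) → ∑± K (λ x → ∑± K (g x)) ≡ ∑± K (λ y → ∑± K (λ x → g x y))
∑±-swap K g = begin
  ∑ K (λ i → ∑ K (λ j → g (+ i) (+ j)) ℤ.+ ∑ K (λ j → g (+ i) -[1+ j ])) ℤ.+ ∑ K (λ i → ∑ K (λ j → g -[1+ i ] (+ j)) ℤ.+ ∑ K (λ j → g -[1+ i ] -[1+ j ]))
    ≡⟨ cong₂ ℤ._+_ (split (λ i → + i)) (split -[1+_]) ⟩
  (∑ K (λ j → ∑ K (λ i → g (+ i) (+ j))) ℤ.+ ∑ K (λ j → ∑ K (λ i → g (+ i) -[1+ j ]))) ℤ.+ (∑ K (λ j → ∑ K (λ i → g -[1+ i ] (+ j))) ℤ.+ ∑ K (λ j → ∑ K (λ i → g -[1+ i ] -[1+ j ])))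
    ≡⟨ shuffle (∑ K (λ j → ∑ K (λ i → g (+ i) (+ j)))) _ _ _ ⟩
  (∑ K (λ j → ∑ K (λ i → g (+ i) (+ j))) ℤ.+ ∑ K (λ j → ∑ K (λ i → g -[1+ i ] (+ j)))) ℤ.+ (∑ K (λ j → ∑ K (λ i → g (+ i) -[1+ j ])) ℤ.+ ∑ K (λ j → ∑ K (λ i → g -[1+ i ] -[1+ j ])))
    ≡⟨ cong₂ ℤ._+_ (∑-+ K _ _) (∑-+ K _ _) ⟨
  ∑± K (λ y → ∑± K (λ x → g x y)) ∎
  where
  open ≡-Reasoning
  shuffle : ∀ a b c d → (a ℤ.+ b) ℤ.+ (c ℤ.+ d) ≡ (a ℤ.+ c) ℤ.+ (b ℤ.+ d)
  shuffle = ℤ-Solver.solve-∀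
  split : ∀ (s : ℕ → ℤ) → ∑ K (λ i → ∑ K (λ j → g (s i) (+ j)) ℤ.+ ∑ K (λ j → g (s i) -[1+ j ]))
        ≡ ∑ K (λ j → ∑ K (λ i → g (s i) (+ j))) ℤ.+ ∑ K (λ j → ∑ K (λ i → g (s i) -[1+ j ]))
  split s = trans (∑-+ K _ _) (cong₂ ℤ._+_ (∑-swap K K _) (∑-swap K K _))

halve : ∀ n → ∃ λ t → n ≡ t ℤ.+ t ⊎ n ≡ 1ℤ ℤ.+ (t ℤ.+ t)
halve (+ zero)     = + 0 , inj₁ refl
halve (+ suc n)    with halve (+ n)
... | t , inj₁ e = t , inj₂ (cong (λ c → 1ℤ ℤ.+ c) e)
... | t , inj₂ e = 1ℤ ℤ.+ t , inj₁ (trans (cong (λ c → 1ℤ ℤ.+ c) e) (identity t))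
  where
  identity : ∀ t → 1ℤ ℤ.+ (1ℤ ℤ.+ (t ℤ.+ t)) ≡ (1ℤ ℤ.+ t) ℤ.+ (1ℤ ℤ.+ t)
  identity = ℤ-Solver.solve-∀
halve -[1+ zero ]  = -[1+ 0 ] , inj₂ refl
halve -[1+ suc n ] with halve -[1+ n ]
... | t , inj₁ e = -[1+ 0 ] ℤ.+ t , inj₂ (trans (cong (λ c → -[1+ 0 ] ℤ.+ c) e) (identity t))
  where
  identity : ∀ t → - 1ℤ ℤ.+ (t ℤ.+ t) ≡ 1ℤ ℤ.+ ((- 1ℤ ℤ.+ t) ℤ.+ (- 1ℤ ℤ.+ t))
  identity = ℤ-Solver.solve-∀
... | t , inj₂ e = t , inj₁ (trans (cong (λ c → -[1+ 0 ] ℤ.+ c) e) (identity t))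
  where
  identity : ∀ t → - 1ℤ ℤ.+ (1ℤ ℤ.+ (t ℤ.+ t)) ≡ t ℤ.+ t
  identity = ℤ-Solver.solve-∀

-- k (n + 2 y), for y in ℤ, runs through k m, for m in a residue class modulo 2;
-- the reflection m ↦ -1 - m exchanges the two classes.
HasSum-symmetric : ∀ (k : ℤ → ℤ) K → (∀ i → k -[1+ i ] ≡ k (+ i)) → (∀ i → K ≤ i → k (+ i) ≡ 0ℤ) →
  ∀ n → HasSum (λ y → k (n ℤ.+ (y ℤ.+ y))) (∑ K (λ i → k (+ i)))
HasSum-symmetric k K reflect vanish n = parity n
  where
  open ≡-Reasoning

  total : ∑ K (λ i → k (+ (i + i))) ℤ.+ ∑ K (λ i → k (+ suc (i + i))) ≡ ∑ K (λ i → k (+ i))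
  total = begin
    ∑ K (λ i → k (+ (i + i))) ℤ.+ ∑ K (λ i → k (+ suc (i + i))) ≡⟨ ∑-+ K _ _ ⟨
    ∑ K (λ i → k (+ (i + i)) ℤ.+ k (+ suc (i + i)))             ≡⟨ ∑-double K (λ i → k (+ i)) ⟨
    ∑ (K + K) (λ i → k (+ i))                                   ≡⟨ ∑-stable (λ i → k (+ i)) (ℕₚ.m≤m+n K K) vanish ⟩
    ∑ K (λ i → k (+ i))                                         ∎

  evens : ∀ {A} → K ≤ A → ∑ A (λ i → k (+ (i + i))) ≡ ∑ K (λ i → k (+ (i + i)))
  evens K≤A = ∑-stable (λ i → k (+ (i + i))) K≤A λ i K≤i → vanish (i + i) (ℕₚ.≤-trans K≤i (ℕₚ.m≤m+n i i))

  odds : ∀ {A} → K ≤ A → ∑ A (λ i → k (+ suc (i + i))) ≡ ∑ K (λ i → k (+ suc (i + i)))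
  odds K≤A = ∑-stable (λ i → k (+ suc (i + i))) K≤A λ i K≤i → vanish (suc (i + i)) (ℕₚ.m≤n⇒m≤1+n (ℕₚ.≤-trans K≤i (ℕₚ.m≤m+n i i)))

  at-even : HasSum (λ y → k (y ℤ.+ y)) (∑ K (λ i → k (+ i)))
  at-even = hasSum K λ A B K≤A K≤B →
    trans (cong₂ ℤ._+_ (evens K≤B) (trans (∑-cong A λ i _ → reflect (suc (i + i))) (odds K≤A))) total

  at-odd : HasSum (λ y → k (1ℤ ℤ.+ (y ℤ.+ y))) (∑ K (λ i → k (+ i)))
  at-odd = hasSum K λ A B K≤A K≤B →
    trans (cong₂ ℤ._+_ (odds K≤B) (trans (∑-cong A λ i _ → reflect (i + i)) (evens K≤A)))
      (trans (ℤₚ.+-comm (∑ K (λ i → k (+ suc (i + i)))) _) total)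

  parity : ∀ n → HasSum (λ y → k (n ℤ.+ (y ℤ.+ y))) (∑ K (λ i → k (+ i)))
  parity n with halve n
  ... | t , inj₁ refl = HasSum-cong (λ y → cong k (identity t y)) (HasSum-shift t at-even)
    where
    identity : ∀ t y → (t ℤ.+ y) ℤ.+ (t ℤ.+ y) ≡ t ℤ.+ t ℤ.+ (y ℤ.+ y)
    identity = ℤ-Solver.solve-∀
  ... | t , inj₂ refl = HasSum-cong (λ y → cong k (identity t y)) (HasSum-shift t at-odd)
    where
    identity : ∀ t y → 1ℤ ℤ.+ ((t ℤ.+ y) ℤ.+ (t ℤ.+ y)) ≡ 1ℤ ℤ.+ (t ℤ.+ t) ℤ.+ (y ℤ.+ y)
    identity = ℤ-Solver.solve-∀

-- The quadratic form x² + 3 y²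

sgn-+ : ∀ m n → sgn (m + n) ≡ sgn m ℤ.* sgn n
sgn-+ zero    n = sym (ℤₚ.*-identityˡ (sgn n))
sgn-+ (suc m) n = trans (cong -_ (sgn-+ m n)) (ℤₚ.neg-distribˡ-* (sgn m) (sgn n))

sgn-double : ∀ n → sgn (n + n) ≡ 1ℤ
sgn-double zero    = refl
sgn-double (suc n) = trans (cong (-_ ∘ sgn) (ℕₚ.+-suc n n)) (trans (ℤₚ.neg-involutive (sgn (n + n))) (sgn-double n))

-- n² and n have the same parity, so the sign (-1)^(x+y) in a product of theta series depends only
-- on the value x² + 3 y².
sgn-square : ∀ n → sgn (n * n) ≡ sgn n
sgn-square zero    = refl
sgn-square (suc n) = begin
  sgn (suc n * suc n)               ≡⟨ cong sgn (identity n) ⟩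
  sgn (suc (n + n) + n * n)         ≡⟨ sgn-+ (suc (n + n)) (n * n) ⟩
  - sgn (n + n) ℤ.* sgn (n * n)     ≡⟨ cong₂ (λ a b → - a ℤ.* b) (sgn-double n) (sgn-square n) ⟩
  - 1ℤ ℤ.* sgn n                    ≡⟨ ℤₚ.-1*i≡-i (sgn n) ⟩
  - sgn n                           ∎
  where
  open ≡-Reasoning
  identity : ∀ n → suc n * suc n ≡ suc (n + n) + n * n
  identity = ℕ-Solver.solve-∀

quadratic : ℤ → ℤ → ℕ
quadratic x y = ∣ x ∣ * ∣ x ∣ + 3 * (∣ y ∣ * ∣ y ∣)

-- x (x + 1) for every integer x. The cases make it natural-valued and invariant under x ↦ -1 - x by
-- definition.
pronic : ℤ → ℕ
pronic (+ n)    = n * suc n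
pronic -[1+ n ] = n * suc n

+-square : ∀ x → + (∣ x ∣ * ∣ x ∣) ≡ x ℤ.* x
+-square (+ n)    = ℤₚ.pos-* n n
+-square -[1+ n ] = refl

+-pronic : ∀ x → + pronic x ≡ x ℤ.* x ℤ.+ x
+-pronic (+ n)    = trans (ℤₚ.pos-* n (suc n)) (identity (+ n))
  where
  identity : ∀ x → x ℤ.* (1ℤ ℤ.+ x) ≡ x ℤ.* x ℤ.+ x
  identity = ℤ-Solver.solve-∀
+-pronic -[1+ n ] = trans (ℤₚ.pos-* n (suc n)) (identity (+ n))
  where
  identity : ∀ x → x ℤ.* (1ℤ ℤ.+ x) ≡ - (1ℤ ℤ.+ x) ℤ.* - (1ℤ ℤ.+ x) ℤ.+ - (1ℤ ℤ.+ x)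
  identity = ℤ-Solver.solve-∀

+-quadratic : ∀ x y → + quadratic x y ≡ x ℤ.* x ℤ.+ + 3 ℤ.* (y ℤ.* y)
+-quadratic x y = trans (ℤₚ.pos-+ (∣ x ∣ * ∣ x ∣) (3 * (∣ y ∣ * ∣ y ∣)))
  (cong₂ ℤ._+_ (+-square x) (trans (ℤₚ.pos-* 3 (∣ y ∣ * ∣ y ∣)) (cong (+ 3 ℤ.*_) (+-square y))))

quadratic-half : ℤ → ℤ → ℤ
quadratic-half y n = + 2 ℤ.* (y ℤ.* y) ℤ.+ + 2 ℤ.* (n ℤ.* y) ℤ.+ + 2 ℤ.* (n ℤ.* n)

-- The x of the same parity as y give even values and so contribute nothing to an odd exponent.
quadratic-even : ∀ y n → quadratic (y ℤ.+ (n ℤ.+ n)) y ≡ 2 * ∣ quadratic-half y n ∣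
quadratic-even y n = begin
  quadratic (y ℤ.+ (n ℤ.+ n)) y ≡⟨ cong ∣_∣ (trans (+-quadratic (y ℤ.+ (n ℤ.+ n)) y) (identity y n)) ⟩
  ∣ + 2 ℤ.* r ∣                 ≡⟨ ℤₚ.abs-* (+ 2) r ⟩
  2 * ∣ r ∣                     ∎
  where
  open ≡-Reasoning
  r = quadratic-half y n
  identity : ∀ y n → (y ℤ.+ (n ℤ.+ n)) ℤ.* (y ℤ.+ (n ℤ.+ n)) ℤ.+ + 3 ℤ.* (y ℤ.* y)
    ≡ + 2 ℤ.* (+ 2 ℤ.* (y ℤ.* y) ℤ.+ + 2 ℤ.* (n ℤ.* y) ℤ.+ + 2 ℤ.* (n ℤ.* n))
  identity = ℤ-Solver.solve-∀

-- In the variables m = n + 2y and n the form separates, which is what turns the double sum into a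
-- product of two series `Ψ`.
quadratic-odd : ∀ y n → quadratic (y ℤ.+ (1ℤ ℤ.+ (n ℤ.+ n))) y ≡ pronic (n ℤ.+ (y ℤ.+ y)) + (3 * pronic n + 1)
quadratic-odd y n = ℤₚ.+-injective (begin
  + quadratic (y ℤ.+ (1ℤ ℤ.+ (n ℤ.+ n))) y ≡⟨ +-quadratic (y ℤ.+ (1ℤ ℤ.+ (n ℤ.+ n))) y ⟩
  (y ℤ.+ (1ℤ ℤ.+ (n ℤ.+ n))) ℤ.* (y ℤ.+ (1ℤ ℤ.+ (n ℤ.+ n))) ℤ.+ + 3 ℤ.* (y ℤ.* y) ≡⟨ identity y n ⟩
  ((n ℤ.+ (y ℤ.+ y)) ℤ.* (n ℤ.+ (y ℤ.+ y)) ℤ.+ (n ℤ.+ (y ℤ.+ y))) ℤ.+ (+ 3 ℤ.* (n ℤ.* n ℤ.+ n) ℤ.+ 1ℤ)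
    ≡⟨ cong₂ (λ a b → a ℤ.+ (b ℤ.+ 1ℤ)) (+-pronic (n ℤ.+ (y ℤ.+ y))) (trans (ℤₚ.pos-* 3 (pronic n)) (cong (+ 3 ℤ.*_) (+-pronic n))) ⟨
  + pronic (n ℤ.+ (y ℤ.+ y)) ℤ.+ (+ (3 * pronic n) ℤ.+ 1ℤ) ∎)
  where
  open ≡-Reasoning
  identity : ∀ y n → (y ℤ.+ (1ℤ ℤ.+ (n ℤ.+ n))) ℤ.* (y ℤ.+ (1ℤ ℤ.+ (n ℤ.+ n))) ℤ.+ + 3 ℤ.* (y ℤ.* y)
    ≡ ((n ℤ.+ (y ℤ.+ y)) ℤ.* (n ℤ.+ (y ℤ.+ y)) ℤ.+ (n ℤ.+ (y ℤ.+ y))) ℤ.+ (+ 3 ℤ.* (n ℤ.* n ℤ.+ n) ℤ.+ 1ℤ)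
  identity = ℤ-Solver.solve-∀

n≤n*n : ∀ n → n ≤ n * n
n≤n*n zero    = z≤n
n≤n*n (suc n) = ℕₚ.m≤m+n (suc n) (n * suc n)

∣x∣≤quadratic : ∀ x y → ∣ x ∣ ≤ quadratic x y
∣x∣≤quadratic x y = ℕₚ.≤-trans (n≤n*n ∣ x ∣) (ℕₚ.m≤m+n (∣ x ∣ * ∣ x ∣) _)

∣y∣≤quadratic : ∀ x y → ∣ y ∣ ≤ quadratic x y
∣y∣≤quadratic x y = ℕₚ.≤-trans (n≤n*n ∣ y ∣) (ℕₚ.≤-trans (ℕₚ.m≤m+n (∣ y ∣ * ∣ y ∣) _) (ℕₚ.m≤n+m (3 * (∣ y ∣ * ∣ y ∣)) (∣ x ∣ * ∣ x ∣)))

∣n∣≤pronic+1 : ∀ n → ∣ n ∣ ≤ pronic n + 1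
∣n∣≤pronic+1 (+ n)    = ℕₚ.≤-trans (ℕₚ.m≤m*n n (suc n)) (ℕₚ.m≤m+n (n * suc n) 1)
∣n∣≤pronic+1 -[1+ n ] = subst (suc n ≤_) (ℕₚ.+-comm 1 (n * suc n)) (s≤s (ℕₚ.m≤m*n n (suc n)))

2*tri : ∀ n → 2 * tri n ≡ n * suc n
2*tri zero    = refl
2*tri (suc n) = trans (ℕₚ.*-distribˡ-+ 2 (tri n) (suc n)) (trans (cong (_+ 2 * suc n) (2*tri n)) (identity n))
  where
  identity : ∀ n → n * suc n + 2 * suc n ≡ suc n * suc (suc n)
  identity = ℕ-Solver.solve-∀

Φ-term : ℕ → ℤ → PS
Φ-term d x = κ (sgn ∣ x ∣) ⊗ mono (d * (∣ x ∣ * ∣ x ∣))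

⨁± : ℕ → (ℤ → PS) → PS
⨁± K t = ⨁ K (λ i → t (+ i)) ⊕ ⨁ K (λ i → t -[1+ i ])

coeff-⨁± : ∀ K t N → coeff (⨁± K t) N ≡ ∑± K (λ x → coeff (t x) N)
coeff-⨁± K t N = cong₂ ℤ._+_ (coeff-⨁ K _ N) (coeff-⨁ K _ N)

⨁±-distrib : ∀ K t u → ⨁± K t ⊗ ⨁± K u ≈ ⨁± K (λ y → ⨁± K (λ x → t x ⊗ u y))
⨁±-distrib K t u = ≈-trans (proj₁ (CommutativeRing.distrib seriesRing) (⨁± K t) _ _) (⊕-cong (outer (λ i → + i)) (outer -[1+_]))
  where
  outer : ∀ (s : ℕ → ℤ) → ⨁± K t ⊗ ⨁ K (u ∘ s) ≈ ⨁ K (λ j → ⨁± K (λ x → t x ⊗ u (s j)))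
  outer s = ≈-trans (⨁-distribˡ K (⨁± K t) (u ∘ s)) (⨁-cong K λ j →
    ≈-trans (proj₂ (CommutativeRing.distrib seriesRing) (u (s j)) _ _) (⊕-cong (⨁-distribʳ K (u (s j)) _) (⨁-distribʳ K (u (s j)) _)))

-- The term x = 0 takes one place of the non-negative half; with `2 + N` places, N + 1 remain for
-- `S`, enough up to exponent N.
Φ-⨁± : ∀ {d} → 1 ≤ d → ∀ N → Φ d ≈ ⨁± (2 + N) (Φ-term d) to N
Φ-⨁± {d} 1≤d N = upto λ k k≤N → let s = λ i → coeff (S-term d i) k in begin
  coeff (κ 1ℤ) k ℤ.+ coeff (κ (+ 2) ⊗ S d) k
    ≡⟨ cong₂ ℤ._+_ (sym (zeroth k)) (trans (coeff-κ-⊗ (+ 2) (S d) k) (two (coeff (S d) k))) ⟩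
  coeff (Φ-term d (+ 0)) k ℤ.+ (coeff (S d) k ℤ.+ coeff (S d) k)
    ≡⟨ cong₂ (λ a b → coeff (Φ-term d (+ 0)) k ℤ.+ (a ℤ.+ b)) (lim-∑ {S-term d} (S-order 1≤d) (s≤s k≤N)) (lim-∑ {S-term d} (S-order 1≤d) (s≤s (ℕₚ.m≤n⇒m≤1+n k≤N))) ⟩
  coeff (Φ-term d (+ 0)) k ℤ.+ (∑ (suc N) s ℤ.+ ∑ (2 + N) s)
    ≡⟨ ℤₚ.+-assoc (coeff (Φ-term d (+ 0)) k) _ _ ⟨
  coeff (Φ-term d (+ 0)) k ℤ.+ ∑ (suc N) s ℤ.+ ∑ (2 + N) s
    ≡⟨ cong (ℤ._+ ∑ (2 + N) s) (∑-first (suc N) (λ i → coeff (Φ-term d (+ i)) k)) ⟨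
  ∑ (2 + N) (λ i → coeff (Φ-term d (+ i)) k) ℤ.+ ∑ (2 + N) s
    ≡⟨ coeff-⨁± (2 + N) (Φ-term d) k ⟨
  coeff (⨁± (2 + N) (Φ-term d)) k ∎
  where
  open ≡-Reasoning
  two : ∀ a → + 2 ℤ.* a ≡ a ℤ.+ a
  two = ℤ-Solver.solve-∀
  zeroth : ∀ k → coeff (Φ-term d (+ 0)) k ≡ coeff (κ 1ℤ) k
  zeroth = at zeroth-term
    where
    zeroth-term : Φ-term d (+ 0) ≈ κ 1ℤ
    zeroth-term = ≈-trans (⊗-identityˡ (mono (d * 0))) (subst (λ e → mono e ≈ κ 1ℤ) (sym (ℕₚ.*-zeroʳ d)) mono-0)

-- The substitution x = y + 2 n + 1, under which x² + 3 y² becomes m (m + 1) + 3 n (n + 1) + 1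
-- with m = n + 2 y.
module Schröter (k : ℕ) where

  N K : ℕ
  N = suc (k + k)
  K = 2 + N

  G : ℕ → ℤ
  G e = coeff (mono e) N

  G-vanish : ∀ {e} → K ≤ suc e → G e ≡ 0ℤ
  G-vanish {e} (s≤s N<e) = coeff-mono-< e N N<e

  sgn-N : sgn N ≡ - 1ℤ
  sgn-N = cong -_ (sgn-double k)

  -- At an odd exponent all terms carry the sign -1, so it remains to count representations.
  coeff-Φ-terms : ∀ x y → coeff (Φ-term 1 x ⊗ Φ-term 3 y) N ≡ - G (quadratic x y)
  coeff-Φ-terms x y = begin
    coeff (Φ-term 1 x ⊗ Φ-term 3 y) N
      ≡⟨ at product N ⟩
    coeff (κ (sgn ∣ x ∣ ℤ.* sgn ∣ y ∣) ⊗ mono (1 * X + 3 * Y)) N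
      ≡⟨ coeff-κ-⊗ (sgn ∣ x ∣ ℤ.* sgn ∣ y ∣) (mono (1 * X + 3 * Y)) N ⟩
    sgn ∣ x ∣ ℤ.* sgn ∣ y ∣ ℤ.* G (1 * X + 3 * Y)
      ≡⟨ cong₂ (λ s e → s ℤ.* G (e + 3 * Y)) signs (ℕₚ.*-identityˡ X) ⟩
    sgn (quadratic x y) ℤ.* G (quadratic x y)
      ≡⟨ support (quadratic x y) ⟩
    - G (quadratic x y) ∎
    where
    open ≡-Reasoning
    X = ∣ x ∣ * ∣ x ∣
    Y = ∣ y ∣ * ∣ y ∣
    product : Φ-term 1 x ⊗ Φ-term 3 y ≈ κ (sgn ∣ x ∣ ℤ.* sgn ∣ y ∣) ⊗ mono (1 * X + 3 * Y)
    product = ≈-trans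
      (PS-Solver.solve 4 (λ a p b q → (a :* p) :* (b :* q) := (a :* b) :* (p :* q)) ≈-refl
        (κ (sgn ∣ x ∣)) (mono (1 * X)) (κ (sgn ∣ y ∣)) (mono (3 * Y)))
      (⊗-cong (≈-sym (κ-* (sgn ∣ x ∣) (sgn ∣ y ∣))) (≈-sym (mono-+ (1 * X) (3 * Y))))
    signs : sgn ∣ x ∣ ℤ.* sgn ∣ y ∣ ≡ sgn (quadratic x y)
    signs = sym (trans (sgn-+ X (3 * Y)) (cong₂ ℤ._*_ (sgn-square ∣ x ∣)
      (trans (cong sgn (identity Y)) (trans (sgn-+ (Y + Y) Y) (trans (cong₂ ℤ._*_ (sgn-double Y) (sgn-square ∣ y ∣)) (ℤₚ.*-identityˡ (sgn ∣ y ∣)))))))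
      where
      identity : ∀ Y → 3 * Y ≡ (Y + Y) + Y
      identity = ℕ-Solver.solve-∀
    support : ∀ e → sgn e ℤ.* G e ≡ - G e
    support e with N ℕ.≟ e
    ... | yes refl = trans (cong (ℤ._* G N) sgn-N) (ℤₚ.-1*i≡-i (G N))
    ... | no N≢e   = trans (cong (sgn e ℤ.*_) (coeff-mono-≢ e N N≢e)) (trans (ℤₚ.*-zeroʳ (sgn e)) (cong -_ (sym (coeff-mono-≢ e N N≢e))))

  g : ℤ → ℤ → ℤ
  g y n = G (pronic (n ℤ.+ (y ℤ.+ y)) + (3 * pronic n + 1))

  -- Both sides are the sum over a whole row of the plane, so the cutoff `K` is legitimate on each
  -- side although the substitution does not map the box to itself.
  rows : ∀ y → ∑± K (λ x → G (quadratic x y)) ≡ ∑± K (g y)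
  rows y = HasSum-unique
    (HasSum-cong pairs (HasSum-double (HasSum-shift y (HasSum-support λ x K≤∣x∣ →
      G-vanish (ℕₚ.m≤n⇒m≤1+n (ℕₚ.≤-trans K≤∣x∣ (∣x∣≤quadratic x y)))))))
    (HasSum-support λ n K≤∣n∣ → G-vanish (ℕₚ.m≤n⇒m≤1+n (ℕₚ.≤-trans K≤∣n∣ (ℕₚ.≤-trans (∣n∣≤pronic+1 n)
      (ℕₚ.≤-trans (ℕₚ.+-monoˡ-≤ 1 (ℕₚ.m≤m+n (pronic n) _)) (ℕₚ.m≤n+m (3 * pronic n + 1) (pronic (n ℤ.+ (y ℤ.+ y)))))))))
    where
    odd≢double : ∀ r → N ≢ 2 * r
    odd≢double r e = ℕₚ.even≢odd r k (trans (sym e) (cong (λ j → suc (k + j)) (sym (ℕₚ.+-identityʳ k))))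
    pairs : ∀ n → G (quadratic (y ℤ.+ (n ℤ.+ n)) y) ℤ.+ G (quadratic (y ℤ.+ (1ℤ ℤ.+ (n ℤ.+ n))) y) ≡ g y n
    pairs n = trans (cong₂ ℤ._+_ (trans (cong G (quadratic-even y n)) (coeff-mono-≢ (2 * ∣ quadratic-half y n ∣) N (odd≢double ∣ quadratic-half y n ∣))) (cong G (quadratic-odd y n))) (ℤₚ.+-identityˡ (g y n))

  columns : ∀ n → ∑± K (λ y → g y n) ≡ ∑ K (λ i → G (i * suc i + (3 * pronic n + 1)))
  columns n = HasSum-unique
    (HasSum-support λ y K≤∣y∣ → trans (cong G (sym (quadratic-odd y n)))
      (G-vanish (ℕₚ.m≤n⇒m≤1+n (ℕₚ.≤-trans K≤∣y∣ (∣y∣≤quadratic (y ℤ.+ (1ℤ ℤ.+ (n ℤ.+ n))) y)))))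
    (HasSum-symmetric (λ m → G (pronic m + (3 * pronic n + 1))) K (λ _ → refl)
      (λ i K≤i → G-vanish (ℕₚ.m≤n⇒m≤1+n (ℕₚ.≤-trans K≤i (ℕₚ.≤-trans (ℕₚ.m≤m*n i (suc i)) (ℕₚ.m≤m+n (i * suc i) _))))) n)

  quadrant : ℤ
  quadrant = ∑ K (λ j → ∑ K (λ i → G (i * suc i + (3 * (j * suc j) + 1))))

  coeff-ΦΦ : coeff (Φ 1 ⊗ Φ 3) N ≡ - (quadrant ℤ.+ quadrant)
  coeff-ΦΦ = begin
    coeff (Φ 1 ⊗ Φ 3) N
      ≡⟨ at-≤ expand N ℕₚ.≤-refl ⟩
    coeff (⨁± K (λ y → ⨁± K (λ x → Φ-term 1 x ⊗ Φ-term 3 y))) N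
      ≡⟨ trans (coeff-⨁± K (λ y → ⨁± K (λ x → Φ-term 1 x ⊗ Φ-term 3 y)) N) (∑±-cong K λ y → coeff-⨁± K (λ x → Φ-term 1 x ⊗ Φ-term 3 y) N) ⟩
    ∑± K (λ y → ∑± K (λ x → coeff (Φ-term 1 x ⊗ Φ-term 3 y) N))
      ≡⟨ ∑±-cong K (λ y → trans (∑±-cong K (λ x → coeff-Φ-terms x y)) (trans (∑±-neg K (λ x → G (quadratic x y))) (cong -_ (rows y)))) ⟩
    ∑± K (λ y → - ∑± K (g y))
      ≡⟨ trans (∑±-neg K (λ y → ∑± K (g y))) (cong -_ (∑±-swap K g)) ⟩
    - ∑± K (λ n → ∑± K (λ y → g y n))
      -- `pronic` agrees on n and -1 - n, so the two halves of the outer sum coincide; this is the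
      -- origin of the factor 2 before `v`.
      ≡⟨ cong -_ (∑±-cong K columns) ⟩
    - (quadrant ℤ.+ quadrant) ∎
    where
    open ≡-Reasoning
    expand : Φ 1 ⊗ Φ 3 ≈ ⨁± K (λ y → ⨁± K (λ x → Φ-term 1 x ⊗ Φ-term 3 y)) to N
    expand = to-trans (≈to-⊗ (Φ-⨁± {1} (s≤s z≤n) N) (Φ-⨁± {3} (s≤s z≤n) N)) (≈-to (⨁±-distrib K (Φ-term 1) (Φ-term 3)))

  coeff-ΨΨ : coeff (mono 1 ⊗ (Ψ 2 ⊗ Ψ 6)) N ≡ quadrant
  coeff-ΨΨ = begin
    coeff (mono 1 ⊗ (Ψ 2 ⊗ Ψ 6)) N
      ≡⟨ at-≤ expand N ℕₚ.≤-refl ⟩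
    coeff (⨁ K (λ j → ⨁ K (λ i → mono 1 ⊗ (Ψ-term 2 i ⊗ Ψ-term 6 j)))) N
      ≡⟨ trans (coeff-⨁ K (λ j → ⨁ K (λ i → mono 1 ⊗ (Ψ-term 2 i ⊗ Ψ-term 6 j))) N) (∑-cong K λ j _ → trans (coeff-⨁ K (λ i → mono 1 ⊗ (Ψ-term 2 i ⊗ Ψ-term 6 j)) N) (∑-cong K λ i _ → term i j)) ⟩
    quadrant ∎
    where
    open ≡-Reasoning
    N<K : N < K
    N<K = ℕₚ.n≤1+n (suc N)
    expand : mono 1 ⊗ (Ψ 2 ⊗ Ψ 6) ≈ ⨁ K (λ j → ⨁ K (λ i → mono 1 ⊗ (Ψ-term 2 i ⊗ Ψ-term 6 j))) to N
    expand = to-trans (≈to-⊗ (≈-to ≈-refl) (≈to-⊗ (lim-⨁ {Ψ-term 2} (Ψ-order {2} (s≤s z≤n)) N<K) (lim-⨁ {Ψ-term 6} (Ψ-order {6} (s≤s z≤n)) N<K)))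
      (≈-to (≈-trans (⊗-cong ≈-refl (≈-trans (⨁-distribˡ K (⨁ K (Ψ-term 2)) (Ψ-term 6)) (⨁-cong K λ j → ⨁-distribʳ K (Ψ-term 6 j) (Ψ-term 2))))
        (≈-trans (⨁-distribˡ K (mono 1) (λ j → ⨁ K (λ i → Ψ-term 2 i ⊗ Ψ-term 6 j))) (⨁-cong K λ j → ⨁-distribˡ K (mono 1) (λ i → Ψ-term 2 i ⊗ Ψ-term 6 j)))))
    exponent : ∀ i j → 1 + (2 * tri i + 6 * tri j) ≡ i * suc i + (3 * (j * suc j) + 1)
    exponent i j = trans (identity (tri i) (tri j)) (cong₂ (λ a b → a + (3 * b + 1)) (2*tri i) (2*tri j))
      where
      identity : ∀ a b → 1 + (2 * a + 6 * b) ≡ 2 * a + (3 * (2 * b) + 1)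
      identity = ℕ-Solver.solve-∀
    term : ∀ i j → coeff (mono 1 ⊗ (Ψ-term 2 i ⊗ Ψ-term 6 j)) N ≡ G (i * suc i + (3 * (j * suc j) + 1))
    term i j = trans (at combined N) (cong G (exponent i j))
      where
      combined : mono 1 ⊗ (Ψ-term 2 i ⊗ Ψ-term 6 j) ≈ mono (1 + (2 * tri i + 6 * tri j))
      combined = ≈-sym (≈-trans (mono-+ 1 (2 * tri i + 6 * tri j)) (⊗-cong ≈-refl (mono-+ (2 * tri i) (6 * tri j))))

coeff-Φ₁Φ₃ : ∀ k → coeff (Φ 1 ⊗ Φ 3) (suc (k + k)) ≡ - (+ 2 ℤ.* coeff (mono 1 ⊗ (Ψ 2 ⊗ Ψ 6)) (suc (k + k)))
coeff-Φ₁Φ₃ k = trans coeff-ΦΦ (cong -_ (trans (cong₂ ℤ._+_ (sym coeff-ΨΨ) (sym coeff-ΨΨ)) (two (coeff (mono 1 ⊗ (Ψ 2 ⊗ Ψ 6)) N))))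
  where
  open Schröter k
  two : ∀ a → a ℤ.+ a ≡ + 2 ℤ.* a
  two = ℤ-Solver.solve-∀

-- Congruences and parity

infix 4 _≈_mod_

-- With the quotient kept as a series, a congruence is an equation that the ring solver can check
-- once the quotient is named.
record _≈_mod_ (x y : PS) (m : ℤ) : Set where
  constructor multiple
  field
    quotient : PS
    equality : x ≈ y ⊕ κ m ⊗ quotient

open _≈_mod_

≈-mod : ∀ {x y m} → x ≈ y → x ≈ y mod m
≈-mod {y = y} {m} p = multiple (κ 0ℤ) (≈-trans p (PS-Solver.solve 2 (λ y m → y := y :+ m :* con 0ℤ) ≈-refl y (κ m)))

combine-mod : ∀ {x y l r m} c → l ≈ r mod m → x ⊕ c ⊗ (r ⊕ ⊖ l) ≈ y mod m → x ≈ y mod m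
combine-mod {x} {y} {l} {r} {m} c (multiple p l≈) (multiple q e) = multiple (q ⊕ c ⊗ p)
  (combine (κ 1ℤ) e (combine c l≈
  (PS-Solver.solve 8 (λ x y l r m c p q →
      x :+ con 1ℤ :* (y :+ m :* q :- (x :+ c :* (r :- l))) :+ c :* (r :+ m :* p :- l)
      := y :+ m :* (q :+ c :* p))
    ≈-refl x y l r (κ m) c p q)))

mod-sym : ∀ {x y m} → x ≈ y mod m → y ≈ x mod m
mod-sym {x} {y} p = combine-mod (⊖ κ 1ℤ) p (≈-mod (PS-Solver.solve 2 (λ x y → y :+ (:- con 1ℤ) :* (y :- x) := x) ≈-refl x y))

mod-trans : ∀ {x y z m} → x ≈ y mod m → y ≈ z mod m → x ≈ z mod m
mod-trans {x} {y} {z} p q = combine-mod (κ 1ℤ) p (combine-mod (κ 1ℤ) q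
  (≈-mod (PS-Solver.solve 3 (λ x y z → x :+ con 1ℤ :* (y :- x) :+ con 1ℤ :* (z :- y) := z) ≈-refl x y z)))

mod-⊗ : ∀ {x x′ y y′ m} → x ≈ x′ mod m → y ≈ y′ mod m → x ⊗ y ≈ x′ ⊗ y′ mod m
mod-⊗ {x} {x′} {y} {y′} p q = combine-mod y p (combine-mod x′ q
  (≈-mod (PS-Solver.solve 4 (λ x x′ y y′ → x :* y :+ y :* (x′ :- x) :+ x′ :* (y′ :- y) := x′ :* y′) ≈-refl x x′ y y′)))

-- The modulus grows with the factor: congruences modulo 2 become congruences modulo 8 or 16 behind
-- a factor 4 or 8.
mod-scale : ∀ {x y m} k → x ≈ y mod m → κ k ⊗ x ≈ κ k ⊗ y mod (k ℤ.* m)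
mod-scale {x} {y} {m} k (multiple q e) = multiple q
  (combine (κ k) e (combine q (≈-sym (κ-* k m))
  (PS-Solver.solve 6 (λ x y k m q n → k :* x :+ k :* (y :+ m :* q :- x) :+ q :* (n :- k :* m) := k :* y :+ n :* q)
    ≈-refl x y (κ k) (κ m) q (κ (k ℤ.* m)))))

unit-cancel-mod : ∀ u {x y m} → coeff u 0 ≡ 1ℤ → u ⊗ x ≈ u ⊗ y mod m → x ≈ y mod m
unit-cancel-mod u {x} {y} {m} u₀ (multiple q e) = multiple (recip u ⊗ q) (unit-cancel u u₀
  (combine (κ 1ℤ) e (combine (⊖ (κ m ⊗ q)) (⊗-recip u u₀)
  (PS-Solver.solve 6 (λ x y u m q r →
      u :* x :+ con 1ℤ :* (u :* y :+ m :* q :- u :* x) :+ (:- (m :* q)) :* (con 1ℤ :- u :* r) := u :* (y :+ m :* (r :* q)))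
    ≈-refl x y u (κ m) q (recip u)))))

mod-coeff : ∀ {x y m} (p : x ≈ y mod m) → ∀ n → coeff x n ≡ coeff y n ℤ.+ m ℤ.* coeff (quotient p) n
mod-coeff {y = y} {m} (multiple q e) n = trans (at e n) (cong (λ c → coeff y n ℤ.+ c) (coeff-κ-⊗ m q n))

coeff-mod : ∀ {x y m} → (∀ n → ∃ λ c → coeff x n ≡ coeff y n ℤ.+ m ℤ.* c) → x ≈ y mod m
coeff-mod {x} {y} {m} h = multiple (series (λ n → proj₁ (h n)))
  (coeffwise λ n → trans (proj₂ (h n)) (cong (λ c → coeff y n ℤ.+ c) (sym (coeff-κ-⊗ m (series (λ k → proj₁ (h k))) n))))

-- A positive power of q is not a unit, so it is cancelled by shifting coefficients.
mono-cancel-mod : ∀ e {x y m} → mono e ⊗ x ≈ mono e ⊗ y mod m → x ≈ y mod m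
mono-cancel-mod e {x} {y} {m} p = coeff-mod λ n → coeff (quotient p) (e + n) ,
  trans (sym (coeff-mono-⊗ e x n)) (trans (mod-coeff p (e + n)) (cong (ℤ._+ m ℤ.* coeff (quotient p) (e + n)) (coeff-mono-⊗ e y n)))

mod-lim : ∀ {t u m} → (∀ i → t i ≈ u i mod m) → lim t ≈ lim u mod m
mod-lim {t} {u} {m} p = coeff-mod λ N → ∑ (suc N) (λ i → coeff (quotient (p i)) N) , go N (suc N)
  where
  go : ∀ N M → ∑ M (λ i → coeff (t i) N) ≡ ∑ M (λ i → coeff (u i) N) ℤ.+ m ℤ.* ∑ M (λ i → coeff (quotient (p i)) N)
  go N zero    = sym (trans (ℤₚ.+-identityˡ _) (ℤₚ.*-zeroʳ m))
  go N (suc M) = trans (cong₂ ℤ._+_ (go N M) (mod-coeff (p M) N)) (shuffle (∑ M (λ i → coeff (u i) N)) m (∑ M (λ i → coeff (quotient (p i)) N)) (coeff (u M) N) (coeff (quotient (p M)) N))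
    where
    shuffle : ∀ a m b c d → a ℤ.+ m ℤ.* b ℤ.+ (c ℤ.+ m ℤ.* d) ≡ a ℤ.+ c ℤ.+ m ℤ.* (b ℤ.+ d)
    shuffle = ℤ-Solver.solve-∀

-- Even and odd parts

parity : ℕ → Bool
parity zero    = false
parity (suc n) = not (parity n)

parity-+ : ∀ m n → parity (m + n) ≡ parity m xor parity n
parity-+ zero    n = refl
parity-+ (suc m) n rewrite parity-+ m n with parity m
... | false = refl
... | true  with parity n
...   | false = refl
...   | true  = refl

parity-double : ∀ n → parity (n + n) ≡ false
parity-double n rewrite parity-+ n n with parity n
... | false = refl
... | true  = refl

parity-* : ∀ m n → parity (m * n) ≡ parity m ∧ parity n
parity-* zero    n = refl
parity-* (suc m) n rewrite parity-+ n (m * n) | parity-* m n with parity m | parity n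
... | false | false = refl
... | false | true  = refl
... | true  | false = refl
... | true  | true  = refl

data Halved : ℕ → Set where
  double     : ∀ k → Halved (k + k)
  suc-double : ∀ k → Halved (suc (k + k))

halved : ∀ n → Halved n
halved zero    = double 0
halved (suc n) with halved n
... | double k     = suc-double k
... | suc-double k = subst Halved (cong suc (ℕₚ.+-suc k k)) (double (suc k))

record Even (x : PS) : Set where
  constructor isEven
  field
    odd-vanish : ∀ n → parity n ≡ true → coeff x n ≡ 0ℤ

record Odd (x : PS) : Set where
  constructor isOdd
  field
    even-vanish : ∀ n → parity n ≡ false → coeff x n ≡ 0ℤ

open Even
open Odd

ev od : PS → PS
coeff (ev x) n = if parity n then 0ℤ else coeff x n
coeff (od x) n = if parity n then coeff x n else 0ℤ

ev-Even : ∀ x → Even (ev x)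
ev-Even x = isEven λ n p → cong (λ b → if b then 0ℤ else coeff x n) p

od-Odd : ∀ x → Odd (od x)
od-Odd x = isOdd λ n p → cong (λ b → if b then coeff x n else 0ℤ) p

ev⊕od : ∀ x → x ≈ ev x ⊕ od x
ev⊕od x = coeffwise split
  where
  split : ∀ n → coeff x n ≡ coeff (ev x ⊕ od x) n
  split n with parity n
  ... | false = sym (ℤₚ.+-identityʳ (coeff x n))
  ... | true  = sym (ℤₚ.+-identityˡ (coeff x n))

od-unique : ∀ {x e o} → x ≈ e ⊕ o → Even e → Odd o → od x ≈ o
od-unique {x} {e} {o} p even odd = coeffwise go
  where
  go : ∀ n → coeff (od x) n ≡ coeff o n
  go n with parity n in eq
  ... | false = sym (even-vanish odd n eq)
  ... | true  = trans (at p n) (trans (cong (ℤ._+ coeff o n) (odd-vanish even n eq)) (ℤₚ.+-identityˡ (coeff o n)))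

⊗-parity : ∀ {x y} → (∀ j k → coeff x j ≡ 0ℤ ⊎ coeff y k ≡ 0ℤ ⊎ parity (j + k) ≡ false) → Even (x ⊗ y)
⊗-parity {x} {y} h = isEven λ n p → ·-vanish (coeff x) (coeff y) n λ j k e → go n p j k e (h j k)
  where
  go : ∀ n → parity n ≡ true → ∀ j k → j + k ≡ n → coeff x j ≡ 0ℤ ⊎ coeff y k ≡ 0ℤ ⊎ parity (j + k) ≡ false → coeff x j ≡ 0ℤ ⊎ coeff y k ≡ 0ℤ
  go n p j k e (inj₁ z)        = inj₁ z
  go n p j k e (inj₂ (inj₁ z)) = inj₂ z
  go n p j k refl (inj₂ (inj₂ q)) with () ← trans (sym p) q

Even-⊗ : ∀ {x y} → Even x → Even y → Even (x ⊗ y)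
Even-⊗ {x} {y} ex ey = ⊗-parity go
  where
  go : ∀ j k → coeff x j ≡ 0ℤ ⊎ coeff y k ≡ 0ℤ ⊎ parity (j + k) ≡ false
  go j k rewrite parity-+ j k with parity j in pj | parity k in pk
  ... | true  | _     = inj₁ (odd-vanish ex j pj)
  ... | false | true  = inj₂ (inj₁ (odd-vanish ey k pk))
  ... | false | false = inj₂ (inj₂ refl)

Odd-⊗-Odd : ∀ {x y} → Odd x → Odd y → Even (x ⊗ y)
Odd-⊗-Odd {x} {y} ox oy = ⊗-parity go
  where
  go : ∀ j k → coeff x j ≡ 0ℤ ⊎ coeff y k ≡ 0ℤ ⊎ parity (j + k) ≡ false
  go j k rewrite parity-+ j k with parity j in pj | parity k in pk
  ... | false | _     = inj₁ (even-vanish ox j pj)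
  ... | true  | false = inj₂ (inj₁ (even-vanish oy k pk))
  ... | true  | true  = inj₂ (inj₂ refl)

Odd-⊗ : ∀ {x y} → Odd x → Even y → Odd (x ⊗ y)
Odd-⊗ {x} {y} ox ey = isOdd λ n p → ·-vanish (coeff x) (coeff y) n (go n p)
  where
  go : ∀ n → parity n ≡ false → ∀ j k → j + k ≡ n → coeff x j ≡ 0ℤ ⊎ coeff y k ≡ 0ℤ
  go n p j k refl with parity j in pj | parity k in pk
  ... | false | _     = inj₁ (even-vanish ox j pj)
  ... | true  | true  = inj₂ (odd-vanish ey k pk)
  ... | true  | false with () ← trans (sym p) (trans (parity-+ j k) (cong₂ _xor_ pj pk))

Even-⊕ : ∀ {x y} → Even x → Even y → Even (x ⊕ y)
Even-⊕ ex ey = isEven λ n p → cong₂ ℤ._+_ (odd-vanish ex n p) (odd-vanish ey n p)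

Odd-⊕ : ∀ {x y} → Odd x → Odd y → Odd (x ⊕ y)
Odd-⊕ ox oy = isOdd λ n p → cong₂ ℤ._+_ (even-vanish ox n p) (even-vanish oy n p)

Even-⊖ : ∀ {x} → Even x → Even (⊖ x)
Even-⊖ ex = isEven λ n p → cong -_ (odd-vanish ex n p)

Odd-⊖ : ∀ {x} → Odd x → Odd (⊖ x)
Odd-⊖ ox = isOdd λ n p → cong -_ (even-vanish ox n p)

Even-κ : ∀ c → Even (κ c)
Even-κ c = isEven λ { (suc n) p → refl }

Even-≈ : ∀ {x y} → x ≈ y → Even x → Even y
Even-≈ p ex = isEven λ n q → trans (sym (at p n)) (odd-vanish ex n q)

Even-mono : ∀ e → parity e ≡ false → Even (mono e)
Even-mono e p = isEven λ n q → coeff-mono-≢ e n λ { refl → case-⊥ (trans (sym q) p) }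
  where
  case-⊥ : true ≡ false → ⊥
  case-⊥ ()

Odd-mono : ∀ e → parity e ≡ true → Odd (mono e)
Odd-mono e p = isOdd λ n q → coeff-mono-≢ e n λ { refl → case-⊥ (trans (sym p) q) }
  where
  case-⊥ : true ≡ false → ⊥
  case-⊥ ()

Even-lim : ∀ {t} → (∀ i → Even (t i)) → Even (lim t)
Even-lim h = isEven λ n p → ∑-zero (suc n) λ i _ → odd-vanish (h i) n p

Odd-lim : ∀ {t} → (∀ i → Odd (t i)) → Odd (lim t)
Odd-lim h = isOdd λ n p → ∑-zero (suc n) λ i _ → even-vanish (h i) n p

od-⊕ : ∀ x y → od (x ⊕ y) ≈ od x ⊕ od y
od-⊕ x y = coeffwise go
  where
  go : ∀ n → coeff (od (x ⊕ y)) n ≡ coeff (od x ⊕ od y) n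
  go n with parity n
  ... | false = refl
  ... | true  = refl

-- Even factors pass through `od`; this is why the multiplier of the generating function is made
-- even before odd parts are taken.
od-⊗ : ∀ x {y} → Even y → od (x ⊗ y) ≈ od x ⊗ y
od-⊗ x {y} ey = od-unique
  (≈-trans (⊗-cong (ev⊕od x) ≈-refl) (proj₂ (CommutativeRing.distrib seriesRing) y (ev x) (od x)))
  (Even-⊗ (ev-Even x) ey) (Odd-⊗ (od-Odd x) ey)

od-cong : ∀ {x y} → x ≈ y → od x ≈ od y
od-cong {x} {y} p = coeffwise λ n → cong (λ c → if parity n then c else 0ℤ) (at p n)

od-mod : ∀ {x y m} → x ≈ y mod m → od x ≈ od y mod m
od-mod {x} {y} {m} (multiple q e) = multiple (od q) (≈-trans (od-cong e) (≈-trans (od-⊕ y (κ m ⊗ q))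
  (⊕-cong ≈-refl (≈-trans (od-cong (⊗-comm (κ m) q)) (≈-trans (od-⊗ q (Even-κ m)) (⊗-comm (od q) (κ m)))))))

-- Squares modulo 2

square-mod-2 : ∀ z → ∃ λ c → z ℤ.* z ≡ z ℤ.+ + 2 ℤ.* c
square-mod-2 z with halve z
... | t , inj₁ refl = + 2 ℤ.* (t ℤ.* t) ℤ.- t , identity t
  where
  identity : ∀ t → (t ℤ.+ t) ℤ.* (t ℤ.+ t) ≡ t ℤ.+ t ℤ.+ + 2 ℤ.* (+ 2 ℤ.* (t ℤ.* t) ℤ.- t)
  identity = ℤ-Solver.solve-∀
... | t , inj₂ refl = + 2 ℤ.* (t ℤ.* t) ℤ.+ t , identity t
  where
  identity : ∀ t → (1ℤ ℤ.+ (t ℤ.+ t)) ℤ.* (1ℤ ℤ.+ (t ℤ.+ t)) ≡ 1ℤ ℤ.+ (t ℤ.+ t) ℤ.+ + 2 ℤ.* (+ 2 ℤ.* (t ℤ.* t) ℤ.+ t)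
  identity = ℤ-Solver.solve-∀

-- The first and last products of the convolution coincide, so modulo 2 only the inner ones remain.
·-square-suc-suc : ∀ a n → (a · a) (2 + n) ≡ (tail a · tail a) n ℤ.+ + 2 ℤ.* (a 0 ℤ.* a (2 + n))
·-square-suc-suc a n = trans (·-suc a a (suc n)) (trans (cong (λ c → a 0 ℤ.* a (2 + n) ℤ.+ c) (·-sucʳ (tail a) a n))
  (shuffle (a 0) (a (2 + n)) ((tail a · tail a) n)))
  where
  shuffle : ∀ x y z → x ℤ.* y ℤ.+ (y ℤ.* x ℤ.+ z) ≡ z ℤ.+ + 2 ℤ.* (x ℤ.* y)
  shuffle = ℤ-Solver.solve-∀

-- With `square-suc-double`, the Frobenius map a(q)² ≡ a(q²): once symmetric pairs are removed, the
-- middle term, the square of `a k`, is left.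
square-double : ∀ a k → ∃ λ c → (a · a) (k + k) ≡ a k ℤ.+ + 2 ℤ.* c
square-double a zero    with square-mod-2 (a 0)
... | c , e = c , trans (·-zero a a) e
square-double a (suc k) with square-double (tail a) k
... | c , e = c ℤ.+ a 0 ℤ.* a (2 + (k + k)) , trans (cong (λ j → (a · a) (suc j)) (ℕₚ.+-suc k k))
    (trans (·-square-suc-suc a (k + k)) (trans (cong (ℤ._+ + 2 ℤ.* (a 0 ℤ.* a (2 + (k + k)))) e) (shuffle (a (suc k)) c _)))
  where
  shuffle : ∀ x y z → x ℤ.+ + 2 ℤ.* y ℤ.+ + 2 ℤ.* z ≡ x ℤ.+ + 2 ℤ.* (y ℤ.+ z)
  shuffle = ℤ-Solver.solve-∀

square-suc-double : ∀ a k → ∃ λ c → (a · a) (suc (k + k)) ≡ + 2 ℤ.* c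
square-suc-double a zero    = a 0 ℤ.* a 1 , trans (·-suc a a 0) (trans (cong (λ c → a 0 ℤ.* a 1 ℤ.+ c) (·-zero (tail a) a)) (shuffle (a 0) (a 1)))
  where
  shuffle : ∀ x y → x ℤ.* y ℤ.+ y ℤ.* x ≡ + 2 ℤ.* (x ℤ.* y)
  shuffle = ℤ-Solver.solve-∀
square-suc-double a (suc k) with square-suc-double (tail a) k
... | c , e = c ℤ.+ a 0 ℤ.* a (3 + (k + k)) , trans (cong (λ j → (a · a) (2 + j)) (ℕₚ.+-suc k k))
    (trans (·-square-suc-suc a (suc (k + k))) (trans (cong (ℤ._+ + 2 ℤ.* (a 0 ℤ.* a (3 + (k + k)))) e) (sym (ℤₚ.*-distribˡ-+ (+ 2) c _))))

coeff-mono-double : ∀ e k → coeff (mono (e + e)) (k + k) ≡ coeff (mono e) k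
coeff-mono-double zero    zero    = refl
coeff-mono-double zero    (suc k) = refl
coeff-mono-double (suc e) zero    = refl
coeff-mono-double (suc e) (suc k) rewrite ℕₚ.+-suc e e | ℕₚ.+-suc k k = coeff-mono-double e k

-- Frobenius, as `S (2 * d)` is `S d` with q replaced by q².
S-square : ∀ {d} → 1 ≤ d → S d ⊗ S d ≈ S (2 * d) mod (+ 2)
S-square {d} 1≤d = coeff-mod λ n → go (halved n)
  where
  exponent : ∀ i → 2 * d * (suc i * suc i) ≡ d * (suc i * suc i) + d * (suc i * suc i)
  exponent i = trans (ℕₚ.*-assoc 2 d (suc i * suc i)) (cong (λ j → d * (suc i * suc i) + j) (ℕₚ.+-identityʳ _))
  evens : ∀ k → coeff (S (2 * d)) (k + k) ≡ coeff (S d) k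
  evens k = trans (∑-cong (suc (k + k)) λ i _ → term i) (sym (lim-∑ {S-term d} (S-order 1≤d) (s≤s (ℕₚ.m≤m+n k k))))
    where
    term : ∀ i → coeff (S-term (2 * d) i) (k + k) ≡ coeff (S-term d i) k
    term i = trans (coeff-κ-⊗ (sgn (suc i)) (mono (2 * d * (suc i * suc i))) (k + k))
      (trans (cong (sgn (suc i) ℤ.*_) (trans (cong (λ e → coeff (mono e) (k + k)) (exponent i)) (coeff-mono-double (d * (suc i * suc i)) k)))
        (sym (coeff-κ-⊗ (sgn (suc i)) (mono (d * (suc i * suc i))) k)))
  S-Even : Even (S (2 * d))
  S-Even = Even-lim {S-term (2 * d)} λ i → Even-⊗ (Even-κ (sgn (suc i)))
    (Even-mono (2 * d * (suc i * suc i)) (trans (cong parity (exponent i)) (parity-double (d * (suc i * suc i)))))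
  go : ∀ {n} → Halved n → ∃ λ c → coeff (S d ⊗ S d) n ≡ coeff (S (2 * d)) n ℤ.+ + 2 ℤ.* c
  go (double k)     with square-double (coeff (S d)) k
  ... | c , e = c , trans e (cong (ℤ._+ + 2 ℤ.* c) (sym (evens k)))
  go (suc-double k) with square-suc-double (coeff (S d)) k
  ... | c , e = c , trans e (trans (sym (ℤₚ.+-identityˡ (+ 2 ℤ.* c))) (cong (ℤ._+ + 2 ℤ.* c) (sym (odd-vanish S-Even (suc (k + k)) (cong not (parity-double k))))))

od-square : ∀ x → od (x ⊗ x) ≈ κ 0ℤ mod (+ 2)
od-square x = coeff-mod λ n → go (halved n)
  where
  go : ∀ {n} → Halved n → ∃ λ c → coeff (od (x ⊗ x)) n ≡ const 0ℤ n ℤ.+ + 2 ℤ.* c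
  go (double k)     rewrite parity-double k = 0ℤ , sym (trans (ℤₚ.+-identityʳ _) (const-zero (k + k)))
  go (suc-double k) rewrite parity-double k with square-suc-double (coeff x) k
  ... | c , e = c , trans e (sym (ℤₚ.+-identityˡ (+ 2 ℤ.* c)))

-- E d and O d collect the terms of S d with an even, respectively odd, summation index.
E-term O-term : ℕ → ℕ → PS
E-term d i = mono (d * ((2 + (i + i)) * (2 + (i + i))))
O-term d i = mono (d * (suc (i + i) * suc (i + i)))

E O : ℕ → PS
E d = lim (E-term d)
O d = lim (O-term d)

n≤d*m*m : ∀ {d n m} → 1 ≤ d → n ≤ m → n ≤ d * (m * m)
n≤d*m*m {m = m} 1≤d n≤m = ℕₚ.≤-trans n≤m (ℕₚ.≤-trans (n≤n*n m) (n≤d*n (m * m) 1≤d))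

O-order : ∀ {d} → 1 ≤ d → Order (O-term d)
O-order {d} 1≤d i N N<i = coeff-mono-< (d * (suc (i + i) * suc (i + i))) N (n≤d*m*m 1≤d (ℕₚ.m≤n⇒m≤1+n (ℕₚ.≤-trans N<i (ℕₚ.m≤m+n i i))))

S-split : ∀ {d} → 1 ≤ d → S d ≈ E d ⊕ ⊖ O d
S-split {d} 1≤d = coeffwise λ N → let M = suc N in begin
  coeff (S d) N
    ≡⟨ lim-∑ {S-term d} (S-order 1≤d) (ℕₚ.m≤m+n M M) ⟩
  ∑ (M + M) (λ i → coeff (S-term d i) N)
    ≡⟨ ∑-double M (λ i → coeff (S-term d i) N) ⟩
  ∑ M (λ i → coeff (S-term d (i + i)) N ℤ.+ coeff (S-term d (suc (i + i))) N)
    -- `S-term` counts from zero, so its even positions carry the odd summation indices.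
    ≡⟨ ∑-cong M (λ i _ → cong₂ ℤ._+_ (odd-term N i) (even-term N i)) ⟩
  ∑ M (λ i → - coeff (O-term d i) N ℤ.+ coeff (E-term d i) N)
    ≡⟨ trans (∑-+ M (λ i → - coeff (O-term d i) N) _) (trans (cong (ℤ._+ coeff (E d) N) (∑-neg M (λ i → coeff (O-term d i) N))) (ℤₚ.+-comm (- coeff (O d) N) _)) ⟩
  coeff (E d) N ℤ.- coeff (O d) N ∎
  where
  open ≡-Reasoning
  odd-term : ∀ N i → coeff (S-term d (i + i)) N ≡ - coeff (O-term d i) N
  odd-term N i = trans (coeff-κ-⊗ (- sgn (i + i)) (O-term d i) N) (trans (cong (λ s → - s ℤ.* coeff (O-term d i) N) (sgn-double i)) (ℤₚ.-1*i≡-i (coeff (O-term d i) N)))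
  even-term : ∀ N i → coeff (S-term d (suc (i + i))) N ≡ coeff (E-term d i) N
  even-term N i = trans (coeff-κ-⊗ (- (- sgn (i + i))) (E-term d i) N) (trans (cong (λ s → - (- s) ℤ.* coeff (E-term d i) N) (sgn-double i)) (ℤₚ.*-identityˡ (coeff (E-term d i) N)))

-- An odd square is 1 plus 8 times a triangular number.
O-Ψ : ∀ {d} → 1 ≤ d → O d ≈ mono d ⊗ Ψ (8 * d)
O-Ψ {d} 1≤d = to-all λ N → to-trans (lim-⨁ {O-term d} (O-order 1≤d) (ℕₚ.n<1+n N))
  (to-trans (≈-to (≈-trans (⨁-cong (suc N) term) (≈-sym (⨁-distribˡ (suc N) (mono d) (Ψ-term (8 * d))))))
  (≈to-⊗ (≈-to ≈-refl) (to-sym (lim-⨁ {Ψ-term (8 * d)} (Ψ-order {8 * d} (ℕₚ.≤-trans 1≤d (ℕₚ.m≤m+n d (7 * d)))) (ℕₚ.n<1+n N)))))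
  where
  exponent : ∀ i → d * (suc (i + i) * suc (i + i)) ≡ d + 8 * d * tri i
  exponent i = trans (identity₁ d i) (trans (cong (λ p → d + 4 * d * p) (sym (2*tri i))) (identity₂ d (tri i)))
    where
    identity₁ : ∀ d i → d * (suc (i + i) * suc (i + i)) ≡ d + 4 * d * (i * suc i)
    identity₁ = ℕ-Solver.solve-∀
    identity₂ : ∀ d t → d + 4 * d * (2 * t) ≡ d + 8 * d * t
    identity₂ = ℕ-Solver.solve-∀
  term : ∀ i → O-term d i ≈ mono d ⊗ Ψ-term (8 * d) i
  term i = subst (λ e → mono e ≈ mono d ⊗ Ψ-term (8 * d) i) (sym (exponent i)) (mono-+ d (8 * d * tri i))

sgn-mod-2 : ∀ n → κ (sgn n) ≈ κ 1ℤ mod (+ 2)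
sgn-mod-2 zero    = ≈-mod ≈-refl
sgn-mod-2 (suc n) = mod-trans (multiple (⊖ κ (sgn n)) (coeffwise λ k → trans (negate k) (cong (λ c → coeff (κ (sgn n)) k ℤ.+ c) (sym (coeff-κ-⊗ (+ 2) (⊖ κ (sgn n)) k))))) (sgn-mod-2 n)
  where
  negate : ∀ k → coeff (κ (- sgn n)) k ≡ coeff (κ (sgn n)) k ℤ.+ + 2 ℤ.* coeff (⊖ κ (sgn n)) k
  negate zero    = identity (sgn n)
    where
    identity : ∀ s → - s ≡ s ℤ.+ + 2 ℤ.* - s
    identity = ℤ-Solver.solve-∀
  negate (suc k) = refl

-- Even squares are 4 times squares, and the signs disappear modulo 2.
E-S : ∀ d → E d ≈ S (4 * d) mod (+ 2)
E-S d = mod-lim {E-term d} {S-term (4 * d)} λ i → mod-sym (mod-trans (mod-⊗ (sgn-mod-2 (suc i)) (≈-mod ≈-refl))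
  (≈-mod (≈-trans (⊗-identityˡ _) (subst (λ e → mono e ≈ E-term d i) (sym (identity d i)) ≈-refl))))
  where
  identity : ∀ d i → 4 * d * (suc i * suc i) ≡ d * ((2 + (i + i)) * (2 + (i + i)))
  identity = ℕ-Solver.solve-∀

E-Even : ∀ d → Even (E d)
E-Even d = Even-lim {E-term d} λ i → Even-mono (d * ((2 + (i + i)) * (2 + (i + i)))) (exponent i)
  where
  exponent : ∀ i → parity (d * ((2 + (i + i)) * (2 + (i + i)))) ≡ false
  exponent i = trans (cong parity (identity d i)) (parity-double (d * (2 * (suc i * suc i))))
    where
    identity : ∀ d i → d * ((2 + (i + i)) * (2 + (i + i))) ≡ d * (2 * (suc i * suc i)) + d * (2 * (suc i * suc i))
    identity = ℕ-Solver.solve-∀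

O-Odd : ∀ d → parity d ≡ true → Odd (O d)
O-Odd d p = Odd-lim {O-term d} λ i → Odd-mono (d * (suc (i + i) * suc (i + i))) (exponent i)
  where
  exponent : ∀ i → parity (d * (suc (i + i) * suc (i + i))) ≡ true
  exponent i rewrite parity-* d (suc (i + i) * suc (i + i)) | p | parity-* (suc (i + i)) (suc (i + i)) | parity-double i = refl

theta : ∀ {d} → 1 ≤ d → 𝐟 d ⊗ 𝐟 d ≈ 𝐟 (2 * d) ⊗ Φ d
theta {d} 1≤d = Gauss.Theta.theta d 1≤d

triangular : ∀ {d} → 1 ≤ d → 𝐟 (2 * d) ⊗ 𝐟 (2 * d) ≈ 𝐟 d ⊗ Ψ d
triangular {d} 1≤d = Gauss.Triangular.triangular d 1≤d

fin-Even : ∀ {m} → parity m ≡ false → ∀ n → Even (fin m n)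
fin-Even {m} p zero    = Even-≈ (≈-sym (fin-zero m)) (Even-κ 1ℤ)
fin-Even {m} p (suc n) = Even-≈ (≈-sym (fin-suc m n)) (Even-⊗ (Even-⊕ (Even-κ 1ℤ) (Even-⊖ (Even-mono (m * suc n)
  (trans (parity-* m (suc n)) (cong (λ b → b ∧ parity (suc n)) p))))) (fin-Even p n))

𝐟-Even : ∀ {m} → parity m ≡ false → Even (𝐟 m)
𝐟-Even {m} p = isEven λ n → odd-vanish (fin-Even p n) n

-- Relations modulo 2, 8 and 16

𝐟-double : ∀ {d} → 1 ≤ d → 𝐟 (2 * d) ≈ 𝐟 d ⊗ 𝐟 d mod (+ 2)
𝐟-double {d} 1≤d = multiple (⊖ (𝐟 (2 * d) ⊗ S d)) (combine (⊖ κ 1ℤ) (theta 1≤d)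
  (PS-Solver.solve 3 (λ f f₂ s → f₂ :+ (:- con 1ℤ) :* (f₂ :* (con 1ℤ :+ con (+ 2) :* s) :- f :* f)
      := f :* f :+ con (+ 2) :* (:- (f₂ :* s))) ≈-refl (𝐟 d) (𝐟 (2 * d)) (S d)))

-- Cancel `𝐟 d` in `𝐟 d ⊗ Ψ d` = `𝐟 (2 * d)`² ≡ `𝐟 d`⁴.
Ψ-cube : ∀ {d} → 1 ≤ d → Ψ d ≈ 𝐟 d ^ᴾ 3 mod (+ 2)
Ψ-cube {d} 1≤d = unit-cancel-mod (𝐟 d) refl
  (combine-mod (⊖ κ 1ℤ) (≈-mod (triangular 1≤d))
  (combine-mod (𝐟 (2 * d) ⊕ 𝐟 d ⊗ 𝐟 d) (𝐟-double 1≤d)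
  (≈-mod (PS-Solver.solve 3 (λ f f₂ ψ →
      f :* ψ :+ (:- con 1ℤ) :* (f :* ψ :- f₂ :* f₂) :+ (f₂ :+ f :* f) :* (f :* f :- f₂) := f :* f :^ 3)
    ≈-refl (𝐟 d) (𝐟 (2 * d)) (Ψ d)))))

1≤2* : ∀ {d} → 1 ≤ d → 1 ≤ 2 * d
1≤2* {d} 1≤d = ℕₚ.≤-trans 1≤d (ℕₚ.m≤m+n d (d + 0))

-- Two further doublings: f₄³ ≡ f₂⁶ ≡ f₁¹². The cofactors are a³ - b³ over a - b at a = f₄, b = f₂²,
-- and a⁶ - b⁶ over a - b at a = f₂, b = f₁².
Ψ-power : ∀ {d} → 1 ≤ d → Ψ (2 * (2 * d)) ≈ (𝐟 d ^ᴾ 3) ^ᴾ 4 mod (+ 2)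
Ψ-power {d} 1≤d = mod-trans (Ψ-cube (1≤2* (1≤2* 1≤d)))
  (combine-mod (f₄ ⊗ f₄ ⊕ f₄ ⊗ (f₂ ⊗ f₂) ⊕ (f₂ ⊗ f₂) ⊗ (f₂ ⊗ f₂)) (𝐟-double (1≤2* 1≤d))
  (combine-mod ((f₂ ⊕ f₁ ⊗ f₁) ⊗ (f₂ ^ᴾ 4 ⊕ f₂ ⊗ f₂ ⊗ (f₁ ⊗ f₁) ⊗ (f₁ ⊗ f₁) ⊕ (f₁ ⊗ f₁) ^ᴾ 4)) (𝐟-double 1≤d)
  (≈-mod (PS-Solver.solve 3 (λ f f₂ f₄ →
      f₄ :^ 3 :+ (f₄ :* f₄ :+ f₄ :* (f₂ :* f₂) :+ (f₂ :* f₂) :* (f₂ :* f₂)) :* (f₂ :* f₂ :- f₄)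
      :+ ((f₂ :+ f :* f) :* (f₂ :^ 4 :+ f₂ :* f₂ :* (f :* f) :* (f :* f) :+ (f :* f) :^ 4)) :* (f :* f :- f₂)
      := (f :^ 3) :^ 4)
    ≈-refl f₁ f₂ f₄))))
  where
  f₁ = 𝐟 d
  f₂ = 𝐟 (2 * d)
  f₄ = 𝐟 (2 * (2 * d))

q : PS
q = mono 1

-- `r` is half of φ(-q) φ(-q³) - 1, and `X` is its reduction modulo 2. `X₂` is `X` with q replaced
-- by q², and `Y₂` is `X₂` + `X₂`² modulo 2 with the square written out by Frobenius.
α β v r X X₂ Y₂ : PS
α  = 𝐟 2 ^ᴾ 3
β  = 𝐟 6 ^ᴾ 3
v  = q ⊗ (Ψ 2 ⊗ Ψ 6)
r  = S 1 ⊕ S 3 ⊕ κ (+ 2) ⊗ (S 1 ⊗ S 3)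
X  = S 1 ⊕ S 3
X₂ = S 2 ⊕ S 6
Y₂ = S 2 ⊕ S 4 ⊕ S 6 ⊕ S 12

Ψ-Even : ∀ {d} → parity d ≡ false → Even (Ψ d)
Ψ-Even {d} p = Even-lim {Ψ-term d} λ i → Even-mono (d * tri i) (trans (parity-* d (tri i)) (cong (λ b → b ∧ parity (tri i)) p))

v-Odd : Odd v
v-Odd = Odd-⊗ (Odd-mono 1 refl) (Even-⊗ (Ψ-Even {2} refl) (Ψ-Even {6} refl))

ΦΦ-r : Φ 1 ⊗ Φ 3 ≈ κ 1ℤ ⊕ κ (+ 2) ⊗ r
ΦΦ-r = PS-Solver.solve 2 (λ s t → (con 1ℤ :+ con (+ 2) :* s) :* (con 1ℤ :+ con (+ 2) :* t)
  := con 1ℤ :+ con (+ 2) :* (s :+ t :+ con (+ 2) :* (s :* t))) ≈-refl (S 1) (S 3)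

-- An exact equation: the odd coefficients of 2 `r` are known, and 2 cancels in the integers.
od-r : od r ≈ ⊖ v
od-r = coeffwise λ n → go (halved n)
  where
  go : ∀ {n} → Halved n → coeff (od r) n ≡ coeff (⊖ v) n
  go (double k)     = trans (even-vanish (od-Odd r) (k + k) (parity-double k)) (cong -_ (sym (even-vanish v-Odd (k + k) (parity-double k))))
  go (suc-double k) = trans (cong (λ b → if b then coeff r N else 0ℤ) (cong not (parity-double k)))
    (ℤₚ.*-cancelˡ-≡ (+ 2) (coeff r N) (- coeff v N) (begin
      + 2 ℤ.* coeff r N            ≡⟨ coeff-κ-⊗ (+ 2) r N ⟨
      coeff (κ (+ 2) ⊗ r) N        ≡⟨ ℤₚ.+-identityˡ _ ⟨
      coeff (κ 1ℤ ⊕ κ (+ 2) ⊗ r) N ≡⟨ at ΦΦ-r N ⟨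
      coeff (Φ 1 ⊗ Φ 3) N          ≡⟨ coeff-Φ₁Φ₃ k ⟩
      - (+ 2 ℤ.* coeff v N)        ≡⟨ ℤₚ.neg-distribʳ-* (+ 2) (coeff v N) ⟩
      + 2 ℤ.* - coeff v N          ∎))
    where
    open ≡-Reasoning
    N = suc (k + k)

r-split : r ≈ ev r ⊕ ⊖ v
r-split = ≈-trans (ev⊕od r) (⊕-cong ≈-refl od-r)

r-X : r ≈ X mod (+ 2)
r-X = multiple (S 1 ⊗ S 3) ≈-refl

X-split : X ≈ (E 1 ⊕ E 3) ⊕ ⊖ (O 1 ⊕ O 3)
X-split = ≈-trans (⊕-cong (S-split {1} (s≤s z≤n)) (S-split {3} (s≤s z≤n)))
  (PS-Solver.solve 4 (λ a b c d → (a :- b) :+ (c :- d) := (a :+ c) :+ :- (b :+ d)) ≈-refl (E 1) (O 1) (E 3) (O 3))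

od-X : od X ≈ ⊖ (O 1 ⊕ O 3)
od-X = od-unique X-split (Even-⊕ (E-Even 1) (E-Even 3)) (Odd-⊖ (Odd-⊕ (O-Odd 1 refl) (O-Odd 3 refl)))

-- Two readings of the odd part of `r`: it is exactly -`v`, and modulo 2 it is the odd part of `X`,
-- collected from the odd squares.
v-O : v ≈ O 1 ⊕ O 3 mod (+ 2)
v-O = combine-mod (κ 1ℤ) (≈-mod od-r) (combine-mod (⊖ κ 1ℤ) (od-mod r-X) (combine-mod (⊖ κ 1ℤ) (≈-mod od-X)
  (≈-mod (PS-Solver.solve 4 (λ v s x o → v :+ con 1ℤ :* (:- v :- s) :+ (:- con 1ℤ) :* (x :- s) :+ (:- con 1ℤ) :* (:- o :- x) := o) ≈-refl v (od r) (od X) (O 1 ⊕ O 3)))))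

1≤ : ∀ {d} → 1 ≤ suc d
1≤ = s≤s z≤n

-- Modulo 2 the even part of `X` is S(q⁴) + S(q¹²), the square of `X₂`, and the odd part is `v`,
-- whose two `Ψ` are cubes of Euler products.
X-recursion : X ≈ X₂ ⊗ X₂ ⊕ q ⊗ (α ⊗ β) mod (+ 2)
X-recursion =
  combine-mod (κ 1ℤ) (≈-mod X-split)
  (combine-mod (κ 1ℤ) (E-S 1)
  (combine-mod (κ 1ℤ) (E-S 3)
  (combine-mod (κ 1ℤ) v-O
  (combine-mod (⊖ (q ⊗ Ψ 6)) (Ψ-cube {2} 1≤)
  (combine-mod (⊖ (q ⊗ α)) (Ψ-cube {6} 1≤)
  (combine-mod (⊖ κ 1ℤ) (S-square {2} 1≤)
  (combine-mod (⊖ κ 1ℤ) (S-square {6} 1≤)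
  (multiple (⊖ (S 2 ⊗ S 6) ⊕ ⊖ (q ⊗ (α ⊗ β)))
  (PS-Solver.solve 13 (λ x e e′ o s₄ s₁₂ s₂ s₆ q ψ ψ′ a b →
      x :+ con 1ℤ :* ((e :+ e′) :- o :- x) :+ con 1ℤ :* (s₄ :- e) :+ con 1ℤ :* (s₁₂ :- e′) :+ con 1ℤ :* (o :- q :* (ψ :* ψ′))
      :+ (:- (q :* ψ′)) :* (a :- ψ) :+ (:- (q :* a)) :* (b :- ψ′)
      :+ (:- con 1ℤ) :* (s₄ :- s₂ :* s₂) :+ (:- con 1ℤ) :* (s₁₂ :- s₆ :* s₆)
      := (s₂ :+ s₆) :* (s₂ :+ s₆) :+ q :* (a :* b) :+ con (+ 2) :* (:- (s₂ :* s₆) :- q :* (a :* b)))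
    ≈-refl X (E 1) (E 3) (O 1 ⊕ O 3) (S 4) (S 12) (S 2) (S 6) q (Ψ 2) (Ψ 6) α β)))))))))

-- `O 1 ⊕ O 3` is q ψ(q⁸) + q³ ψ(q²⁴), hence ≡ q α⁴ + q³ β⁴; by `v-O` it is also ≡ `v` ≡ q α β. One
-- q is cancelled.
αβ-relation : α ^ᴾ 4 ⊕ mono 2 ⊗ β ^ᴾ 4 ≈ α ⊗ β mod (+ 2)
αβ-relation = mono-cancel-mod 1
  (combine-mod q (mod-sym (Ψ-power {2} 1≤))
  (combine-mod (q ⊗ mono 2) (mod-sym (Ψ-power {6} 1≤))
  (combine-mod (κ 1ℤ) (≈-mod (≈-sym (O-Ψ {1} 1≤)))
  (combine-mod (Ψ 24) (≈-mod (≈-sym (mono-+ 1 2)))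
  (combine-mod (κ 1ℤ) (≈-mod (≈-sym (O-Ψ {3} 1≤)))
  (combine-mod (κ 1ℤ) (mod-sym v-O)
  (combine-mod (q ⊗ Ψ 6) (Ψ-cube {2} 1≤)
  (combine-mod (q ⊗ α) (Ψ-cube {6} 1≤)
  (≈-mod (PS-Solver.solve 11 (λ q m m₃ a b ψ ψ′ ψ₈ ψ₂₄ o o′ →
      q :* (a :^ 4 :+ m :* b :^ 4) :+ q :* (ψ₈ :- a :^ 4) :+ q :* m :* (ψ₂₄ :- b :^ 4)
      :+ con 1ℤ :* (o :- q :* ψ₈) :+ ψ₂₄ :* (m₃ :- q :* m) :+ con 1ℤ :* (o′ :- m₃ :* ψ₂₄)
      :+ con 1ℤ :* (q :* (ψ :* ψ′) :- (o :+ o′)) :+ q :* ψ′ :* (a :- ψ) :+ q :* a :* (b :- ψ′)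
      := q :* (a :* b))
    ≈-refl q (mono 2) (mono 3) α β (Ψ 2) (Ψ 6) (Ψ 8) (Ψ 24) (O 1) (O 3)))))))))))

X-square : X ⊗ X ≈ X₂ mod (+ 2)
X-square =
  combine-mod (κ 1ℤ) (S-square {1} 1≤)
  (combine-mod (κ 1ℤ) (S-square {3} 1≤)
  (multiple (S 1 ⊗ S 3) (PS-Solver.solve 4 (λ s₁ s₃ s₂ s₆ →
      (s₁ :+ s₃) :* (s₁ :+ s₃) :+ con 1ℤ :* (s₂ :- s₁ :* s₁) :+ con 1ℤ :* (s₆ :- s₃ :* s₃) := s₂ :+ s₆ :+ con (+ 2) :* (s₁ :* s₃))
    ≈-refl (S 1) (S 3) (S 2) (S 6))))

-- The square of `X-recursion`: the left side becomes `X₂` and the cross term drops out modulo 2.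
X₂-recursion : X₂ ≈ X₂ ^ᴾ 4 ⊕ mono 2 ⊗ (α ⊗ β) ^ᴾ 2 mod (+ 2)
X₂-recursion =
  combine-mod (κ 1ℤ) (mod-sym X-square)
  (combine-mod (X ⊕ (X₂ ⊗ X₂ ⊕ q ⊗ (α ⊗ β))) X-recursion
  (combine-mod (⊖ ((α ⊗ β) ^ᴾ 2)) (≈-mod (mono-+ 1 1))
  (multiple (X₂ ⊗ X₂ ⊗ (q ⊗ (α ⊗ β)))
  (PS-Solver.solve 5 (λ x x₂ q m c →
      x₂ :+ con 1ℤ :* (x :* x :- x₂) :+ (x :+ (x₂ :* x₂ :+ q :* c)) :* (x₂ :* x₂ :+ q :* c :- x) :+ (:- (c :^ 2)) :* (q :* q :- m)
      := x₂ :^ 4 :+ m :* c :^ 2 :+ con (+ 2) :* (x₂ :* x₂ :* (q :* c)))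
    ≈-refl X X₂ q (mono 2) (α ⊗ β)))))

Y₂-X₂ : Y₂ ≈ X₂ ⊕ X₂ ⊗ X₂ mod (+ 2)
Y₂-X₂ =
  combine-mod (⊖ κ 1ℤ) (S-square {2} 1≤)
  (combine-mod (⊖ κ 1ℤ) (S-square {6} 1≤)
  (multiple (⊖ (S 2 ⊗ S 6)) (PS-Solver.solve 4 (λ s₂ s₄ s₆ s₁₂ →
      s₂ :+ s₄ :+ s₆ :+ s₁₂ :+ (:- con 1ℤ) :* (s₄ :- s₂ :* s₂) :+ (:- con 1ℤ) :* (s₁₂ :- s₆ :* s₆)
      := (s₂ :+ s₆) :+ (s₂ :+ s₆) :* (s₂ :+ s₆) :+ con (+ 2) :* (:- (s₂ :* s₆)))
    ≈-refl (S 2) (S 4) (S 6) (S 12))))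

-- For y = x + x² the sum y + y² collapses modulo 2 to x + x⁴, which `X₂-recursion` evaluates.
Y₂-quadratic : Y₂ ⊕ Y₂ ⊗ Y₂ ≈ mono 2 ⊗ (α ⊗ β) ^ᴾ 2 mod (+ 2)
Y₂-quadratic =
  combine-mod (κ 1ℤ ⊕ Y₂ ⊕ (X₂ ⊕ X₂ ⊗ X₂)) Y₂-X₂
  (combine-mod (κ 1ℤ) X₂-recursion
  (multiple (X₂ ^ᴾ 2 ⊕ X₂ ^ᴾ 3 ⊕ X₂ ^ᴾ 4) (PS-Solver.solve 4 (λ y x m c →
      y :+ y :* y :+ (con 1ℤ :+ y :+ (x :+ x :* x)) :* (x :+ x :* x :- y) :+ con 1ℤ :* (x :^ 4 :+ m :* c :^ 2 :- x)
      := m :* c :^ 2 :+ con (+ 2) :* (x :^ 2 :+ x :^ 3 :+ x :^ 4))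
    ≈-refl Y₂ X₂ (mono 2) (α ⊗ β))))

-- For the difference z of the two sides z (z + α) ≡ 0, and z + α is a unit since z has no constant term.
Y₂-α : Y₂ ⊗ α ≈ mono 2 ⊗ β ^ᴾ 3 mod (+ 2)
Y₂-α = combine-mod (κ 1ℤ) z≈0
  (≈-mod (PS-Solver.solve 2 (λ a b → a :+ con 1ℤ :* (con 0ℤ :- (a :- b)) := b) ≈-refl (Y₂ ⊗ α) (mono 2 ⊗ β ^ᴾ 3)))
  where
  z : PS
  z = Y₂ ⊗ α ⊕ ⊖ (mono 2 ⊗ β ^ᴾ 3)
  z≈0 : z ≈ κ 0ℤ mod (+ 2)
  z≈0 = unit-cancel-mod (z ⊕ α) refl
    (combine-mod (α ^ᴾ 2) Y₂-quadratic
    (combine-mod (mono 2 ⊗ β ^ᴾ 2) αβ-relation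
    (multiple (⊖ (Y₂ ⊗ α ⊗ mono 2 ⊗ β ^ᴾ 3)) (PS-Solver.solve 4 (λ y a b m →
        (y :* a :- m :* b :^ 3 :+ a) :* (y :* a :- m :* b :^ 3)
        :+ a :^ 2 :* (m :* (a :* b) :^ 2 :- (y :+ y :* y))
        :+ m :* b :^ 2 :* (a :* b :- (a :^ 4 :+ m :* b :^ 4))
        := (y :* a :- m :* b :^ 3 :+ a) :* con 0ℤ :+ con (+ 2) :* (:- (y :* a :* m :* b :^ 3)))
      ≈-refl Y₂ α β (mono 2)))))

-- Φ 1 ⊗ Φ 3 = U - 2 v with U even and v odd, so D = Φ 1 ⊗ Φ 3 ⊗ (U + 2 v) is even.
U D : PS
U = κ 1ℤ ⊕ κ (+ 2) ⊗ ev r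
D = U ⊗ U ⊕ ⊖ (κ (+ 4) ⊗ (v ⊗ v))

-- `D` is 1 + 4 (e + e² - v²) with e = `ev r`. Modulo 2, e² - v² ≡ r² ≡ S(q²) + S(q⁶), and e is the
-- even part of `X`, that is S(q⁴) + S(q¹²).
D-mod-8 : D ≈ κ 1ℤ ⊕ κ (+ 4) ⊗ (S 4 ⊕ S 12 ⊕ S 2 ⊕ S 6) mod (+ 8)
D-mod-8 = combine-mod (κ 1ℤ) (mod-scale (+ 4) inner) (≈-mod (PS-Solver.solve 3 (λ e v s →
    (con 1ℤ :+ con (+ 2) :* e) :* (con 1ℤ :+ con (+ 2) :* e) :- con (+ 4) :* (v :* v)
    :+ con 1ℤ :* (con (+ 4) :* s :- con (+ 4) :* (e :+ e :* e :- v :* v)) := con 1ℤ :+ con (+ 4) :* s)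
  ≈-refl (ev r) v (S 4 ⊕ S 12 ⊕ S 2 ⊕ S 6)))
  where
  inner : ev r ⊕ ev r ⊗ ev r ⊕ ⊖ (v ⊗ v) ≈ S 4 ⊕ S 12 ⊕ S 2 ⊕ S 6 mod (+ 2)
  inner =
    combine-mod (κ 1ℤ ⊕ (ev r ⊕ v) ⊕ r) (≈-mod (≈-sym r-split))
    (combine-mod (κ 1ℤ ⊕ r ⊕ X) r-X
    (combine-mod (κ 1ℤ) (≈-mod X-split)
    (combine-mod (κ 1ℤ) v-O
    (combine-mod (κ 1ℤ) (E-S 1)
    (combine-mod (κ 1ℤ) (E-S 3)
    (combine-mod (κ 1ℤ) X-square
    (multiple (r ⊗ v) (PS-Solver.solve 11 (λ e v r x o e₁ e₃ s₄ s₁₂ s₂ s₆ →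
        e :+ e :* e :- v :* v :+ (con 1ℤ :+ (e :+ v) :+ r) :* (r :- (e :- v)) :+ (con 1ℤ :+ r :+ x) :* (x :- r)
        :+ con 1ℤ :* ((e₁ :+ e₃) :- o :- x) :+ con 1ℤ :* (o :- v) :+ con 1ℤ :* (s₄ :- e₁) :+ con 1ℤ :* (s₁₂ :- e₃) :+ con 1ℤ :* (s₂ :+ s₆ :- x :* x)
        := s₄ :+ s₁₂ :+ s₂ :+ s₆ :+ con (+ 2) :* (r :* v))
      ≈-refl (ev r) v r X (O 1 ⊕ O 3) (E 1) (E 3) (S 4) (S 12) (S 2) (S 6)))))))))

Φ-square : ∀ {d} → 1 ≤ d → Φ d ⊗ Φ d ≈ κ 1ℤ ⊕ κ (+ 4) ⊗ (S d ⊕ S (2 * d)) mod (+ 8)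
Φ-square {d} 1≤d = combine-mod (κ 1ℤ) (mod-scale (+ 4) (S-square 1≤d)) (≈-mod (PS-Solver.solve 2 (λ s t →
    (con 1ℤ :+ con (+ 2) :* s) :* (con 1ℤ :+ con (+ 2) :* s) :+ con 1ℤ :* (con (+ 4) :* t :- con (+ 4) :* (s :* s)) := con 1ℤ :+ con (+ 4) :* (s :+ t))
  ≈-refl (S d) (S (2 * d))))

-- The terms 4 (S(q²) + S(q⁴)) of the two factors add up to a multiple of 8, and 4 (S(q⁶) + S(q¹²))
-- is left.
D-Φ : D ⊗ (Φ 2 ⊗ Φ 2) ≈ Φ 6 ⊗ Φ 6 mod (+ 8)
D-Φ =
  combine-mod (Φ 2 ⊗ Φ 2) D-mod-8
  (combine-mod (κ 1ℤ ⊕ κ (+ 4) ⊗ (S 4 ⊕ S 12 ⊕ S 2 ⊕ S 6)) (Φ-square {2} 1≤)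
  (combine-mod (κ 1ℤ) (mod-sym (Φ-square {6} 1≤))
  (multiple (S 2 ⊕ S 4 ⊕ κ (+ 2) ⊗ ((S 4 ⊕ S 12 ⊕ S 2 ⊕ S 6) ⊗ (S 2 ⊕ S 4)))
  (PS-Solver.solve 7 (λ d p p₆ s₂ s₄ s₆ s₁₂ →
      d :* p :+ p :* (con 1ℤ :+ con (+ 4) :* (s₄ :+ s₁₂ :+ s₂ :+ s₆) :- d)
      :+ (con 1ℤ :+ con (+ 4) :* (s₄ :+ s₁₂ :+ s₂ :+ s₆)) :* (con 1ℤ :+ con (+ 4) :* (s₂ :+ s₄) :- p)
      :+ con 1ℤ :* (p₆ :- (con 1ℤ :+ con (+ 4) :* (s₆ :+ s₁₂)))
      := p₆ :+ con (+ 8) :* (s₂ :+ s₄ :+ con (+ 2) :* ((s₄ :+ s₁₂ :+ s₂ :+ s₆) :* (s₂ :+ s₄))))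
    ≈-refl D (Φ 2 ⊗ Φ 2) (Φ 6 ⊗ Φ 6) (S 2) (S 4) (S 6) (S 12)))))

-- The generating function and its odd part

series-^ : ∀ a n → series (a ^ n) ≈ series a ^ᴾ n
series-^ a zero    = coeffwise λ { zero → refl ; (suc n) → refl }
series-^ a (suc n) = ≈-trans (coeffwise λ _ → refl) (⊗-cong (≈-refl {series a}) (series-^ a n))

𝐅 : PS
𝐅 = series CP3series

𝐅-product : 𝐅 ⊗ (𝐟 1 ^ᴾ 2 ⊗ 𝐟 2 ^ᴾ 2) ≈ 𝐟 3 ^ᴾ 6 ⊗ 𝐟 6 ^ᴾ 6
𝐅-product = ≈-trans (⊗-cong 𝐅≈ (≈-sym denominator≈))
  (combine numerator (⊗-recip denominator refl)
  (≈-trans (PS-Solver.solve 3 (λ n d r → n :* r :* d :+ n :* (con 1ℤ :- d :* r) := n) ≈-refl numerator denominator (recip denominator)) numerator≈))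
  where
  numerator denominator : PS
  numerator   = series ((f 3 ^ 6) · (f 6 ^ 6))
  denominator = series ((f 1 ^ 2) · (f 2 ^ 2))
  𝐅≈ : 𝐅 ≈ numerator ⊗ recip denominator
  𝐅≈ = coeffwise λ _ → refl
  numerator≈ : numerator ≈ 𝐟 3 ^ᴾ 6 ⊗ 𝐟 6 ^ᴾ 6
  numerator≈ = ≈-trans (coeffwise λ _ → refl) (⊗-cong (series-^ (f 3) 6) (series-^ (f 6) 6))
  denominator≈ : denominator ≈ 𝐟 1 ^ᴾ 2 ⊗ 𝐟 2 ^ᴾ 2
  denominator≈ = ≈-trans (coeffwise λ _ → refl) (⊗-cong (series-^ (f 1) 2) (series-^ (f 2) 2))

-- The theta identity replaces f₁² by f₂ φ(-q) and f₃⁶ by f₆³ φ(-q³)³; the fourth φ(-q³) is the one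
-- multiplied in.
𝐅-Φ : 𝐅 ⊗ (Φ 1 ⊗ Φ 3) ⊗ α ≈ Φ 3 ^ᴾ 4 ⊗ β ^ᴾ 3
𝐅-Φ =
  combine (𝐅 ⊗ Φ 3 ⊗ 𝐟 2 ^ᴾ 2) (≈-sym (theta {1} 1≤))
  (combine (Φ 3) 𝐅-product
  (combine ((s ⊗ s ⊕ s ⊗ t ⊕ t ⊗ t) ⊗ Φ 3 ⊗ 𝐟 6 ^ᴾ 6) (theta {3} 1≤)
  (PS-Solver.solve 7 (λ F p p₃ f₁ f₂ f₃ f₆ →
      F :* (p :* p₃) :* f₂ :^ 3 :+ F :* p₃ :* f₂ :^ 2 :* (f₁ :* f₁ :- f₂ :* p)
      :+ p₃ :* (f₃ :^ 6 :* f₆ :^ 6 :- F :* (f₁ :^ 2 :* f₂ :^ 2))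
      :+ ((f₃ :* f₃) :* (f₃ :* f₃) :+ (f₃ :* f₃) :* (f₆ :* p₃) :+ (f₆ :* p₃) :* (f₆ :* p₃)) :* p₃ :* f₆ :^ 6 :* (f₆ :* p₃ :- f₃ :* f₃)
      := p₃ :^ 4 :* (f₆ :^ 3) :^ 3)
    ≈-refl 𝐅 (Φ 1) (Φ 3) (𝐟 1) (𝐟 2) (𝐟 3) (𝐟 6))))
  where
  s = 𝐟 3 ⊗ 𝐟 3
  t = 𝐟 6 ⊗ Φ 3

-- (1 + 2s)⁴ = 1 + 8 `Z₃` + 16 `W₃` for s = `S 3`, and `V⁺` is the conjugate of U - 2v.
Z₃ W₃ V⁺ : PS
Z₃ = S 3 ⊕ S 3 ⊗ S 3
W₃ = S 3 ^ᴾ 2 ⊕ κ (+ 2) ⊗ S 3 ^ᴾ 3 ⊕ S 3 ^ᴾ 4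
V⁺ = U ⊕ κ (+ 2) ⊗ v

-- `𝐅-Φ` times `V⁺`. As `V⁺` ≡ 1 modulo 2, it does not affect 8 `Z₃` modulo 16.
𝐅-D : 𝐅 ⊗ (D ⊗ α) ≈ (U ⊕ (κ (+ 2) ⊗ v ⊕ κ (+ 8) ⊗ Z₃)) ⊗ β ^ᴾ 3 mod (+ 16)
𝐅-D =
  combine-mod (⊖ (V⁺ ⊗ 𝐅 ⊗ α ⊗ κ (+ 2))) (≈-mod r-split)
  (combine-mod (⊖ (V⁺ ⊗ 𝐅 ⊗ α)) (≈-mod ΦΦ-r)
  (combine-mod V⁺ (≈-mod 𝐅-Φ)
  (multiple ((Z₃ ⊗ (ev r ⊕ v) ⊕ W₃ ⊗ V⁺) ⊗ β ^ᴾ 3)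
  (PS-Solver.solve 8 (λ F e v r p s a b →
      F :* (((con 1ℤ :+ con (+ 2) :* e) :* (con 1ℤ :+ con (+ 2) :* e) :- con (+ 4) :* (v :* v)) :* a)
      :+ (:- ((con 1ℤ :+ con (+ 2) :* e :+ con (+ 2) :* v) :* F :* a :* con (+ 2))) :* ((e :- v) :- r)
      :+ (:- ((con 1ℤ :+ con (+ 2) :* e :+ con (+ 2) :* v) :* F :* a)) :* (con 1ℤ :+ con (+ 2) :* r :- p)
      :+ (con 1ℤ :+ con (+ 2) :* e :+ con (+ 2) :* v) :* ((con 1ℤ :+ con (+ 2) :* s) :^ 4 :* b :^ 3 :- F :* p :* a)
      := (con 1ℤ :+ con (+ 2) :* e :+ (con (+ 2) :* v :+ con (+ 8) :* (s :+ s :* s))) :* b :^ 3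
         :+ con (+ 16) :* (((s :+ s :* s) :* (e :+ v) :+ (s :^ 2 :+ con (+ 2) :* s :^ 3 :+ s :^ 4) :* (con 1ℤ :+ con (+ 2) :* e :+ con (+ 2) :* v)) :* b :^ 3))
    ≈-refl 𝐅 (ev r) v r (Φ 1 ⊗ Φ 3) (S 3) α β))))

U-Even : Even U
U-Even = Even-⊕ (Even-κ 1ℤ) (Even-⊗ (Even-κ (+ 2)) (ev-Even r))

D-Even : Even D
D-Even = Even-⊕ (Even-⊗ U-Even U-Even) (Even-⊖ (Even-⊗ (Even-κ (+ 4)) (Odd-⊗-Odd v-Odd v-Odd)))

^-Even : ∀ {x} → Even x → ∀ n → Even (x ^ᴾ n)
^-Even ex zero    = Even-κ 1ℤ
^-Even ex (suc n) = Even-⊗ ex (^-Even ex n)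

α-Even : Even α
α-Even = ^-Even (𝐟-Even {2} refl) 3

β³-Even : Even (β ^ᴾ 3)
β³-Even = ^-Even (^-Even (𝐟-Even {6} refl) 3) 3

od-Z₃ : od Z₃ ≈ ⊖ O 3 mod (+ 2)
od-Z₃ = combine-mod (κ 1ℤ) (≈-mod (od-⊕ (S 3) (S 3 ⊗ S 3)))
  (combine-mod (κ 1ℤ) (≈-mod (od-unique (S-split {3} 1≤) (E-Even 3) (Odd-⊖ (O-Odd 3 refl))))
  (combine-mod (κ 1ℤ) (od-square (S 3))
  (≈-mod (PS-Solver.solve 4 (λ z s t o → z :+ con 1ℤ :* (s :+ t :- z) :+ con 1ℤ :* (:- o :- s) :+ con 1ℤ :* (con 0ℤ :- t) := :- o)
    ≈-refl (od Z₃) (od (S 3)) (od (S 3 ⊗ S 3)) (O 3)))))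

od-sum : od (U ⊕ (κ (+ 2) ⊗ v ⊕ κ (+ 8) ⊗ Z₃)) ≈ κ (+ 2) ⊗ v ⊕ κ (+ 8) ⊗ od Z₃
od-sum = od-unique {e = U ⊕ κ (+ 8) ⊗ ev Z₃}
  (combine (κ (+ 8)) (ev⊕od Z₃) (PS-Solver.solve 5 (λ u v z e o →
      u :+ (con (+ 2) :* v :+ con (+ 8) :* z) :+ con (+ 8) :* (e :+ o :- z) := u :+ con (+ 8) :* e :+ (con (+ 2) :* v :+ con (+ 8) :* o))
    ≈-refl U v Z₃ (ev Z₃) (od Z₃)))
  (Even-⊕ U-Even (Even-⊗ (Even-κ (+ 8)) (ev-Even Z₃)))
  (Odd-⊕ (κ-Odd (+ 2) v-Odd) (κ-Odd (+ 8) (od-Odd Z₃)))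
  where
  κ-Odd : ∀ c {x} → Odd x → Odd (κ c ⊗ x)
  κ-Odd c {x} ox = isOdd λ n p → trans (coeff-κ-⊗ c x n) (trans (cong (c ℤ.*_) (even-vanish ox n p)) (ℤₚ.*-zeroʳ c))

od-𝐅-D : od 𝐅 ⊗ (D ⊗ α) ≈ (κ (+ 2) ⊗ v ⊕ κ (+ 8) ⊗ ⊖ O 3) ⊗ β ^ᴾ 3 mod (+ 16)
od-𝐅-D =
  combine-mod (⊖ κ 1ℤ) (≈-mod (od-⊗ 𝐅 (Even-⊗ D-Even α-Even)))
  (combine-mod (κ 1ℤ) (od-mod 𝐅-D)
  (combine-mod (κ 1ℤ) (≈-mod (od-⊗ (U ⊕ (κ (+ 2) ⊗ v ⊕ κ (+ 8) ⊗ Z₃)) β³-Even))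
  (combine-mod (β ^ᴾ 3) (≈-mod od-sum)
  (combine-mod (β ^ᴾ 3) (mod-scale (+ 8) od-Z₃)
  (≈-mod (PS-Solver.solve 8 (λ x y y′ z b v w o →
      x :+ (:- con 1ℤ) :* (x :- y) :+ con 1ℤ :* (y′ :- y) :+ con 1ℤ :* (z :* b :- y′)
      :+ b :* (con (+ 2) :* v :+ con (+ 8) :* w :- z) :+ b :* (con (+ 8) :* :- o :- con (+ 8) :* w)
      := (con (+ 2) :* v :+ con (+ 8) :* :- o) :* b)
    ≈-refl (od 𝐅 ⊗ (D ⊗ α)) (od (𝐅 ⊗ (D ⊗ α))) (od ((U ⊕ (κ (+ 2) ⊗ v ⊕ κ (+ 8) ⊗ Z₃)) ⊗ β ^ᴾ 3))
      (od (U ⊕ (κ (+ 2) ⊗ v ⊕ κ (+ 8) ⊗ Z₃))) (β ^ᴾ 3) v (od Z₃) (O 3)))))))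

-- q `T₆` is the value modulo 8 of v f₆⁹ divided by D f₂³, as `principal` shows.
T₆ : PS
T₆ = 𝐟 12 ^ᴾ 6 ⊗ (Φ 6 ⊗ Φ 6)

-- The extra f₂ completes `α` to f₂⁴ = f₄² φ(-q²)², to which `D-Φ` applies. This gives f₄² f₁₂⁶
-- φ(-q⁶)⁴ = f₄² f₆⁸ f₁₂², and the triangular identities turn f₄² and f₁₂² into `Ψ 2` and `Ψ 6`.
principal : mono 3 ⊗ T₆ ⊗ (D ⊗ (𝐟 2 ⊗ α)) ≈ mono 2 ⊗ 𝐟 2 ⊗ v ⊗ β ^ᴾ 3 mod (+ 8)
principal =
  combine-mod (mono 3 ⊗ T₆ ⊗ D ⊗ (𝐟 2 ⊗ 𝐟 2 ⊕ 𝐟 4 ⊗ Φ 2)) (≈-mod (theta {2} 1≤))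
  (combine-mod (mono 3 ⊗ T₆ ⊗ 𝐟 4 ⊗ 𝐟 4) D-Φ
  (combine-mod (mono 3 ⊗ 𝐟 12 ^ᴾ 2 ⊗ 𝐟 4 ⊗ 𝐟 4 ⊗ ((𝐟 12 ⊗ Φ 6) ^ᴾ 3 ⊕ (𝐟 12 ⊗ Φ 6) ^ᴾ 2 ⊗ (𝐟 6 ⊗ 𝐟 6) ⊕ (𝐟 12 ⊗ Φ 6) ⊗ (𝐟 6 ⊗ 𝐟 6) ^ᴾ 2 ⊕ (𝐟 6 ⊗ 𝐟 6) ^ᴾ 3)) (≈-mod (≈-sym (theta {6} 1≤)))
  (combine-mod (mono 3 ⊗ 𝐟 4 ⊗ 𝐟 4 ⊗ 𝐟 6 ^ᴾ 8) (≈-mod (triangular {6} 1≤))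
  (combine-mod (mono 3 ⊗ 𝐟 6 ^ᴾ 9 ⊗ Ψ 6) (≈-mod (triangular {2} 1≤))
  (combine-mod (𝐟 6 ^ᴾ 9 ⊗ Ψ 6 ⊗ 𝐟 2 ⊗ Ψ 2) (≈-mod (mono-+ 2 1))
  (≈-mod (PS-Solver.solve 12 (λ m₃ m₂ q d f₂ f₄ f₆ f₁₂ p₂ p₆ ψ₂ ψ₆ →
      m₃ :* (f₁₂ :^ 6 :* (p₆ :* p₆)) :* (d :* (f₂ :* f₂ :^ 3))
      :+ m₃ :* (f₁₂ :^ 6 :* (p₆ :* p₆)) :* d :* (f₂ :* f₂ :+ f₄ :* p₂) :* (f₄ :* p₂ :- f₂ :* f₂)
      :+ m₃ :* (f₁₂ :^ 6 :* (p₆ :* p₆)) :* f₄ :* f₄ :* (p₆ :* p₆ :- d :* (p₂ :* p₂))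
      :+ m₃ :* f₁₂ :^ 2 :* f₄ :* f₄ :* ((f₁₂ :* p₆) :^ 3 :+ (f₁₂ :* p₆) :^ 2 :* (f₆ :* f₆) :+ (f₁₂ :* p₆) :* (f₆ :* f₆) :^ 2 :+ (f₆ :* f₆) :^ 3) :* (f₆ :* f₆ :- f₁₂ :* p₆)
      :+ m₃ :* f₄ :* f₄ :* f₆ :^ 8 :* (f₆ :* ψ₆ :- f₁₂ :* f₁₂)
      :+ m₃ :* f₆ :^ 9 :* ψ₆ :* (f₂ :* ψ₂ :- f₄ :* f₄)
      :+ f₆ :^ 9 :* ψ₆ :* f₂ :* ψ₂ :* (m₂ :* q :- m₃)
      := m₂ :* f₂ :* (q :* (ψ₂ :* ψ₆)) :* (f₆ :^ 3) :^ 3)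
    ≈-refl (mono 3) (mono 2) q D (𝐟 2) (𝐟 4) (𝐟 6) (𝐟 12) (Φ 2) (Φ 6) (Ψ 2) (Ψ 6))))))))

-- `D` is 1 modulo 2, so this is `Y₂-α`; the factors `D` and `𝐟 2` match the unit of `principal`.
secondary : O 3 ⊗ Y₂ ⊗ (D ⊗ (𝐟 2 ⊗ α)) ≈ mono 2 ⊗ 𝐟 2 ⊗ O 3 ⊗ β ^ᴾ 3 mod (+ 2)
secondary =
  combine-mod (O 3 ⊗ 𝐟 2 ⊗ D) Y₂-α
  (multiple (mono 2 ⊗ β ^ᴾ 3 ⊗ O 3 ⊗ 𝐟 2 ⊗ (κ (+ 2) ⊗ (ev r ⊕ ev r ⊗ ev r ⊕ ⊖ (v ⊗ v))))
  (PS-Solver.solve 8 (λ o y e v f₂ a m b →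
      o :* y :* (((con 1ℤ :+ con (+ 2) :* e) :* (con 1ℤ :+ con (+ 2) :* e) :- con (+ 4) :* (v :* v)) :* (f₂ :* a))
      :+ o :* f₂ :* ((con 1ℤ :+ con (+ 2) :* e) :* (con 1ℤ :+ con (+ 2) :* e) :- con (+ 4) :* (v :* v)) :* (m :* b :- y :* a)
      := m :* f₂ :* o :* b :+ con (+ 2) :* (m :* b :* o :* f₂ :* (con (+ 2) :* (e :+ e :* e :- v :* v))))
    ≈-refl (O 3) Y₂ (ev r) v (𝐟 2) α (mono 2) (β ^ᴾ 3)))

-- The factor q² clears the q⁻² in f₆⁹/f₂³ ≡ q⁻² `Y₂`.
od-𝐅 : mono 2 ⊗ od 𝐅 ≈ κ (+ 2) ⊗ (mono 3 ⊗ T₆) ⊕ κ (+ 8) ⊗ ⊖ (O 3 ⊗ Y₂) mod (+ 16)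
od-𝐅 = unit-cancel-mod (D ⊗ (𝐟 2 ⊗ α)) refl
  (combine-mod (mono 2 ⊗ 𝐟 2) od-𝐅-D
  (combine-mod (κ 1ℤ) (mod-scale (+ 2) (mod-sym principal))
  (combine-mod (⊖ κ 1ℤ) (mod-scale (+ 8) (mod-sym secondary))
  (≈-mod (PS-Solver.solve 10 (λ F d f₂ a m v o b t y →
      d :* (f₂ :* a) :* (m :* F)
      :+ m :* f₂ :* ((con (+ 2) :* v :+ con (+ 8) :* :- o) :* b :- F :* (d :* a))
      :+ con 1ℤ :* (con (+ 2) :* (t :* (d :* (f₂ :* a))) :- con (+ 2) :* (m :* f₂ :* v :* b))
      :+ (:- con 1ℤ) :* (con (+ 8) :* (o :* y :* (d :* (f₂ :* a))) :- con (+ 8) :* (m :* f₂ :* o :* b))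
      := d :* (f₂ :* a) :* (con (+ 2) :* t :+ con (+ 8) :* :- (o :* y)))
    ≈-refl (od 𝐅) D (𝐟 2) α (mono 2) v (O 3) (β ^ᴾ 3) (mono 3 ⊗ T₆) Y₂)))))

-- Exponents modulo 6 and 24

record Sixfold (x : PS) : Set where
  constructor sixfold
  field
    vanish : ∀ n → n % 6 ≢ 0 → coeff x n ≡ 0ℤ

open Sixfold

Sixfold-⊕ : ∀ {x y} → Sixfold x → Sixfold y → Sixfold (x ⊕ y)
Sixfold-⊕ p q = sixfold λ n h → cong₂ ℤ._+_ (vanish p n h) (vanish q n h)

Sixfold-⊖ : ∀ {x} → Sixfold x → Sixfold (⊖ x)
Sixfold-⊖ p = sixfold λ n h → cong -_ (vanish p n h)

Sixfold-⊗ : ∀ {x y} → Sixfold x → Sixfold y → Sixfold (x ⊗ y)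
Sixfold-⊗ {x} {y} p q = sixfold λ n h → ·-vanish (coeff x) (coeff y) n (go n h)
  where
  go : ∀ n → n % 6 ≢ 0 → ∀ j k → j + k ≡ n → coeff x j ≡ 0ℤ ⊎ coeff y k ≡ 0ℤ
  go n h j k refl with j % 6 ℕ.≟ 0 | k % 6 ℕ.≟ 0
  ... | no j≢0 | _      = inj₁ (vanish p j j≢0)
  ... | yes _  | no k≢0 = inj₂ (vanish q k k≢0)
  ... | yes j≡0 | yes k≡0 = ⊥-elim (h (trans (%-distribˡ-+ j k 6) (cong₂ (λ a b → (a + b) % 6) j≡0 k≡0)))

Sixfold-κ : ∀ c → Sixfold (κ c)
Sixfold-κ c = sixfold λ { zero h → ⊥-elim (h refl) ; (suc n) h → refl }

Sixfold-mono : ∀ e → e % 6 ≡ 0 → Sixfold (mono e)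
Sixfold-mono e p = sixfold λ n h → coeff-mono-≢ e n λ { refl → h p }

Sixfold-≈ : ∀ {x y} → x ≈ y → Sixfold x → Sixfold y
Sixfold-≈ e p = sixfold λ n h → trans (sym (at e n)) (vanish p n h)

Sixfold-fin : ∀ n → Sixfold (fin 12 n)
Sixfold-fin zero    = Sixfold-≈ (≈-sym (fin-zero 12)) (Sixfold-κ 1ℤ)
Sixfold-fin (suc n) = Sixfold-≈ (≈-sym (fin-suc 12 n)) (Sixfold-⊗ (Sixfold-⊕ (Sixfold-κ 1ℤ) (Sixfold-⊖ (Sixfold-mono (12 * suc n)
  (trans (cong (_% 6) (identity n)) (m*n%n≡0 (2 * suc n) 6))))) (Sixfold-fin n))
  where
  identity : ∀ n → 12 * suc n ≡ 2 * suc n * 6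
  identity = ℕ-Solver.solve-∀

Sixfold-S : Sixfold (S 6)
Sixfold-S = sixfold λ n h → ∑-zero (suc n) λ i _ → vanish (term i) n h
  where
  term : ∀ i → Sixfold (S-term 6 i)
  term i = Sixfold-⊗ (Sixfold-κ (sgn (suc i))) (Sixfold-mono (6 * (suc i * suc i)) (trans (cong (_% 6) (ℕₚ.*-comm 6 (suc i * suc i))) (m*n%n≡0 (suc i * suc i) 6)))

Sixfold-T₆ : Sixfold T₆
Sixfold-T₆ = Sixfold-⊗ (power 6) (Sixfold-⊗ Sixfold-Φ Sixfold-Φ)
  where
  Sixfold-Φ : Sixfold (Φ 6)
  Sixfold-Φ = Sixfold-⊕ (Sixfold-κ 1ℤ) (Sixfold-⊗ (Sixfold-κ (+ 2)) Sixfold-S)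
  power : ∀ n → Sixfold (𝐟 12 ^ᴾ n)
  power zero    = Sixfold-κ 1ℤ
  power (suc n) = Sixfold-⊗ (sixfold λ k h → vanish (Sixfold-fin k) k h) (power n)

-- 3 (2i+1)² is 3 plus 24 times a triangular number.
O₃-vanish : ∀ j → j % 24 ≢ 3 → coeff (O 3) j ≡ 0ℤ
O₃-vanish j h = ∑-zero (suc j) λ i _ → coeff-mono-≢ (3 * (suc (i + i) * suc (i + i))) j λ { refl → h (residue i) }
  where
  residue : ∀ i → (3 * (suc (i + i) * suc (i + i))) % 24 ≡ 3
  residue i = trans (cong (_% 24) (trans (identity₁ i) (trans (cong (λ p → 3 + p * 12) (sym (2*tri i))) (identity₂ (tri i))))) ([m+kn]%n≡m%n 3 (tri i) 24)
    where
    identity₁ : ∀ i → 3 * (suc (i + i) * suc (i + i)) ≡ 3 + i * suc i * 12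
    identity₁ = ℕ-Solver.solve-∀
    identity₂ : ∀ t → 3 + 2 * t * 12 ≡ 3 + t * 24
    identity₂ = ℕ-Solver.solve-∀

-- d s² modulo 24 depends only on s modulo 24, which leaves a finite check.
S-vanish : ∀ d N → (∀ {r} → r < 24 → (d * (r * r)) % 24 ≢ N % 24) → coeff (S d) N ≡ 0ℤ
S-vanish d N h = ∑-zero (suc N) λ i _ → trans (coeff-κ-⊗ (sgn (suc i)) (mono (d * (suc i * suc i))) N)
  (trans (cong (sgn (suc i) ℤ.*_) (coeff-mono-≢ (d * (suc i * suc i)) N λ { refl → h (m%n<n (suc i) 24) (sym (residue (suc i))) })) (ℤₚ.*-zeroʳ (sgn (suc i))))
  where
  residue : ∀ s → (d * (s * s)) % 24 ≡ (d * ((s % 24) * (s % 24))) % 24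
  residue s = trans (cong (λ t → (d * (t * t)) % 24) (m≡m%n+[m/n]*n s 24))
    (trans (cong (_% 24) (identity d (s % 24) (s / 24))) ([m+kn]%n≡m%n (d * ((s % 24) * (s % 24))) (d * (2 * (s % 24) * (s / 24) + 24 * ((s / 24) * (s / 24)))) 24))
    where
    identity : ∀ d r t → d * ((r + t * 24) * (r + t * 24)) ≡ d * (r * r) + d * (2 * r * t + 24 * (t * t)) * 24
    identity = ℕ-Solver.solve-∀

-- Modulo 24 the values of 2s² are 0, 2, 8, 18, those of 4s² are 0, 4, 12, 16, those of 6s² are 0, 6
-- and those of 12s² are 0, 12.
Y₂-vanish : ∀ N → N % 24 ≡ 14 ⊎ N % 24 ≡ 20 → coeff Y₂ N ≡ 0ℤ
Y₂-vanish N h = cong₂ ℤ._+_ (cong₂ ℤ._+_ (cong₂ ℤ._+_ (S-zero 2 (from-yes (avoids? 2))) (S-zero 4 (from-yes (avoids? 4)))) (S-zero 6 (from-yes (avoids? 6)))) (S-zero 12 (from-yes (avoids? 12)))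
  where
  Avoids : ℕ → Set
  Avoids d = ∀ {r} → r < 24 → (d * (r * r)) % 24 ≢ 14 × (d * (r * r)) % 24 ≢ 20
  avoids? : ∀ d → Dec (Avoids d)
  avoids? d = ℕₚ.allUpTo? (λ r → ¬? ((d * (r * r)) % 24 ℕ.≟ 14) ×-dec ¬? ((d * (r * r)) % 24 ℕ.≟ 20)) 24
  S-zero : ∀ d → Avoids d → coeff (S d) N ≡ 0ℤ
  S-zero d avoids = S-vanish d N λ r<24 e → go (avoids r<24) e h
    where
    go : ∀ {a b} → a ≢ 14 × a ≢ 20 → a ≡ b → b ≡ 14 ⊎ b ≡ 20 → ⊥
    go (p , _) refl (inj₁ refl) = p refl
    go (_ , p) refl (inj₂ refl) = p refl

O₃Y₂-vanish : ∀ M → M % 24 ≡ 17 ⊎ M % 24 ≡ 23 → coeff (O 3 ⊗ Y₂) M ≡ 0ℤ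
O₃Y₂-vanish M h = ·-vanish (coeff (O 3)) (coeff Y₂) M go
  where
  complement : ∀ {r} → r < 24 → ((3 + r) % 24 ≡ 17 → r ≡ 14) × ((3 + r) % 24 ≡ 23 → r ≡ 20)
  complement = from-yes (ℕₚ.allUpTo? (λ r → (((3 + r) % 24 ℕ.≟ 17) →-dec (r ℕ.≟ 14)) ×-dec (((3 + r) % 24 ℕ.≟ 23) →-dec (r ℕ.≟ 20))) 24)
  go : ∀ j k → j + k ≡ M → coeff (O 3) j ≡ 0ℤ ⊎ coeff Y₂ k ≡ 0ℤ
  go j k refl with j % 24 ℕ.≟ 3
  ... | no j≢3  = inj₁ (O₃-vanish j j≢3)
  ... | yes j≡3 = inj₂ (Y₂-vanish k (residue h))
    where
    sum : (j + k) % 24 ≡ (3 + k % 24) % 24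
    sum = trans (%-distribˡ-+ j k 24) (cong (λ a → (a + k % 24) % 24) j≡3)
    residue : (j + k) % 24 ≡ 17 ⊎ (j + k) % 24 ≡ 23 → k % 24 ≡ 14 ⊎ k % 24 ≡ 20
    residue (inj₁ e) = inj₁ (proj₁ (complement (m%n<n k 24)) (trans (sym sum) e))
    residue (inj₂ e) = inj₂ (proj₂ (complement (m%n<n k 24)) (trans (sym sum) e))

-- Exponent `suc j` appears in `od-𝐅` as 3 + j, so 15 and 21 become 17 and 23, while q³ `T₆` at 3 +
-- j is `T₆` at j, outside its support when j ≡ 2 modulo 6.
divisible : ∀ j → parity (suc j) ≡ true → j % 6 ≡ 2 → (3 + j) % 24 ≡ 17 ⊎ (3 + j) % 24 ≡ 23 → + 16 ∣ CP3 (suc j)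
divisible j odd j≡2 residue = Signed.∣⇒∣ᵤ (Signed.divides (coeff (quotient od-𝐅) (3 + j)) (begin
  CP3 (suc j)                    ≡⟨ cong (λ b → if b then CP3 (suc j) else 0ℤ) odd ⟨
  coeff (od 𝐅) (suc j)           ≡⟨ coeff-mono-⊗ 2 (od 𝐅) (suc j) ⟨
  coeff (mono 2 ⊗ od 𝐅) (3 + j)  ≡⟨ mod-coeff od-𝐅 (3 + j) ⟩
  coeff (κ (+ 2) ⊗ (mono 3 ⊗ T₆)) (3 + j) ℤ.+ coeff (κ (+ 8) ⊗ ⊖ (O 3 ⊗ Y₂)) (3 + j) ℤ.+ + 16 ℤ.* quo
    ≡⟨ cong₂ (λ a b → a ℤ.+ b ℤ.+ + 16 ℤ.* quo) first second ⟩
  0ℤ ℤ.+ 0ℤ ℤ.+ + 16 ℤ.* quo     ≡⟨ trans (ℤₚ.+-identityˡ (+ 16 ℤ.* quo)) (ℤₚ.*-comm (+ 16) quo) ⟩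
  quo ℤ.* + 16                   ∎))
  where
  open ≡-Reasoning
  quo = coeff (quotient od-𝐅) (3 + j)
  first : coeff (κ (+ 2) ⊗ (mono 3 ⊗ T₆)) (3 + j) ≡ 0ℤ
  first = trans (coeff-κ-⊗ (+ 2) (mono 3 ⊗ T₆) (3 + j)) (cong (+ 2 ℤ.*_) (trans (coeff-mono-⊗ 3 T₆ j)
    (vanish Sixfold-T₆ j λ j≡0 → 2≢0 (trans (sym j≡2) j≡0))))
    where
    2≢0 : 2 ≢ 0
    2≢0 ()
  second : coeff (κ (+ 8) ⊗ ⊖ (O 3 ⊗ Y₂)) (3 + j) ≡ 0ℤ
  second = trans (coeff-κ-⊗ (+ 8) (⊖ (O 3 ⊗ Y₂)) (3 + j)) (cong (λ c → + 8 ℤ.* - c) (O₃Y₂-vanish (3 + j) residue))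

theorem3p7 : (n : ℕ) →
    ((+ 16) ∣ CP3 (24 * n + 15)) × ((+ 16) ∣ CP3 (24 * n + 21))
theorem3p7 n = subst (λ m → + 16 ∣ CP3 m) (sym (suc-14 n))
      (divisible (24 * n + 14) (trans (cong parity (odd-15 n)) (cong not (parity-double (12 * n + 7))))
        (trans (cong (_% 6) (mod-6-14 n)) ([m+kn]%n≡m%n 2 (4 * n + 2) 6))
        (inj₁ (trans (cong (_% 24) (mod-24-17 n)) ([m+kn]%n≡m%n 17 n 24))))
  , subst (λ m → + 16 ∣ CP3 m) (sym (suc-20 n))
      (divisible (24 * n + 20) (trans (cong parity (odd-21 n)) (cong not (parity-double (12 * n + 10))))
        (trans (cong (_% 6) (mod-6-20 n)) ([m+kn]%n≡m%n 2 (4 * n + 3) 6))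
        (inj₂ (trans (cong (_% 24) (mod-24-23 n)) ([m+kn]%n≡m%n 23 n 24))))
  where
  suc-14 : ∀ n → 24 * n + 15 ≡ suc (24 * n + 14)
  suc-14 = ℕ-Solver.solve-∀
  suc-20 : ∀ n → 24 * n + 21 ≡ suc (24 * n + 20)
  suc-20 = ℕ-Solver.solve-∀
  odd-15 : ∀ n → suc (24 * n + 14) ≡ suc ((12 * n + 7) + (12 * n + 7))
  odd-15 = ℕ-Solver.solve-∀
  odd-21 : ∀ n → suc (24 * n + 20) ≡ suc ((12 * n + 10) + (12 * n + 10))
  odd-21 = ℕ-Solver.solve-∀
  mod-6-14 : ∀ n → 24 * n + 14 ≡ 2 + (4 * n + 2) * 6
  mod-6-14 = ℕ-Solver.solve-∀
  mod-6-20 : ∀ n → 24 * n + 20 ≡ 2 + (4 * n + 3) * 6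
  mod-6-20 = ℕ-Solver.solve-∀
  mod-24-17 : ∀ n → 3 + (24 * n + 14) ≡ 17 + n * 24
  mod-24-17 = ℕ-Solver.solve-∀
  mod-24-23 : ∀ n → 3 + (24 * n + 20) ≡ 23 + n * 24
  mod-24-23 = ℕ-Solver.solve-∀
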